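{- For any positive integers $n$ and $r$ there are bijections (i) from $r$-colored partitions of $[n]$ to vacillating $r$-partite tableaux of length $2n$; (ii) from $r$-colored matchings of $[n]$ to semi-oscillating $r$-partite tableaux of length $n$; (iii) from $r$-colored complete matchings of $[2n]$ to oscillating $r$-partite tableaux of length $2n$; such that for each of these bijections, if $\Lambda\mapsto(\boldsymbol\lambda^0,\boldsymbol\lambda^1,\dots)$, then for all positive integers $j,k$ we have $\mathrm{cr}(\Lambda)<j$ and $\mathrm{ne}(\Lambda)<k$ if and only if each of the $r$ components of every $\boldsymbol\lambda^i$ has fewer than $j$ columns and fewer than $k$ rows.
   Context: For a partition $P$ of $[n]=\{1,\dots,n\}$, $\mathrm{Arc}(P)$ is the set of pairs $(i,j)$ with $i,j$ in the same block and $j$ the least element of that block greater than $i$. A $k$-crossing is a sequence of arcs with $i_1<\dots<i_k<j_1<\dots<j_k$, a $k$-nesting one with $i_1<\dots<i_k<j_k<\dots<j_1$. An $r$-colored partition is $\Lambda=(P,\varphi)$ with $\varphi:\mathrm{Arc}(P)\to[r]$; $\mathrm{cr}(\Lambda)$ ($\mathrm{ne}(\Lambda)$) is the largest $k$ such that $P$ has a $k$-crossing ($k$-nesting) whose arcs all have the same color. An $r$-colored matching is an $r$-colored partition all of whose blocks have size $1$ or $2$; it is complete if all blocks have size $2$. An integer partition $\lambda$ is identified with its Young diagram; its number of rows is its number of parts and its number of columns is its largest part. An $r$-partite partition is a sequence $\boldsymbol\lambda=(\lambda^1,\dots,\lambda^r)$ of integer partitions; adding (deleting) a box means adding (deleting)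 one box in one component so that the result is again an $r$-partite partition; $\boldsymbol\mu\subseteq\boldsymbol\lambda$ means componentwise inclusion of Young diagrams. A semi-oscillating $r$-partite tableau of length $m$ is a sequence $(\boldsymbol\lambda^0,\dots,\boldsymbol\lambda^m)$ with $\boldsymbol\lambda^0=\boldsymbol\lambda^m$ the empty $r$-partite partition and each $\boldsymbol\lambda^i$ obtained from $\boldsymbol\lambda^{i-1}$ by adding a box, deleting a box, or doing nothing. It is vacillating if moreover $\boldsymbol\lambda^{i-1}\subseteq\boldsymbol\lambda^i$ for even $i$ and $\boldsymbol\lambda^{i-1}\supseteq\boldsymbol\lambda^i$ for odd $i$, and oscillating if $\boldsymbol\lambda^{i-1}\neq\boldsymbol\lambda^i$ for all $i$. -}

module Defs where

open import Data.Nat using (ℕ; zero; suc; _+_; _≤_; _<_; _⊔_)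
open import Data.Fin as F using (Fin; toℕ; inject₁)
open import Data.Bool using (Bool; true; false)
open import Data.List using (List; []; _∷_; length; foldr)
open import Data.Nat.ListAction using (sum)
open import Data.List.Relation.Unary.All using (All)
open import Data.List.Relation.Unary.Linked using (Linked)
open import Data.Product using (Σ; _×_; _,_)
open import Data.Sum using (_⊎_)
open import Relation.Nullary using (¬_)
open import Relation.Binary.PropositionalEquality using (_≡_; _≢_)

record SetPartition (n : ℕ) : Set where
  field
    same      : Fin n → Fin n → Bool
    same-refl : ∀ i → same i i ≡ true
    same-sym  : ∀ i j → same i j ≡ same j i
    same-trans : ∀ i j k → same i j ≡ true → same j k ≡ true → same i k ≡ true

open SetPartition public

Arc : ∀ {n} → SetPartition n → Fin n → Fin n → Set
Arc P i j = (same P i j ≡ true) × (i F.< j) ×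
            (∀ k → i F.< k → k F.< j → same P i k ≡ false)

-- r-colored partition: a partition together with a coloring of its arcs.
-- The coloring is given as a function on all pairs; only its values on
-- arcs are relevant (see the equality _≈CP_ below).
record ColPartition (n r : ℕ) : Set where
  field
    part : SetPartition n
    col  : Fin n → Fin n → Fin r

open ColPartition public

_≈CP_ : ∀ {n r} → ColPartition n r → ColPartition n r → Set
Λ ≈CP Λ' = (∀ i j → same (part Λ) i j ≡ same (part Λ') i j) ×
           (∀ i j → Arc (part Λ) i j → col Λ i j ≡ col Λ' i j)

IsMatching : ∀ {n} → SetPartition n → Set
IsMatching P = ∀ i j k → same P i j ≡ true → same P i k ≡ true →
               j ≢ i → k ≢ i → j ≡ k

IsCompleteMatching : ∀ {n} → SetPartition n → Set
IsCompleteMatching P = IsMatching P × (∀ i → Σ (Fin _) λ j → (j ≢ i) × (same P i j ≡ true))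

ColMatching : ℕ → ℕ → Set
ColMatching n r = Σ (ColPartition n r) λ Λ → IsMatching (part Λ)

ColCompleteMatching : ℕ → ℕ → Set
ColCompleteMatching n r = Σ (ColPartition n r) λ Λ → IsCompleteMatching (part Λ)

Crossing : ∀ {n r} → ColPartition n r → ℕ → Set
Crossing {n} {r} Λ k =
  Σ (Fin k → Fin n) λ is → Σ (Fin k → Fin n) λ js → Σ (Fin r) λ c →
    (∀ a b → a F.< b → is a F.< is b) ×
    (∀ a b → a F.< b → js a F.< js b) ×
    (∀ a b → is a F.< js b) ×
    (∀ a → Arc (part Λ) (is a) (js a) × (col Λ (is a) (js a) ≡ c))

Nesting : ∀ {n r} → ColPartition n r → ℕ → Set
Nesting {n} {r} Λ k =
  Σ (Fin k → Fin n) λ is → Σ (Fin k → Fin n) λ js → Σ (Fin r) λ c →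
    (∀ a b → a F.< b → is a F.< is b) ×
    (∀ a b → a F.< b → js b F.< js a) ×
    (∀ a b → is a F.< js b) ×
    (∀ a → Arc (part Λ) (is a) (js a) × (col Λ (is a) (js a) ≡ c))

-- cr(Λ) < j : the largest k admitting a monochromatic k-crossing is < j
CrLess : ∀ {n r} → ColPartition n r → ℕ → Set
CrLess Λ j = ∀ k → Crossing Λ k → k < j

NeLess : ∀ {n r} → ColPartition n r → ℕ → Set
NeLess Λ j = ∀ k → Nesting Λ k → k < j

_≥ℕ_ : ℕ → ℕ → Set
m ≥ℕ n = n ≤ m

record IntPartition : Set where
  field
    parts : List ℕ
    decr  : Linked _≥ℕ_ parts
    pos   : All (λ x → 0 < x) parts

open IntPartition public

nth : List ℕ → ℕ → ℕ
nth []       _       = 0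
nth (x ∷ xs) zero    = x
nth (x ∷ xs) (suc t) = nth xs t

rows : IntPartition → ℕ
rows λ' = length (parts λ')

cols : IntPartition → ℕ
cols λ' = foldr _⊔_ 0 (parts λ')

size : IntPartition → ℕ
size λ' = sum (parts λ')

_⊆Y_ : IntPartition → IntPartition → Set
λ' ⊆Y μ = ∀ t → nth (parts λ') t ≤ nth (parts μ) t

AddY : IntPartition → IntPartition → Set
AddY λ' μ = (λ' ⊆Y μ) × (size μ ≡ suc (size λ'))

MultiPart : ℕ → Set
MultiPart r = Fin r → IntPartition

_≈M_ : ∀ {r} → MultiPart r → MultiPart r → Set
L ≈M M = ∀ c → parts (L c) ≡ parts (M c)

_⊆M_ : ∀ {r} → MultiPart r → MultiPart r → Set
L ⊆M M = ∀ c → L c ⊆Y M c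

IsEmptyM : ∀ {r} → MultiPart r → Set
IsEmptyM L = ∀ c → parts (L c) ≡ []

AddM : ∀ {r} → MultiPart r → MultiPart r → Set
AddM {r} L M = Σ (Fin r) λ c → AddY (L c) (M c) ×
                 (∀ c' → c' ≢ c → parts (L c') ≡ parts (M c'))

StepM : ∀ {r} → MultiPart r → MultiPart r → Set
StepM L M = AddM L M ⊎ AddM M L ⊎ L ≈M M

record SemiOsc (r m : ℕ) : Set where
  field
    seq   : Fin (suc m) → MultiPart r
    start : IsEmptyM (seq F.zero)
    end   : IsEmptyM (seq (F.fromℕ m))
    step  : ∀ (i : Fin m) → StepM (seq (inject₁ i)) (seq (F.suc i))

open SemiOsc public

isEven : ℕ → Bool
isEven zero          = true
isEven (suc zero)    = false
isEven (suc (suc n)) = isEven n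

IsVacillating : ∀ {r m} → SemiOsc r m → Set
IsVacillating {r} {m} T = ∀ (i : Fin m) →
  (isEven (suc (toℕ i)) ≡ true  → seq T (inject₁ i) ⊆M seq T (F.suc i)) ×
  (isEven (suc (toℕ i)) ≡ false → seq T (F.suc i) ⊆M seq T (inject₁ i))

IsOscillating : ∀ {r m} → SemiOsc r m → Set
IsOscillating {r} {m} T = ∀ (i : Fin m) → ¬ (seq T (inject₁ i) ≈M seq T (F.suc i))

Vacillating : ℕ → ℕ → Set
Vacillating r m = Σ (SemiOsc r m) IsVacillating

Oscillating : ℕ → ℕ → Set
Oscillating r m = Σ (SemiOsc r m) IsOscillating

_≈T_ : ∀ {r m} → SemiOsc r m → SemiOsc r m → Set
T ≈T T' = ∀ i → seq T i ≈M seq T' i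

Bounded : ∀ {r m} → SemiOsc r m → ℕ → ℕ → Set
Bounded T j k = ∀ i c → (cols (seq T i c) < j) × (rows (seq T i c) < k)

record Bij {A B : Set} (_≈A_ : A → A → Set) (_≈B_ : B → B → Set) : Set where
  field
    to      : A → B
    from    : B → A
    to-cong   : ∀ {x y} → x ≈A y → to x ≈B to y
    from-cong : ∀ {x y} → x ≈B y → from x ≈A from y
    from-to : ∀ x → from (to x) ≈A x
    to-from : ∀ y → to (from y) ≈B y

open Bij public

CrNeProp : ∀ {n r m} {A B : Set} → (A → ColPartition n r) → (B → SemiOsc r m) → (A → B) → Set
CrNeProp {A = A} pa tb f = ∀ (Λ : A) (j k : ℕ) → 0 < j → 0 < k →
  (CrLess (pa Λ) j × NeLess (pa Λ) k → Bounded (tb (f Λ)) j k) ×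
  (Bounded (tb (f Λ)) j k → CrLess (pa Λ) j × NeLess (pa Λ) k)

{-# OPTIONS --safe #-}
module Submission where

-- An arc (s , t) is a mark in a triangular board.  Fomin's local rules turn a marked board into
-- Young diagrams at its vertices, and a board can be recovered from the diagrams along the diagonal
-- staircase, since the rules are reversible and any other edge label on the outer boundary would
-- remove a box from, or add one to reach, the empty diagram.  The staircase is the tableau: step t
-- closes the arc ending at t and then opens the one starting at t.  Each color has its own board.
-- A diagram is recorded by its column heights.  The first height obeys the recurrence of the longest
-- chain of nested arcs over the vertex.  Deleting the first column gives the growth of the skeleton
-- of Viennot's shadow lines, whose longest crossing is shorter by exactly one arc, so that the
-- number of columns is the length of the longest crossing over the vertex.

open import Defs
open import Data.Nat
open import Data.Nat.ListAction using (sum)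
open import Data.Nat.Properties
open import Data.Bool using (Bool; true; false; _∧_; if_then_else_)
import Data.Bool.Properties as Bool
open import Data.Empty using (⊥; ⊥-elim)
open import Data.Fin as F using (Fin; toℕ; fromℕ; fromℕ<; inject₁)
open import Data.Fin.Properties as F
  using (any?; all?; toℕ<n; toℕ-injective; toℕ-fromℕ<; toℕ-fromℕ; fromℕ<-toℕ; toℕ-inject₁)
open import Data.List using ([]; _∷_; length; applyUpTo; foldr)
open import Data.List.Relation.Unary.All using (All; []; _∷_)
import Data.List.Relation.Unary.All.Properties as All
open import Data.List.Relation.Unary.Linked using (Linked; []; [-]; _∷_)
import Data.List.Relation.Unary.Linked.Properties as Linked
open import Data.Maybe using (Maybe; just; nothing)
open import Data.Maybe.Properties using (just-injective)
open import Data.Product using (Σ; ∃; _×_; _,_; proj₁; proj₂)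
open import Data.Sum using (_⊎_; inj₁; inj₂)
open import Data.Unit using (⊤; tt)
open import Function using (flip; _∘_; Equivalence)
open import Relation.Binary using (Tri; tri<; tri≈; tri>)
open import Relation.Binary.PropositionalEquality
open import Relation.Nullary using (¬_; Dec; yes; no; does; contradiction)
open import Relation.Nullary.Decidable using (_×-dec_; _→-dec_; dec-true; dec-false)

-- An edge label names the column that gains a box, and the local rule reads labels only. Growing a
-- board forward or backward is thus a recursion on labels alone. Diagrams return where labels do
-- not suffice: that the labels grown backward vanish on the outer boundary follows from the
-- diagrams there being empty. Column heights suit the rule, because a clash in column i is pushed
-- to column i + 1; peeling then amounts to lowering every label by one. The bounds of the theorem
-- concern only the first height and the number of nonempty columns, the two extreme cases of
-- Greene's description of a diagram. A board sees arcs, not blocks. The bijections therefore pass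
-- through systems of arcs in which every point begins at most one arc and ends at most one; the
-- blocks are the paths that such arcs form. In a matching no point does both, so the diagram
-- between two steps is the smaller of its neighbors, and the tableau can leave it out.

-- Edge labels and the local rule

Label : Set
Label = Maybe ℕ

-- The growth of column `k` along an edge: `just i` puts one box into column `i`, and `nothing`
-- keeps the diagram.
δ : Label → ℕ → ℕ
δ nothing        _       = 0
δ (just zero)    zero    = 1
δ (just zero)    (suc k) = 0
δ (just (suc i)) zero    = 0
δ (just (suc i)) (suc k) = δ (just i) k

δ-diag : ∀ i → δ (just i) i ≡ 1
δ-diag zero    = refl
δ-diag (suc i) = δ-diag i

δ-off : ∀ {i k} → i ≢ k → δ (just i) k ≡ 0
δ-off {zero}  {zero}  i≢k = contradiction refl i≢k
δ-off {zero}  {suc k} i≢k = refl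
δ-off {suc i} {zero}  i≢k = refl
δ-off {suc i} {suc k} i≢k = δ-off (λ eq → i≢k (cong suc eq))

δ≢0 : ∀ l {k} → δ l k ≢ 0 → l ≡ just k
δ≢0 nothing            ne = contradiction refl ne
δ≢0 (just i) {k} ne with i ≟ k
... | yes refl = refl
... | no  i≢k  = contradiction (δ-off i≢k) ne

δ-zero⇒nothing : ∀ l → (∀ k → δ l k ≡ 0) → l ≡ nothing
δ-zero⇒nothing nothing  _ = refl
δ-zero⇒nothing (just i) z with trans (sym (δ-diag i)) (z i)
... | ()

δ-injective : ∀ l l' → (∀ k → δ l k ≡ δ l' k) → l ≡ l'
δ-injective nothing  l'       eq = sym (δ-zero⇒nothing l' (λ k → sym (eq k)))
δ-injective (just i) l'       eq = sym (δ≢0 l' (λ z → 1+n≢0 (trans (sym (δ-diag i)) (trans (eq i) z))))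

-- Fomin's local rule in terms of edge labels: h, v leave the smallest corner of
-- the cell, h′, v′ enter the largest one, and x tells whether the cell is marked.
data Cell : (h v : Label) (x : Bool) (h′ v′ : Label) → Set where
  idleᵛ : ∀ {h} → Cell h nothing false h nothing
  idleʰ : ∀ {j} → Cell nothing (just j) false nothing (just j)
  pass  : ∀ {i j} → i ≢ j → Cell (just i) (just j) false (just i) (just j)
  bump  : ∀ {i} → Cell (just i) (just i) false (just (suc i)) (just (suc i))
  mark  : Cell nothing nothing true (just 0) (just 0)

Cell-sym : ∀ {h v x h′ v′} → Cell h v x h′ v′ → Cell v h x v′ h′
Cell-sym {nothing} idleᵛ      = idleᵛ
Cell-sym {just _}  idleᵛ      = idleʰ
Cell-sym           idleʰ      = idleᵛ
Cell-sym           (pass i≢j) = pass (λ eq → i≢j (sym eq))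
Cell-sym           bump       = bump
Cell-sym           mark       = mark

Cell-δ : ∀ {h v x h′ v′} → Cell h v x h′ v′ → ∀ k → δ v k + δ h′ k ≡ δ h k + δ v′ k
Cell-δ {h} idleᵛ k = sym (+-identityʳ (δ h k))
Cell-δ (idleʰ {j}) k = +-identityʳ (δ (just j) k)
Cell-δ (pass {i} {j} _) k = +-comm (δ (just j) k) (δ (just i) k)
Cell-δ bump k = refl
Cell-δ mark k = refl

cellF : Label → Label → Bool → Label × Label
cellF nothing  nothing  true  = just 0 , just 0
cellF nothing  nothing  false = nothing , nothing
cellF nothing  (just j) _     = nothing , just j
cellF (just i) nothing  _     = just i , nothing
cellF (just i) (just j) _ with i ≟ j
... | yes _ = just (suc i) , just (suc i)
... | no  _ = just i , just j

-- No rule covers a mark with an incoming label, and there `cellF` falls back on a junk value. The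
-- hypothesis rules this out; `fresh` later derives it from the fact that marks form a partial
-- permutation.
cellF-Cell : ∀ h v x → (x ≡ true → h ≡ nothing × v ≡ nothing) →
             Cell h v x (proj₁ (cellF h v x)) (proj₂ (cellF h v x))
cellF-Cell nothing  nothing  true  _ = mark
cellF-Cell nothing  nothing  false _ = idleᵛ
cellF-Cell nothing  (just j) true  f with proj₂ (f refl)
... | ()
cellF-Cell nothing  (just j) false _ = idleʰ
cellF-Cell (just i) v        true  f with proj₁ (f refl)
... | ()
cellF-Cell (just i) nothing  false _ = idleᵛ
cellF-Cell (just i) (just j) false _ with i ≟ j
... | yes refl = bump
... | no  i≢j  = pass i≢j

Cell-forward : ∀ {h v x a b c e} → Cell h v x a b → Cell h v x c e → a ≡ c × b ≡ e
Cell-forward idleᵛ    idleᵛ    = refl , refl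
Cell-forward idleʰ    idleʰ    = refl , refl
Cell-forward (pass _) (pass _) = refl , refl
Cell-forward (pass n) bump     = contradiction refl n
Cell-forward bump     (pass n) = contradiction refl n
Cell-forward bump     bump     = refl , refl
Cell-forward mark     mark     = refl , refl

uncellF : Label → Label → Label × Label × Bool
uncellF nothing  v        = nothing , v , false
uncellF (just i) nothing  = just i , nothing , false
uncellF (just i) (just j) with i ≟ j
... | no _ = just i , just j , false
uncellF (just zero)    (just j) | yes _ = nothing , nothing , true
uncellF (just (suc i)) (just j) | yes _ = just i , just i , false

-- Every pair of outgoing labels arises: two labels 0 from a mark, two equal larger ones from a
-- bump, all other pairs by passing through. A board can thus be grown back from arbitrary labels.
uncellF-Cell : ∀ h′ v′ → let (h , v , x) = uncellF h′ v′ in Cell h v x h′ v′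
uncellF-Cell nothing  nothing  = idleᵛ
uncellF-Cell nothing  (just j) = idleʰ
uncellF-Cell (just i) nothing  = idleᵛ
uncellF-Cell (just i) (just j) with i ≟ j
... | no i≢j = pass i≢j
uncellF-Cell (just zero)    (just j) | yes refl = mark
uncellF-Cell (just (suc i)) (just j) | yes refl = bump

Cell-backward : ∀ {h v x h₁ v₁ x₁ a b} → Cell h v x a b → Cell h₁ v₁ x₁ a b →
                h ≡ h₁ × v ≡ v₁ × x ≡ x₁
Cell-backward idleᵛ    idleᵛ    = refl , refl , refl
Cell-backward idleʰ    idleʰ    = refl , refl , refl
Cell-backward (pass _) (pass _) = refl , refl , refl
Cell-backward (pass n) bump     = contradiction refl n
Cell-backward (pass n) mark     = contradiction refl n
Cell-backward bump     (pass n) = contradiction refl n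
Cell-backward bump     bump     = refl , refl , refl
Cell-backward mark     (pass n) = contradiction refl n
Cell-backward mark     mark     = refl , refl , refl

-- Diagrams as column heights, and edges between them

Shape : Set
Shape = ℕ → ℕ

Decr : Shape → Set
Decr f = ∀ k → f (suc k) ≤ f k

record Edge (f : Shape) (l : Label) (g : Shape) : Set where
  constructor edge
  field at : ∀ k → g k ≡ f k + δ l k

open Edge public

Edge-≤ : ∀ {f l g} → Edge f l g → ∀ k → f k ≤ g k
Edge-≤ {f} {l} e k = subst (f k ≤_) (sym (at e k)) (m≤m+n (f k) (δ l k))

Edge-at : ∀ {f l g k} → Edge f l g → δ l k ≡ 0 → g k ≡ f k
Edge-at {f} {k = k} e z = trans (at e k) (trans (cong (f k +_) z) (+-identityʳ (f k)))

Edge-label-unique : ∀ {f g f' g' l l'} → Edge f l g → Edge f' l' g' →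
                    (∀ k → f k ≡ f' k) → (∀ k → g k ≡ g' k) → l ≡ l'
Edge-label-unique {f} {g} {f'} {g'} {l} {l'} e e' p q = δ-injective l l' λ k →
  +-cancelˡ-≡ (f k) (δ l k) (δ l' k)
    (trans (sym (at e k)) (trans (q k) (trans (at e' k) (cong (_+ δ l' k) (sym (p k))))))

Edge-to-∅ : ∀ {f l g} → Edge f l g → (∀ k → g k ≡ 0) → (∀ k → f k ≡ 0) × l ≡ nothing
Edge-to-∅ {f} {l} e z =
  (λ k → m+n≡0⇒m≡0 (f k) (trans (sym (at e k)) (z k))) ,
  δ-zero⇒nothing l (λ k → m+n≡0⇒n≡0 (f k) (trans (sym (at e k)) (z k)))

suc≢ : ∀ {k} → k ≢ suc k
suc≢ ()

-- If one of the two edges into `ρ` leaves column `k + 1` alone, the inequality is inherited from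
-- `μ` or `ν`. Only a bump from column `k` touches it along both edges, and then `μ` has just gained
-- a box in column `k`, which makes room for the new one.
Cell-Decr-up : ∀ {λ₀ μ ν ρ h v x h′ v′} → Cell h v x h′ v′ →
               Edge λ₀ h ν → Edge λ₀ v μ → Edge μ h′ ρ → Edge ν v′ ρ →
               Decr λ₀ → Decr μ → Decr ν → Decr ρ
Cell-Decr-up {λ₀} {μ} {ν} {ρ} {h} {v} {x} {h′} {v′} cell eν eμ eρ eρ′ Dλ Dμ Dν k = go cell
  where
  via-μ : δ h′ (suc k) ≡ 0 → ρ (suc k) ≤ ρ k
  via-μ z = ≤-trans (≤-reflexive (Edge-at eρ z)) (≤-trans (Dμ k) (Edge-≤ eρ k))
  via-ν : δ v′ (suc k) ≡ 0 → ρ (suc k) ≤ ρ k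
  via-ν z = ≤-trans (≤-reflexive (Edge-at eρ′ z)) (≤-trans (Dν k) (Edge-≤ eρ′ k))
  go : Cell h v x h′ v′ → ρ (suc k) ≤ ρ k
  go idleᵛ = via-ν refl
  go idleʰ = via-μ refl
  go (pass {i} {j} i≢j) with j ≟ suc k
  ... | yes refl = via-μ (δ-off i≢j)
  ... | no  j≢   = via-ν (δ-off j≢)
  go mark = via-μ refl
  go (bump {i}) with i ≟ k
  ... | no  i≢k  = via-μ (δ-off i≢k)
  ... | yes refl = begin
    ρ (suc i)                ≡⟨ at eρ (suc i) ⟩
    μ (suc i) + δ (just i) i ≡⟨ cong₂ _+_ (Edge-at eμ (δ-off (suc≢ {i}))) (δ-diag i) ⟩
    λ₀ (suc i) + 1           ≤⟨ +-monoˡ-≤ 1 (Dλ i) ⟩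
    λ₀ i + 1                 ≡⟨ cong (λ₀ i +_) (δ-diag i) ⟨
    λ₀ i + δ (just i) i      ≡⟨ at eμ i ⟨
    μ i                      ≤⟨ Edge-≤ eρ i ⟩
    ρ i                      ∎ where open ≤-Reasoning

-- The smallest corner is `μ` without the box of `v`, and the heights have to stay decreasing after
-- the removal. In a pass the critical column `j` agrees with that of `ν`. In a bump the box that
-- `ρ` gains in column `i + 1` rests against column `i`, so `μ` is strictly higher in column `i`
-- than in the next one.
Cell-Decr-down : ∀ {μ ν ρ h v x h′ v′} → Cell h v x h′ v′ →
                 Edge μ h′ ρ → Edge ν v′ ρ → Decr μ → Decr ν → Decr ρ →
                 Σ Shape λ λ₀ → Edge λ₀ v μ × Edge λ₀ h ν × Decr λ₀
Cell-Decr-down {μ} idleᵛ eμ eν Dμ Dν Dρ =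
  μ , edge (λ k → sym (+-identityʳ (μ k))) ,
  edge (λ k → trans (sym (Edge-at eν refl)) (at eμ k)) , Dμ
Cell-Decr-down {ν = ν} idleʰ eμ eν Dμ Dν Dρ =
  ν , edge (λ k → trans (sym (Edge-at eμ refl)) (at eν k)) ,
  edge (λ k → sym (+-identityʳ (ν k))) , Dν
Cell-Decr-down {μ} {ν} mark eμ eν Dμ Dν Dρ =
  μ , edge (λ k → sym (+-identityʳ (μ k))) ,
  edge (λ k → trans (+-cancelʳ-≡ (δ (just 0) k) (ν k) (μ k) (trans (sym (at eν k)) (at eμ k)))
               (sym (+-identityʳ (μ k)))) , Dμ
Cell-Decr-down {μ} {ν} {ρ} (pass {i} {j} i≢j) eμ eν Dμ Dν Dρ = κ , eκμ , eκν , Dκ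
  where
  κ : Shape
  κ k = μ k ∸ δ (just j) k
  δ≤μ : ∀ k → δ (just j) k ≤ μ k
  δ≤μ k with j ≟ k
  ... | yes refl = subst (δ (just j) j ≤_) (trans (sym (at eν j)) (Edge-at eμ (δ-off i≢j)))
                         (m≤n+m (δ (just j) j) (ν j))
  ... | no j≢k   = subst (_≤ μ k) (sym (δ-off j≢k)) z≤n
  eκμ : Edge κ (just j) μ
  eκμ .at k = sym (m∸n+n≡m (δ≤μ k))
  eκν : Edge κ (just i) ν
  eκν .at k = +-cancelʳ-≡ (δ (just j) k) (ν k) (κ k + δ (just i) k) (begin
    ν k + δ (just j) k                    ≡⟨ at eν k ⟨
    ρ k                                   ≡⟨ at eμ k ⟩
    μ k + δ (just i) k                    ≡⟨ cong (_+ δ (just i) k) (at eκμ k) ⟩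
    κ k + δ (just j) k + δ (just i) k     ≡⟨ +-assoc (κ k) _ _ ⟩
    κ k + (δ (just j) k + δ (just i) k)   ≡⟨ cong (κ k +_) (+-comm (δ (just j) k) _) ⟩
    κ k + (δ (just i) k + δ (just j) k)   ≡⟨ +-assoc (κ k) _ _ ⟨
    κ k + δ (just i) k + δ (just j) k     ∎) where open ≡-Reasoning
  Dκ : Decr κ
  Dκ k with j ≟ k
  ... | no j≢k = ≤-trans (m∸n≤m (μ (suc k)) (δ (just j) (suc k)))
                   (≤-trans (Dμ k) (≤-reflexive (Edge-at eκμ (δ-off j≢k))))
  ... | yes refl = ≤-trans (Edge-≤ eκν (suc k))
                     (≤-trans (Dν k) (≤-reflexive (Edge-at eκν (δ-off i≢j))))
Cell-Decr-down {μ} {ν} {ρ} (bump {i}) eμ eν Dμ Dν Dρ = κ , eκμ , eκν , Dκ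
  where
  κ : Shape
  κ k = μ k ∸ δ (just i) k
  gap : suc (μ (suc i)) ≤ μ i
  gap = begin
    suc (μ (suc i))           ≡⟨ +-comm 1 (μ (suc i)) ⟩
    μ (suc i) + 1             ≡⟨ cong (μ (suc i) +_) (δ-diag i) ⟨
    μ (suc i) + δ (just i) i  ≡⟨ at eμ (suc i) ⟨
    ρ (suc i)                 ≤⟨ Dρ i ⟩
    ρ i                       ≡⟨ Edge-at eμ (δ-off {suc i} {i} (λ ())) ⟩
    μ i                       ∎ where open ≤-Reasoning
  δ≤μ : ∀ k → δ (just i) k ≤ μ k
  δ≤μ k with i ≟ k
  ... | yes refl = subst (_≤ μ i) (sym (δ-diag i)) (≤-trans (s≤s z≤n) gap)
  ... | no i≢k   = subst (_≤ μ k) (sym (δ-off i≢k)) z≤n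
  eκμ : Edge κ (just i) μ
  eκμ .at k = sym (m∸n+n≡m (δ≤μ k))
  eκν : Edge κ (just i) ν
  eκν .at k = trans (+-cancelʳ-≡ _ (ν k) (μ k) (trans (sym (at eν k)) (at eμ k))) (at eκμ k)
  Dκ : Decr κ
  Dκ k with i ≟ k
  ... | no i≢k = ≤-trans (m∸n≤m (μ (suc k)) (δ (just i) (suc k)))
                   (≤-trans (Dμ k) (≤-reflexive (Edge-at eκμ (δ-off i≢k))))
  ... | yes refl = begin
    κ (suc i)            ≤⟨ m∸n≤m (μ (suc i)) (δ (just i) (suc i)) ⟩
    μ (suc i)            ≤⟨ ∸-monoˡ-≤ 1 gap ⟩
    μ i ∸ 1              ≡⟨ cong (μ i ∸_) (δ-diag i) ⟨
    κ i                  ∎ where open ≤-Reasoning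

-- Growths on a marked board

Filling : Set
Filling = ℕ → ℕ → Bool

-- `H s d` labels the edge from the vertex `(s , d)` to `(s + 1 , d)`, and `V s d` the edge from
-- `(s , d)` to `(s , d + 1)`. Shapes are not stored; they are sums of labels along paths.
record Growth (X : Filling) : Set where
  field
    H V   : ℕ → ℕ → Label
    H-out : ∀ s → H s 0 ≡ nothing
    V-out : ∀ d → V 0 d ≡ nothing
    cell  : ∀ s d → Cell (H s d) (V s d) (X s d) (H s (suc d)) (V (suc s) d)

  -- The shape at the vertex (s , d), given by its column heights.
  γ : ℕ → ℕ → Shape
  γ zero    d k = 0
  γ (suc s) d k = γ s d k + δ (H s d) k

  γ-edgeᴴ : ∀ s d → Edge (γ s d) (H s d) (γ (suc s) d)
  γ-edgeᴴ s d .at k = refl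

  -- `γ` sums along one direction only. Both ways around a cell add the same boxes by `Cell-δ`, so
  -- the sum does not depend on the path.
  γ-edgeⱽ : ∀ s d → Edge (γ s d) (V s d) (γ s (suc d))
  γ-edgeⱽ zero    d .at k rewrite V-out d = refl
  γ-edgeⱽ (suc s) d .at k = begin
    γ s (suc d) k + δ (H s (suc d)) k         ≡⟨ cong (_+ δ (H s (suc d)) k) (at (γ-edgeⱽ s d) k) ⟩
    γ s d k + δ (V s d) k + δ (H s (suc d)) k ≡⟨ +-assoc (γ s d k) _ _ ⟩
    γ s d k + (δ (V s d) k + δ (H s (suc d)) k) ≡⟨ cong (γ s d k +_) (Cell-δ (cell s d) k) ⟩
    γ s d k + (δ (H s d) k + δ (V (suc s) d) k) ≡⟨ +-assoc (γ s d k) _ _ ⟨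
    γ s d k + δ (H s d) k + δ (V (suc s) d) k ∎
    where open ≡-Reasoning

  γ-out : ∀ s k → γ s 0 k ≡ 0
  γ-out zero    k = refl
  γ-out (suc s) k rewrite H-out s = trans (+-identityʳ _) (γ-out s k)

  γ-Decr : ∀ s d → Decr (γ s d)
  γ-Decr zero    d       k = z≤n
  γ-Decr (suc s) zero    k = ≤-trans (≤-reflexive (γ-out (suc s) (suc k))) z≤n
  γ-Decr (suc s) (suc d)   = Cell-Decr-up (cell s d) (γ-edgeᴴ s d) (γ-edgeⱽ s d)
    (γ-edgeᴴ s (suc d)) (γ-edgeⱽ (suc s) d) (γ-Decr s d) (γ-Decr s (suc d)) (γ-Decr (suc s) d)

  γ-monoᴴ : ∀ {s s′} d k → s ≤ s′ → γ s d k ≤ γ s′ d k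
  γ-monoᴴ d k s≤s′ = go (≤⇒≤′ s≤s′)
    where
    go : ∀ {s s′} → s ≤′ s′ → γ s d k ≤ γ s′ d k
    go ≤′-refl       = ≤-refl
    go (≤′-step {n} p) = ≤-trans (go p) (m≤m+n (γ n d k) _)

  γ-monoⱽ : ∀ {d d′} s k → d ≤ d′ → γ s d k ≤ γ s d′ k
  γ-monoⱽ s k d≤d′ = go (≤⇒≤′ d≤d′)
    where
    go : ∀ {d d′} → d ≤′ d′ → γ s d k ≤ γ s d′ k
    go ≤′-refl       = ≤-refl
    go (≤′-step {n} p) = ≤-trans (go p) (Edge-≤ (γ-edgeⱽ s n) k)

  -- A label is born as 0 at a mark, and every further cell raises it by at most one. Hence a shape
  -- at second coordinate `d` has at most `d` columns.
  H-bound : ∀ s d {k} → H s d ≡ just k → k < d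
  H-bound s zero    eq with trans (sym eq) (H-out s)
  ... | ()
  H-bound s (suc d) eq = go (cell s d) refl eq
    where
    go : ∀ {h v x h′ v′ k} → Cell h v x h′ v′ → h ≡ H s d → h′ ≡ just k → k < suc d
    go idleᵛ    e refl = m<n⇒m<1+n (H-bound s d (sym e))
    go (pass _) e refl = m<n⇒m<1+n (H-bound s d (sym e))
    go bump     e refl = s≤s (H-bound s d (sym e))
    go mark     e refl = s≤s z≤n

  γ-bound : ∀ s d k → d ≤ k → γ s d k ≡ 0
  γ-bound zero    d k d≤k = refl
  γ-bound (suc s) d k d≤k = trans (cong (_+ δ (H s d) k) (γ-bound s d k d≤k)) δ≡0
    where
    δ≡0 : δ (H s d) k ≡ 0
    δ≡0 with δ (H s d) k ≟ 0
    ... | yes z  = z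
    ... | no  nz = contradiction (H-bound s d (δ≢0 (H s d) nz)) (≤⇒≯ d≤k)

  -- Only a mark creates a label, and by `H-persists` no cell destroys one. So a nontrivial label
  -- means exactly that a mark with the same first coordinate lies before it; openers and closers
  -- are read off the staircase in this way.
  H-source : ∀ s d {k} → H s d ≡ just k → ∃ λ e → e < d × X s e ≡ true
  H-source s zero    eq with trans (sym eq) (H-out s)
  ... | ()
  H-source s (suc d) eq = go (cell s d) refl refl eq
    where
    older : ∀ {k} → H s d ≡ just k → ∃ λ e → e < suc d × X s e ≡ true
    older eq′ with H-source s d eq′
    ... | e , e<d , p = e , m<n⇒m<1+n e<d , p
    go : ∀ {h v x h′ v′ k} → Cell h v x h′ v′ → h ≡ H s d → x ≡ X s d → h′ ≡ just k →
         ∃ λ e → e < suc d × X s e ≡ true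
    go idleᵛ    e _ refl = older (sym e)
    go (pass _) e _ refl = older (sym e)
    go bump     e _ refl = older (sym e)
    go mark     _ x refl = d , ≤-refl , sym x

  H-persists : ∀ s {e d} → X s e ≡ true → e < d → H s d ≢ nothing
  H-persists s {e} {suc d} Xse e<1+d with m≤n⇒m<n∨m≡n (s≤s⁻¹ e<1+d)
  ... | inj₂ refl = go (cell s d) (sym Xse)
    where
    go : ∀ {h v x h′ v′} → Cell h v x h′ v′ → true ≡ x → h′ ≢ nothing
    go mark _ ()
  ... | inj₁ e<d = go (cell s d) (H-persists s Xse e<d)
    where
    go : ∀ {h v x h′ v′} → Cell h v x h′ v′ → h ≢ nothing → h′ ≢ nothing
    go idleᵛ    n = n
    go idleʰ    n = n
    go (pass _) n = n
    go bump     n ()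
    go mark     n ()

open Growth

transpose : ∀ {X} → Growth X → Growth (flip X)
transpose G .H s d     = V G d s
transpose G .V s d     = H G d s
transpose G .H-out     = V-out G
transpose G .V-out     = H-out G
transpose G .cell s d  = Cell-sym (cell G d s)

-- Peeling off the first column: the skeleton of Viennot's shadow lines

pred-label : Label → Label
pred-label nothing        = nothing
pred-label (just zero)    = nothing
pred-label (just (suc i)) = just i

is-zero : Label → Bool
is-zero (just zero) = true
is-zero _           = false

is-zero⇒ : ∀ {l} → is-zero l ≡ true → l ≡ just 0
is-zero⇒ {just zero} _ = refl

δ-pred : ∀ l k → δ (pred-label l) k ≡ δ l (suc k)
δ-pred nothing        k = refl
δ-pred (just zero)    k = refl
δ-pred (just (suc i)) k = refl

-- Dropping label 0 and lowering the others turns each rule into a rule without a mark, except the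
-- bump of two labels 0: there nothing enters and two labels 0 leave, as at a mark. The marks of the
-- skeleton are therefore the cells in which two labels 0 meet.
Cell-pred : ∀ {h v x h′ v′} → Cell h v x h′ v′ →
            Cell (pred-label h) (pred-label v) (is-zero h ∧ is-zero v) (pred-label h′) (pred-label v′)
Cell-pred {nothing}      idleᵛ = idleᵛ
Cell-pred {just zero}    idleᵛ = idleᵛ
Cell-pred {just (suc _)} idleᵛ = idleᵛ
Cell-pred (idleʰ {zero})  = idleᵛ
Cell-pred (idleʰ {suc j}) = idleʰ
Cell-pred (pass {zero}  {zero}  i≢j) = contradiction refl i≢j
Cell-pred (pass {zero}  {suc j} i≢j) = idleʰ
Cell-pred (pass {suc i} {zero}  i≢j) = idleᵛ
Cell-pred (pass {suc i} {suc j} i≢j) = pass (λ eq → i≢j (cong suc eq))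
Cell-pred (bump {zero})  = mark
Cell-pred (bump {suc i}) = bump
Cell-pred mark           = idleᵛ

skeleton : ∀ {X} → Growth X → Filling
skeleton G s d = is-zero (H G s d) ∧ is-zero (V G s d)

peel : ∀ {X} (G : Growth X) → Growth (skeleton G)
peel G .H s d    = pred-label (H G s d)
peel G .V s d    = pred-label (V G s d)
peel G .H-out s  = cong pred-label (H-out G s)
peel G .V-out d  = cong pred-label (V-out G d)
peel G .cell s d = Cell-pred (cell G s d)

peel-γ : ∀ {X} (G : Growth X) s d k → γ (peel G) s d k ≡ γ G s d (suc k)
peel-γ G zero    d k = refl
peel-γ G (suc s) d k = cong₂ _+_ (peel-γ G s d k) (δ-pred (H G s d) k)

skeleton⁺ : ∀ {X} (G : Growth X) {s d} → H G s d ≡ just 0 → V G s d ≡ just 0 → skeleton G s d ≡ true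
skeleton⁺ G p q rewrite p | q = refl

skeleton⁻ : ∀ {X} (G : Growth X) {s d} → skeleton G s d ≡ true → H G s d ≡ just 0 × V G s d ≡ just 0
skeleton⁻ G {s} {d} p with is-zero (H G s d) in eqH
skeleton⁻ G {s} {d} () | false
... | true = is-zero⇒ eqH , is-zero⇒ p

-- Chains of marks and the first column

Point : Set
Point = ℕ × ℕ

-- `B` restricts the first point only, and `R p` takes its place for the rest. An induction can thus
-- state what the next point has to satisfy without naming the previous one.
data Chain (R : Point → Point → Set) (Q : Point → Set) (B : Point → Set) : ℕ → Set where
  []  : Chain R Q B 0
  cons : ∀ {k} p → B p → Q p → Chain R Q (R p) k → Chain R Q B (suc k)

weaken : ∀ {R Q Q′ B B′ k} → (∀ {p} → Q p → Q′ p) → (∀ {p} → B p → B′ p) → Chain R Q B k → Chain R Q′ B′ k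
weaken f g []             = []
weaken f g (cons p b q c) = cons p (g b) (f q) (weaken f (λ r → r) c)

-- The second coordinate counts closers from the right, so two arcs over a common vertex are nested
-- when related by `⟋` and crossing when related by `⟍`.
_⟋_ _⟍_ : Point → Point → Set
(i , e) ⟋ (i′ , e′) = i < i′ × e < e′
(i , e) ⟍ (i′ , e′) = i < i′ × e′ < e

In : Filling → ℕ → ℕ → Point → Set
In X s d (i , e) = i < s × e < d × X i e ≡ true

Any : Point → Set
Any _ = ⊤

module _ {X : Filling} (G : Growth X) where

  snoc : ∀ {s d B k} → X s d ≡ true → B (s , d) → Chain _⟋_ (In X s d) B k →
         Chain _⟋_ (In X (suc s) (suc d)) B (suc k)
  snoc {s} {d} x b [] = cons (s , d) b (≤-refl , ≤-refl , x) []
  snoc {s} {d} x b (cons p b′ (i<s , e<d , q) c) =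
    cons p b′ (m<n⇒m<1+n i<s , m<n⇒m<1+n e<d , q) (snoc x (i<s , e<d) c)

  marked : ∀ {s d} → X s d ≡ true → suc (γ G s d 0) ≤ γ G (suc s) (suc d) 0
  marked {s} {d} x = go (cell G s d) (sym x) refl
    where
    go : ∀ {h v b h′ v′} → Cell h v b h′ v′ → true ≡ b → h′ ≡ H G s (suc d) →
         suc (γ G s d 0) ≤ γ G (suc s) (suc d) 0
    go mark _ eq rewrite sym eq = begin
      suc (γ G s d 0)     ≤⟨ s≤s (γ-monoⱽ G s 0 (n≤1+n d)) ⟩
      suc (γ G s (suc d) 0) ≡⟨ +-comm 1 _ ⟩
      γ G s (suc d) 0 + 1 ∎ where open ≤-Reasoning

  -- Crossing a marked cell adds a box to the first column, and between two marks of the chain that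
  -- column cannot shrink.
  ⟋-length′ : ∀ {s d p k} → Chain _⟋_ (In X s d) (p ⟋_) k →
              let (i , e) = p in i < s → e < d → X i e ≡ true → suc k + γ G i e 0 ≤ γ G s d 0
  ⟋-length′ {s} {d} {i , e} [] i<s e<d x = begin
    suc (γ G i e 0)       ≤⟨ marked x ⟩
    γ G (suc i) (suc e) 0 ≤⟨ γ-monoᴴ G (suc e) 0 i<s ⟩
    γ G s (suc e) 0       ≤⟨ γ-monoⱽ G s 0 e<d ⟩
    γ G s d 0             ∎ where open ≤-Reasoning
  ⟋-length′ {s} {d} {i , e} {suc k} (cons (i′ , e′) (i<i′ , e<e′) (i′<s , e′<d , x′) c) i<s e<d x = begin
    suc (suc k) + γ G i e 0    ≡⟨ +-suc (suc k) _ ⟨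
    suc k + suc (γ G i e 0)    ≤⟨ +-monoʳ-≤ (suc k) (marked x) ⟩
    suc k + γ G (suc i) (suc e) 0 ≤⟨ +-monoʳ-≤ (suc k) (γ-monoᴴ G (suc e) 0 i<i′) ⟩
    suc k + γ G i′ (suc e) 0   ≤⟨ +-monoʳ-≤ (suc k) (γ-monoⱽ G i′ 0 e<e′) ⟩
    suc k + γ G i′ e′ 0        ≤⟨ ⟋-length′ c i′<s e′<d x′ ⟩
    γ G s d 0                  ∎ where open ≤-Reasoning

  ⟋-length : ∀ {s d k} → Chain _⟋_ (In X s d) Any k → k ≤ γ G s d 0
  ⟋-length []                             = z≤n
  ⟋-length (cons p _ (i<s , e<d , x) c) = ≤-trans (m≤m+n _ _) (⟋-length′ c i<s e<d x)

  -- Unless the last cell is marked, one of the two edges into its largest corner has a label other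
  -- than 0, so the neighbor along that edge has the same first height and the search moves there.
  -- At a mark, the mark ends the chain and the rest lies below the smallest corner.
  ⟋-chain : ∀ s d k → k ≤ γ G s d 0 → Chain _⟋_ (In X s d) Any k
  ⟋-chain s       d       zero    _  = []
  ⟋-chain (suc s) zero    (suc k) le = contradiction (subst (suc k ≤_) (γ-out G (suc s) 0) le) (λ ())
  ⟋-chain (suc s) (suc d) (suc k) le = go (cell G s d) refl refl refl refl
    where
    via-H : δ (H G s (suc d)) 0 ≡ 0 → Chain _⟋_ (In X (suc s) (suc d)) Any (suc k)
    via-H z = weaken (λ (a , b) → m<n⇒m<1+n a , b) (λ b → b)
      (⟋-chain s (suc d) (suc k) (≤-trans le (≤-reflexive (Edge-at (γ-edgeᴴ G s (suc d)) z))))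
    via-V : δ (V G (suc s) d) 0 ≡ 0 → Chain _⟋_ (In X (suc s) (suc d)) Any (suc k)
    via-V z = weaken (λ (a , b , c) → a , m<n⇒m<1+n b , c) (λ b → b)
      (⟋-chain (suc s) d (suc k) (≤-trans le (≤-reflexive (Edge-at (γ-edgeⱽ G (suc s) d) z))))
    go : ∀ {h v x h′ v′} → Cell h v x h′ v′ → v ≡ V G s d → x ≡ X s d →
         h′ ≡ H G s (suc d) → v′ ≡ V G (suc s) d → Chain _⟋_ (In X (suc s) (suc d)) Any (suc k)
    go idleᵛ _ _ _ eq = via-V (cong (λ l → δ l 0) (sym eq))
    go idleʰ _ _ eq _ = via-H (cong (λ l → δ l 0) (sym eq))
    go (pass {i} {zero} i≢j) _ _ eq _ = via-H (trans (cong (λ l → δ l 0) (sym eq)) (δ-off i≢j))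
    go (pass {i} {suc j} i≢j) _ _ _ eq = via-V (cong (λ l → δ l 0) (sym eq))
    go bump _ _ eq _ = via-H (cong (λ l → δ l 0) (sym eq))
    go mark eqv eqx eqh _ = snoc (sym eqx) tt (⟋-chain s d k (s≤s⁻¹ (begin
      suc k                            ≤⟨ le ⟩
      γ G s (suc d) 0 + δ (H G s (suc d)) 0 ≡⟨ cong (λ l → γ G s (suc d) 0 + δ l 0) eqh ⟨
      γ G s (suc d) 0 + 1              ≡⟨ +-comm _ 1 ⟩
      suc (γ G s (suc d) 0)            ≡⟨ cong suc (Edge-at (γ-edgeⱽ G s d) (cong (λ l → δ l 0) (sym eqv))) ⟩
      suc (γ G s d 0)                  ∎)))
      where open ≤-Reasoning

  -- Shadow lines: the rays with label 0 that leave a marked cell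

  -- A label 0 passes every cell unchanged except in a bump, and a bump needs a second label 0 to
  -- meet it.
  V-ray : ∀ {i i′ e} → V G (suc i) e ≡ just 0 → i < i′ →
          V G i′ e ≡ just 0 ⊎ (∃ λ a → i < a × a < i′ × H G a e ≡ just 0 × V G a e ≡ just 0)
  V-ray {i} {suc i′} {e} Vi i<1+i′ with m≤n⇒m<n∨m≡n (s≤s⁻¹ i<1+i′)
  ... | inj₂ refl = inj₁ Vi
  ... | inj₁ i<i′ with V-ray Vi i<i′
  ...   | inj₂ (a , i<a , a<i′ , p) = inj₂ (a , i<a , m<n⇒m<1+n a<i′ , p)
  ...   | inj₁ Vi′ = go (cell G i′ e) refl (sym Vi′) refl
    where
    go : ∀ {h v x h′ v′} → Cell h v x h′ v′ → h ≡ H G i′ e → just 0 ≡ v → v′ ≡ V G (suc i′) e →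
         V G (suc i′) e ≡ just 0 ⊎ (∃ λ a → i < a × a < suc i′ × H G a e ≡ just 0 × V G a e ≡ just 0)
    go idleʰ    _ refl eq = inj₁ (sym eq)
    go (pass _) _ refl eq = inj₁ (sym eq)
    go bump     p refl _  = inj₂ (i′ , i<i′ , ≤-refl , sym p , Vi′)

  V-mark : ∀ {i e} → X i e ≡ true → V G (suc i) e ≡ just 0
  V-mark {i} {e} x = go (cell G i e) (sym x) refl
    where
    go : ∀ {h v b h′ v′} → Cell h v b h′ v′ → true ≡ b → v′ ≡ V G (suc i) e → V G (suc i) e ≡ just 0
    go mark _ eq = sym eq

  -- No bump emits label 0. Backward, the ray is therefore unbroken until it reaches the mark that
  -- created it.
  V-trace : ∀ s {d} → V G s d ≡ just 0 →
            ∃ λ i → i < s × X i d ≡ true × (∀ u → i < u → u ≤ s → V G u d ≡ just 0)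
  V-trace zero    {d} eq with trans (sym eq) (V-out G d)
  ... | ()
  V-trace (suc s) {d} eq = go (cell G s d) refl refl (sym eq)
    where
    Src : Set
    Src = ∃ λ i → i < suc s × X i d ≡ true × (∀ u → i < u → u ≤ suc s → V G u d ≡ just 0)
    older : V G s d ≡ just 0 → Src
    older eq′ with V-trace s eq′
    ... | i , i<s , x , ray = i , m<n⇒m<1+n i<s , x , ray′
      where
      ray′ : ∀ u → i < u → u ≤ suc s → V G u d ≡ just 0
      ray′ u i<u u≤ with m≤n⇒m<n∨m≡n u≤
      ... | inj₁ u< = ray u i<u (s≤s⁻¹ u<)
      ... | inj₂ refl = eq
    go : ∀ {h v x h′ v′} → Cell h v x h′ v′ → v ≡ V G s d → x ≡ X s d → just 0 ≡ v′ → Src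
    go idleʰ    e _ refl = older (sym e)
    go (pass _) e _ refl = older (sym e)
    go mark     _ x refl = s , ≤-refl , sym x , λ u s<u u≤ → trans (cong (λ w → V G w d) (≤-antisym u≤ s<u)) eq

  bump-H : ∀ {s d} → H G s d ≡ just 0 → V G s d ≡ just 0 → H G s (suc d) ≡ just 1
  bump-H {s} {d} p q = go (cell G s d) (sym p) (sym q) refl
    where
    go : ∀ {h v x h′ v′} → Cell h v x h′ v′ → just 0 ≡ h → just 0 ≡ v → h′ ≡ H G s (suc d) →
         H G s (suc d) ≡ just 1
    go (pass n) refl refl _ = contradiction refl n
    go bump     refl refl e = sym e

module _ {X : Filling} (G : Growth X) where

  -- The ray from (i , e) along row e and the ray from (i′ , e′) along column i′ would meet in (i′ , e);
  -- if one of them stops earlier, it does so by meeting another ray.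
  shadow-meet : ∀ {i e i′ e′} → X i e ≡ true → X i′ e′ ≡ true → i < i′ → e′ < e →
                ∃ λ a → ∃ λ b → i < a × a ≤ i′ × e′ < b × b ≤ e × skeleton G a b ≡ true
  shadow-meet {i} {e} {i′} {e′} x x′ i<i′ e′<e with V-ray G (V-mark G x) i<i′
  ... | inj₂ (a , i<a , a<i′ , p , q) = a , e , i<a , <⇒≤ a<i′ , e′<e , ≤-refl , skeleton⁺ G p q
  ... | inj₁ q with V-ray (transpose G) (V-mark (transpose G) x′) e′<e
  ...   | inj₂ (b , e′<b , b<e , q′ , p) = i′ , b , i<i′ , ≤-refl , e′<b , <⇒≤ b<e , skeleton⁺ G p q′
  ...   | inj₁ p = i′ , e , i<i′ , ≤-refl , e′<e , ≤-refl , skeleton⁺ G p q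

  -- Each pair of neighbors in the chain yields a meeting point by `shadow-meet`. The bounds on that
  -- point are strict on one side and weak on the other, which makes successive meeting points
  -- strictly comparable.
  ⟍-peel′ : ∀ {s d i e k} → X i e ≡ true → e < d → Chain _⟍_ (In X s d) ((i , e) ⟍_) k →
            Chain _⟍_ (In (skeleton G) s d) (λ (a , b) → i < a × b ≤ e) k
  ⟍-peel′ x e<d [] = []
  ⟍-peel′ x e<d (cons (i′ , e′) (i<i′ , e′<e) (i′<s , e′<d , x′) c) with shadow-meet x x′ i<i′ e′<e
  ... | a , b , i<a , a≤i′ , e′<b , b≤e , y =
    cons (a , b) (i<a , b≤e) (≤-<-trans a≤i′ i′<s , ≤-<-trans b≤e e<d , y)
      (weaken (λ q → q) (λ (p , q) → ≤-<-trans a≤i′ p , ≤-<-trans q e′<b) (⟍-peel′ x′ e′<d c))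

  -- Otherwise the rays that meet in (a , b) and in (a′ , b′) already meet in (a , b′), and column a
  -- carries label 1 from there on.
  between : ∀ {a b a′ b′} → skeleton G a b ≡ true → skeleton G a′ b′ ≡ true → a < a′ → b′ < b →
            ∃ λ i → ∃ λ e → a ≤ i × i < a′ × b′ ≤ e × e < b × X i e ≡ true
  between {a} {b} {a′} {b′} y y′ a<a′ b′<b
    with skeleton⁻ G y | skeleton⁻ G y′
  ... | p , _ | _ , q with V-trace (transpose G) b p | V-trace G a′ q
  ...   | e , e<b , x , rayᴴ | i , i<a′ , x′ , rayⱽ with b′ ≤? e | a ≤? i
  ...     | yes b′≤e | _       = a , e , ≤-refl , a<a′ , b′≤e , e<b , x
  ...     | no _     | yes a≤i = i , b′ , a≤i , i<a′ , ≤-refl , b′<b , x′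
  ...     | no b′≰e  | no a≰i  = contradiction (trans (sym (rayᴴ (suc b′) (m<n⇒m<1+n (≰⇒> b′≰e)) b′<b))
              (bump-H G (rayᴴ b′ (≰⇒> b′≰e) (<⇒≤ b′<b)) (rayⱽ a (≰⇒> a≰i) (<⇒≤ a<a′)))) λ ()

  -- `between` supplies a mark for each pair of neighboring skeleton marks, and the source of a ray
  -- into the last one supplies another. `⟍-unpeel` then adds the source of the other ray into the
  -- first one, which makes one mark more than in the skeleton.
  ⟍-unpeel′ : ∀ {s d a b k} → skeleton G a b ≡ true → a < s → b < d → Chain _⟍_ (In (skeleton G) s d) ((a , b) ⟍_) k →
              Chain _⟍_ (In X s d) (λ (i , e) → a ≤ i × e < b) (suc k)
  ⟍-unpeel′ {a = a} {b} y a<s b<d [] with V-trace (transpose G) b (proj₁ (skeleton⁻ G y))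
  ... | e , e<b , x , _ = cons (a , e) (≤-refl , e<b) (a<s , <-trans e<b b<d , x) []
  ⟍-unpeel′ y a<s b<d (cons (a′ , b′) (a<a′ , b′<b) (a′<s , b′<d , y′) c) with between y y′ a<a′ b′<b
  ... | i , e , a≤i , i<a′ , b′≤e , e<b , x =
    cons (i , e) (a≤i , e<b) (<-trans i<a′ a′<s , <-trans e<b b<d , x)
      (weaken (λ q → q) (λ (p , q) → <-≤-trans i<a′ p , <-≤-trans q b′≤e) (⟍-unpeel′ y′ a′<s b′<d c))

  ⟍-peel : ∀ {s d k} → Chain _⟍_ (In X s d) Any (suc k) → Chain _⟍_ (In (skeleton G) s d) Any k
  ⟍-peel (cons _ _ (_ , e<d , x) c) = weaken (λ q → q) _ (⟍-peel′ x e<d c)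

  ⟍-unpeel : ∀ {s d k} → Chain _⟍_ (In (skeleton G) s d) Any (suc k) → Chain _⟍_ (In X s d) Any (suc (suc k))
  ⟍-unpeel (cons (a , b) _ (a<s , b<d , y) c) with V-trace G a (proj₂ (skeleton⁻ G y))
  ... | i , i<a , x , _ = cons (i , b) _ (<-trans i<a a<s , b<d , x)
    (weaken (λ q → q) (λ (p , q) → <-≤-trans i<a p , q) (⟍-unpeel′ y a<s b<d c))

⟍-length : ∀ {X} (G : Growth X) {s d} k → Chain _⟍_ (In X s d) Any (suc k) → 0 < γ G s d k
-- For a single mark the two kinds of chains coincide, so the first column settles the base case.
⟍-length G zero (cons p b q []) = ⟋-length G (cons p b q [])
⟍-length G {s} {d} (suc k) c = subst (0 <_) (peel-γ G s d k) (⟍-length (peel G) k (⟍-peel G c))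

⟍-chain : ∀ {X} (G : Growth X) {s d} k → 0 < γ G s d k → Chain _⟍_ (In X s d) Any (suc k)
⟍-chain G {s} {d} zero 0<γ with ⟋-chain G s d 1 0<γ
... | cons p b q [] = cons p b q []
⟍-chain G {s} {d} (suc k) 0<γ =
  ⟍-unpeel G (⟍-chain (peel G) k (subst (0 <_) (sym (peel-γ G s d k)) 0<γ))

-- Forward growth from a partial permutation

cellF-justʰ : ∀ h v x → proj₁ (cellF h v x) ≢ nothing → h ≢ nothing ⊎ x ≡ true
cellF-justʰ (just i) v        x     _  = inj₁ λ ()
cellF-justʰ nothing  nothing  true  _  = inj₂ refl
cellF-justʰ nothing  nothing  false ne = contradiction refl ne
cellF-justʰ nothing  (just j) x     ne = contradiction refl ne

cellF-justᵛ : ∀ h v x → proj₂ (cellF h v x) ≢ nothing → v ≢ nothing ⊎ x ≡ true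
cellF-justᵛ h        (just j) x     _  = inj₁ λ ()
cellF-justᵛ nothing  nothing  true  _  = inj₂ refl
cellF-justᵛ nothing  nothing  false ne = contradiction refl ne
cellF-justᵛ (just i) nothing  x     ne = contradiction refl ne

is-nothing? : (l : Label) → l ≡ nothing ⊎ l ≢ nothing
is-nothing? nothing  = inj₁ refl
is-nothing? (just _) = inj₂ λ ()

module Forward (X : Filling)
  (row : ∀ {s d d′} → X s d ≡ true → X s d′ ≡ true → d ≡ d′)
  (column : ∀ {s s′ d} → X s d ≡ true → X s′ d ≡ true → s ≡ s′) where

  fH fV : ℕ → ℕ → Label
  fH s zero    = nothing
  fH s (suc d) = proj₁ (cellF (fH s d) (fV s d) (X s d))
  fV zero    d = nothing
  fV (suc s) d = proj₂ (cellF (fH s d) (fV s d) (X s d))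

  fH-source : ∀ s d → fH s d ≢ nothing → ∃ λ e → e < d × X s e ≡ true
  fH-source s zero    ne = contradiction refl ne
  fH-source s (suc d) ne with cellF-justʰ (fH s d) (fV s d) (X s d) ne
  ... | inj₂ x  = d , ≤-refl , x
  ... | inj₁ ne′ with fH-source s d ne′
  ...   | e , e<d , x = e , m<n⇒m<1+n e<d , x

  fV-source : ∀ s d → fV s d ≢ nothing → ∃ λ i → i < s × X i d ≡ true
  fV-source zero    d ne = contradiction refl ne
  fV-source (suc s) d ne with cellF-justᵛ (fH s d) (fV s d) (X s d) ne
  ... | inj₂ x  = s , ≤-refl , x
  ... | inj₁ ne′ with fV-source s d ne′
  ...   | i , i<s , x = i , m<n⇒m<1+n i<s , x

  -- A label entering a marked cell would come from an earlier mark with the same first or the same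
  -- second coordinate.
  fresh : ∀ s d → X s d ≡ true → fH s d ≡ nothing × fV s d ≡ nothing
  fresh s d x = freshᴴ , freshⱽ
    where
    freshᴴ : fH s d ≡ nothing
    freshᴴ with is-nothing? (fH s d)
    ... | inj₁ eq = eq
    ... | inj₂ ne with fH-source s d ne
    ...   | e , e<d , x′ = contradiction (row x′ x) (<⇒≢ e<d)
    freshⱽ : fV s d ≡ nothing
    freshⱽ with is-nothing? (fV s d)
    ... | inj₁ eq = eq
    ... | inj₂ ne with fV-source s d ne
    ...   | i , i<s , x′ = contradiction (column x′ x) (<⇒≢ i<s)

  growth : Growth X
  growth .H = fH
  growth .V = fV
  growth .H-out s  = refl
  growth .V-out d  = refl
  growth .cell s d = cellF-Cell (fH s d) (fV s d) (X s d) (fresh s d)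

-- Staircases

-- The shapes along the staircase: E t sits at the vertex (t , N ∸ t), and O t at (t , N ∸ suc t).
record Stair (N : ℕ) : Set where
  field
    E O : ℕ → Shape
    a b : ℕ → Label
    edgeᵇ   : ∀ t → Edge (O t) (b t) (E t)
    edgeᵃ   : ∀ t → Edge (O t) (a t) (E (suc t))
    E-Decr  : ∀ t → Decr (E t)
    O-Decr  : ∀ t → Decr (O t)
    E-start : ∀ k → E 0 k ≡ 0
    E-end   : ∀ t → N ≤ t → ∀ k → E t k ≡ 0

open Stair

module _ {X : Filling} (G : Growth X) where

  -- The second argument will be `N ∸ t`. Its value zero occurs from `t = N` on, past the end of the
  -- staircase, where all shapes are empty and all labels trivial.
  oAt : ℕ → ℕ → Shape
  oAt t zero    = γ G t 0
  oAt t (suc d) = γ G t d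

  aAt bAt : ℕ → ℕ → Label
  aAt t zero    = nothing
  aAt t (suc d) = H G t d
  bAt t zero    = nothing
  bAt t (suc d) = V G t d

  stair : ∀ N → Stair N
  stair N .E t = γ G t (N ∸ t)
  stair N .O t = oAt t (N ∸ t)
  stair N .a t = aAt t (N ∸ t)
  stair N .b t = bAt t (N ∸ t)
  stair N .edgeᵇ t = go (N ∸ t)
    where
    go : ∀ d → Edge (oAt t d) (bAt t d) (γ G t d)
    go zero    .at k = sym (+-identityʳ _)
    go (suc d)       = γ-edgeⱽ G t d
  stair N .edgeᵃ t = subst (λ d → Edge (oAt t (N ∸ t)) (aAt t (N ∸ t)) (γ G (suc t) d))
                           (pred[m∸n]≡m∸[1+n] N t) (go (N ∸ t))
    where
    go : ∀ d → Edge (oAt t d) (aAt t d) (γ G (suc t) (pred d))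
    go zero    .at k = cong (λ l → γ G t 0 k + δ l k) (H-out G t)
    go (suc d)       = γ-edgeᴴ G t d
  stair N .E-Decr t = γ-Decr G t (N ∸ t)
  stair N .O-Decr t = go (N ∸ t)
    where
    go : ∀ d → Decr (oAt t d)
    go zero    = γ-Decr G t 0
    go (suc d) = γ-Decr G t d
  stair N .E-start k = refl
  stair N .E-end t N≤t k rewrite m≤n⇒m∸n≡0 N≤t = γ-out G t k

  stair-a : ∀ N t d → suc (t + d) ≡ N → a (stair N) t ≡ H G t d
  stair-a .(suc (t + d)) t d refl rewrite sym (+-suc t d) | m+n∸m≡n t (suc d) = refl

  stair-b : ∀ N t d → suc (t + d) ≡ N → b (stair N) t ≡ V G t d
  stair-b .(suc (t + d)) t d refl rewrite sym (+-suc t d) | m+n∸m≡n t (suc d) = refl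

-- Backward growth from the staircase

module Backward (a b : ℕ → Label) where

  -- A g s and B g s label the edges of opener s at closer s + 1 + g, and of
  -- closer s + g at opener s; M g s is the cell of opener s and closer s + 1 + g.
  A B : ℕ → ℕ → Label
  A zero    s = a s
  A (suc g) s = proj₁ (uncellF (A g s) (B g (suc s)))
  B zero    s = b s
  B (suc g) s = proj₁ (proj₂ (uncellF (A g s) (B g (suc s))))

  M : ℕ → ℕ → Bool
  M g s = proj₂ (proj₂ (uncellF (A g s) (B g (suc s))))

  backCell : ∀ g s → Cell (A (suc g) s) (B (suc g) s) (M g s) (A g s) (B g (suc s))
  backCell g s = uncellF-Cell (A g s) (B g (suc s))

  M⇒ : ∀ g s → M g s ≡ true → A g s ≡ just 0 × B g (suc s) ≡ just 0 ×
       A (suc g) s ≡ nothing × B (suc g) s ≡ nothing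
  M⇒ g s m = go (backCell g s) (sym m) refl refl refl refl
    where
    go : ∀ {h v x h′ v′} → Cell h v x h′ v′ → true ≡ x →
         h ≡ A (suc g) s → v ≡ B (suc g) s → h′ ≡ A g s → v′ ≡ B g (suc s) →
         A g s ≡ just 0 × B g (suc s) ≡ just 0 × A (suc g) s ≡ nothing × B (suc g) s ≡ nothing
    go mark _ p q r t = sym r , sym t , sym p , sym q

  A-nothing : ∀ {g s} m → A g s ≡ nothing → A (m + g) s ≡ nothing
  A-nothing         zero    eq = eq
  A-nothing {g} {s} (suc m) eq rewrite A-nothing {g} {s} m eq = refl

  -- Both labels belong to the closer `m + s + g`, seen from openers that are `m` apart.
  B-nothing : ∀ {g s} m → B g (m + s) ≡ nothing → B (m + g) s ≡ nothing
  B-nothing         zero    eq = eq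
  B-nothing {g} {s} (suc m) eq
    rewrite B-nothing {g} {suc s} m (trans (cong (B g) (+-suc m s)) eq) with A (m + g) s
  ... | nothing = refl
  ... | just _  = refl

  -- Going backward, a mark consumes the label of its opener, and a missing label never comes back;
  -- a second mark would need it again. `M-column` is the same for the closer.
  M-row : ∀ {g g′ s} → M g s ≡ true → M g′ s ≡ true → ¬ g < g′
  M-row {g} {g′} {s} m m′ g<g′ with M⇒ g s m | M⇒ g′ s m′
  ... | _ , _ , dead , _ | live , _ = contradiction
    (trans (sym live) (trans (cong (λ u → A u s) (sym (m∸n+n≡m g<g′))) (A-nothing (g′ ∸ suc g) dead)))
    λ ()

  M-column : ∀ {g g′ s s′} → M g s ≡ true → M g′ s′ ≡ true → s + g ≡ s′ + g′ → ¬ s′ < s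
  M-column {g} {g′} {s} {s′} m m′ eq s′<s with M⇒ g s m | M⇒ g′ s′ m′
  ... | _ , _ , _ , dead | _ , live , _ = contradiction
    (trans (sym live) (trans (cong (λ u → B u (suc s′)) g′≡) (B-nothing n (subst (λ u → B (suc g) u ≡ nothing) s≡ dead))))
    λ ()
    where
    n = s ∸ suc s′
    s≡ : s ≡ n + suc s′
    s≡ = sym (m∸n+n≡m s′<s)
    g′≡ : g′ ≡ n + suc g
    g′≡ = +-cancelˡ-≡ s′ g′ (n + suc g) (begin
      s′ + g′            ≡⟨ eq ⟨
      s + g              ≡⟨ cong (_+ g) s≡ ⟩
      n + suc s′ + g     ≡⟨ cong (_+ g) (+-comm n (suc s′)) ⟩
      suc s′ + n + g     ≡⟨ +-assoc (suc s′) n g ⟩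
      suc s′ + (n + g)   ≡⟨ +-suc s′ (n + g) ⟨
      s′ + suc (n + g)   ≡⟨ cong (s′ +_) (+-suc n g) ⟨
      s′ + (n + suc g)   ∎) where open ≡-Reasoning

  M-opener : ∀ {g s} → M g s ≡ true → a s ≢ nothing
  M-opener {g} {s} m eq with M⇒ g s m
  ... | live , _ with trans (sym live) (subst (λ u → A u s ≡ nothing) (+-identityʳ g) (A-nothing g eq))
  ...   | ()

  M-closer : ∀ {g s} → M g s ≡ true → b (suc s + g) ≢ nothing
  M-closer {g} {s} m eq with M⇒ g s m
  ... | _ , live , _ with trans (sym live) (subst (λ u → B u (suc s) ≡ nothing) (+-identityʳ g)
                             (B-nothing g (trans (cong b (+-comm g (suc s))) eq)))
  ...   | ()

module _ {N : ℕ} (Z : Stair N) where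
  open Backward (a Z) (b Z)

  -- The shapes on two neighboring antidiagonals, `g` steps below the staircase. `Backward` computes
  -- labels for any input; these shapes serve to show that the labels vanish at the boundary,
  -- because a diagram contained in an empty one is empty.
  record Level (g : ℕ) : Set where
    field
      outer inner  : ℕ → Shape
      edgeᴮ        : ∀ s → Edge (inner s) (B g s) (outer s)
      edgeᴬ        : ∀ s → Edge (inner s) (A g s) (outer (suc s))
      outer-Decr   : ∀ s → Decr (outer s)
      inner-Decr   : ∀ s → Decr (inner s)
      outer-start  : ∀ k → outer 0 k ≡ 0
      outer-end    : ∀ s → N ≤ s + g → ∀ k → outer s k ≡ 0
  open Level

  level : ∀ g → Level g
  level zero = record
    { outer = E Z ; inner = O Z ; edgeᴮ = edgeᵇ Z ; edgeᴬ = edgeᵃ Z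
    ; outer-Decr = E-Decr Z ; inner-Decr = O-Decr Z ; outer-start = E-start Z
    ; outer-end = λ s le → E-end Z s (subst (N ≤_) (+-identityʳ s) le) }
  level (suc g) = record
    { outer = inner L ; inner = λ s → proj₁ (down s)
    ; edgeᴮ = λ s → proj₁ (proj₂ (down s)) ; edgeᴬ = λ s → proj₁ (proj₂ (proj₂ (down s)))
    ; outer-Decr = inner-Decr L ; inner-Decr = λ s → proj₂ (proj₂ (proj₂ (down s)))
    ; outer-start = proj₁ (Edge-to-∅ (edgeᴮ L 0) (outer-start L))
    ; outer-end = λ s le → proj₁ (Edge-to-∅ (edgeᴬ L s) (outer-end L (suc s) (subst (N ≤_) (+-suc s g) le))) }
    where
    L = level g
    down : ∀ s → _
    down s = Cell-Decr-down (backCell g s) (edgeᴬ L s) (edgeᴮ L (suc s))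
      (inner-Decr L s) (inner-Decr L (suc s)) (outer-Decr L (suc s))

  B-out : ∀ g → B g 0 ≡ nothing
  B-out g = proj₂ (Edge-to-∅ (edgeᴮ (level g) 0) (outer-start (level g)))

  A-out : ∀ g s → N ≤ suc s + g → A g s ≡ nothing
  A-out g s le = proj₂ (Edge-to-∅ (edgeᴬ (level g) s) (outer-end (level g) (suc s) le))

  B-end : ∀ g s → N ≤ s + g → B g s ≡ nothing
  B-end g s le = proj₂ (Edge-to-∅ (edgeᴮ (level g) s) (outer-end (level g) s le))

  M-bound : ∀ {g s} → M g s ≡ true → suc s + g < N
  M-bound {g} {s} m with N ≤? suc s + g
  ... | no  gt = ≰⇒> gt
  ... | yes le with trans (sym (proj₁ (proj₂ (M⇒ g s m)))) (B-end g (suc s) le)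
  ...   | ()

  module _ {X : Filling} (G : Growth X) where

    Agree : ℕ → ℕ → ℕ → Set
    Agree g s d = H G s d ≡ A g s × V G s d ≡ B g s

    back-step : ∀ {g s d} → H G s (suc d) ≡ A g s → V G (suc s) d ≡ B g (suc s) →
                Agree (suc g) s d × X s d ≡ M g s
    back-step {g} {s} {d} p q
      with Cell-backward (subst₂ (Cell (H G s d) (V G s d) (X s d)) p q (cell G s d)) (backCell g s)
    ... | e₁ , e₂ , e₃ = (e₁ , e₂) , e₃

    module _ (base : ∀ s d → suc (s + d) ≡ N → Agree 0 s d) where

      agree-backward : ∀ g s d → suc g + (s + d) ≡ N → Agree g s d
      agree-backward zero    s d eq = base s d eq
      agree-backward (suc g) s d eq = proj₁ (back-step {g}
        (proj₁ (agree-backward g s (suc d) (trans (cong (suc g +_) (+-suc s d)) (trans (+-suc (suc g) (s + d)) eq))))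
        (proj₂ (agree-backward g (suc s) d (trans (+-suc (suc g) (s + d)) eq))))

      marks-backward : ∀ g s d → suc (suc g) + (s + d) ≡ N → X s d ≡ M g s
      marks-backward g s d eq = proj₂ (back-step {g}
        (proj₁ (agree-backward g s (suc d) (trans (cong (suc g +_) (+-suc s d)) (trans (+-suc (suc g) (s + d)) eq))))
        (proj₂ (agree-backward g (suc s) d (trans (+-suc (suc g) (s + d)) eq))))

    module _ (marks : ∀ g s d → suc (suc g) + (s + d) ≡ N → X s d ≡ M g s) where

      -- Forward from the boundary, where both sides are trivial: equal marks and equal incoming
      -- labels force equal outgoing ones. The recursion descends on `s + d`, while `g` keeps the
      -- distance to the staircase.
      agreeᴴ : ∀ g s d → suc g + (s + d) ≡ N → H G s d ≡ A g s
      agreeⱽ : ∀ g s d → suc g + (s + d) ≡ N → V G s d ≡ B g s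

      fore-step : ∀ g s d → suc (suc g) + (s + d) ≡ N → H G s (suc d) ≡ A g s × V G (suc s) d ≡ B g (suc s)
      fore-step g s d eq = Cell-forward (cell G s d) cell′
        where
        cell′ : Cell (H G s d) (V G s d) (X s d) (A g s) (B g (suc s))
        cell′ rewrite agreeᴴ (suc g) s d eq | agreeⱽ (suc g) s d eq | marks g s d eq = backCell g s

      agreeᴴ g s zero    eq = trans (H-out G s) (sym (A-out g s (≤-reflexive
        (trans (sym eq) (cong suc (trans (cong (g +_) (+-identityʳ s)) (+-comm g s)))))))
      agreeᴴ g s (suc d) eq = proj₁ (fore-step g s d
        (trans (sym (+-suc (suc g) (s + d))) (trans (cong (suc g +_) (sym (+-suc s d))) eq)))
      agreeⱽ g zero    d eq = trans (V-out G d) (sym (B-out g))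
      agreeⱽ g (suc s) d eq = proj₂ (fore-step g s d (trans (sym (+-suc (suc g) (s + d))) eq))

-- Shapes and labels of a staircase determine each other

module _ {N : ℕ} (Z Z′ : Stair N) (a≡ : ∀ t → a Z t ≡ a Z′ t) (b≡ : ∀ t → b Z t ≡ b Z′ t) where

  Edge-cancel : ∀ {f g f' g' l l'} → Edge f l g → Edge f' l' g' → l ≡ l' →
                (∀ k → g k ≡ g' k) → ∀ k → f k ≡ f' k
  Edge-cancel {f} {g} {f'} {g'} {l} e e' refl q k =
    +-cancelʳ-≡ (δ l k) (f k) (f' k) (trans (sym (at e k)) (trans (q k) (at e' k)))

  E-determined : ∀ t k → E Z t k ≡ E Z′ t k
  O-determined : ∀ t k → O Z t k ≡ O Z′ t k
  E-determined zero    k = trans (E-start Z k) (sym (E-start Z′ k))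
  E-determined (suc t) k = trans (at (edgeᵃ Z t) k)
    (trans (cong₂ (λ m l → m + δ l k) (O-determined t k) (a≡ t)) (sym (at (edgeᵃ Z′ t) k)))
  O-determined t = Edge-cancel (edgeᵇ Z t) (edgeᵇ Z′ t) (b≡ t) (E-determined t)

a-determined : ∀ {N} (Z Z′ : Stair N) → (∀ t k → E Z t k ≡ E Z′ t k) → (∀ t k → O Z t k ≡ O Z′ t k) →
               ∀ t → a Z t ≡ a Z′ t
a-determined Z Z′ E≡ O≡ t = Edge-label-unique (edgeᵃ Z t) (edgeᵃ Z′ t) (O≡ t) (E≡ (suc t))

b-determined : ∀ {N} (Z Z′ : Stair N) → (∀ t k → E Z t k ≡ E Z′ t k) → (∀ t k → O Z t k ≡ O Z′ t k) →
               ∀ t → b Z t ≡ b Z′ t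
b-determined Z Z′ E≡ O≡ t = Edge-label-unique (edgeᵇ Z t) (edgeᵇ Z′ t) (O≡ t) (E≡ t)

-- Rows and columns of a partition

<ᵇ-true⇒< : ∀ {m n} → (m <ᵇ n) ≡ true → m < n
<ᵇ-true⇒< {m} {n} eq = <ᵇ⇒< m n (Equivalence.from Bool.T-≡ eq)

<⇒<ᵇ-true : ∀ {m n} → m < n → (m <ᵇ n) ≡ true
<⇒<ᵇ-true = Equivalence.to Bool.T-≡ ∘ <⇒<ᵇ

count : ℕ → (ℕ → Bool) → ℕ
count zero    p = 0
count (suc n) p = (if p 0 then 1 else 0) + count n (p ∘ suc)

count-mono : ∀ n {p q} → (∀ i → p i ≡ true → q i ≡ true) → count n p ≤ count n q
count-mono zero    imp = z≤n
count-mono (suc n) {p} {q} imp = +-mono-≤ head (count-mono n (imp ∘ suc))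
  where
  head : (if p 0 then 1 else 0) ≤ (if q 0 then 1 else 0)
  head with p 0 in eq
  ... | false = z≤n
  ... | true rewrite imp 0 eq = ≤-refl

Closed : (ℕ → Bool) → Set
Closed p = ∀ i → p (suc i) ≡ true → p i ≡ true

closed-0 : ∀ {p} → Closed p → ∀ i → p i ≡ true → p 0 ≡ true
closed-0 cl zero    eq = eq
closed-0 cl (suc i) eq = closed-0 cl i (cl i eq)

<count⇒ : ∀ n {p} → Closed p → ∀ i → i < count n p → p i ≡ true
<count⇒ (suc n) {p} cl i lt with p 0 in eq
<count⇒ (suc n) {p} cl zero    lt       | true = eq
<count⇒ (suc n) {p} cl (suc i) (s≤s lt) | true = <count⇒ n (cl ∘ suc) i lt
... | false with trans (sym eq) (closed-0 cl (suc i) (<count⇒ n (cl ∘ suc) i lt))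
...   | ()

⇒<count : ∀ n {p} → Closed p → ∀ i → i < n → p i ≡ true → i < count n p
⇒<count (suc n) {p} cl i lt pi with p 0 in eq
⇒<count (suc n) cl zero    lt       pi | true = s≤s z≤n
⇒<count (suc n) cl (suc i) (s≤s lt) pi | true = s≤s (⇒<count n (cl ∘ suc) i lt pi)
... | false with trans (sym eq) (closed-0 cl i pi)
...   | ()

-- Each side says that the box in row `i` and column `k` belongs to the diagram. In this form
-- conjugation is symmetric, and it determines `G` from `F` without any counting.
record Conj (F G : Shape) : Set where
  constructor conj
  field
    ⇒ : ∀ {i k} → i < G k → k < F i
    ⇐ : ∀ {i k} → k < F i → i < G k
open Conj

Conj-sym : ∀ {F G} → Conj F G → Conj G F
Conj-sym (conj f g) = conj g f

<-ext : ∀ {m n} → (∀ {i} → i < m → i < n) → (∀ {i} → i < n → i < m) → m ≡ n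
<-ext {m} {n} f g = ≤-antisym (≮⇒≥ λ n<m → <-irrefl refl (f n<m)) (≮⇒≥ λ m<n → <-irrefl refl (g m<n))

Conj-unique : ∀ {F F′ G G′} → Conj F G → Conj F′ G′ → (∀ k → F k ≡ F′ k) → ∀ k → G k ≡ G′ k
Conj-unique c c′ eq k = <-ext (λ {i} lt → ⇐ c′ (subst (k <_) (eq i) (⇒ c lt)))
                              (λ {i} lt → ⇐ c (subst (k <_) (sym (eq i)) (⇒ c′ lt)))

conjugate : ℕ → Shape → Shape
conjugate n F k = count n (λ i → k <ᵇ F i)

conjugate-Conj : ∀ n {F} → Decr F → (∀ i → n ≤ i → F i ≡ 0) → Conj F (conjugate n F)
conjugate-Conj n {F} D z = conj
  (λ {i} {k} lt → <ᵇ-true⇒< (<count⇒ n (closed k) i lt))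
  (λ {i} {k} lt → ⇒<count n (closed k) i (i<n lt) (<⇒<ᵇ-true lt))
  where
  closed : ∀ k → Closed (λ i → k <ᵇ F i)
  closed k i eq = <⇒<ᵇ-true (<-≤-trans (<ᵇ-true⇒< {k} eq) (D i))
  i<n : ∀ {i k} → k < F i → i < n
  i<n {i} {k} lt = ≰⇒> λ n≤i → contradiction (subst (k <_) (z i n≤i) lt) λ ()

-- Columns are counted from 0, so a box put at the end of row `i` lands in column `F i`.
Conj-Edge : ∀ {F G F′ G′ i} → Conj F G → Conj F′ G′ → Edge F (just i) F′ → Edge G (just (F i)) G′
Conj-Edge {F} {G} {F′} {G′} {i} c c′ e .at k with F i ≟ k
... | no Fi≢k = trans (<-ext
        (λ {x} lt → ⇐ c (old x (⇒ c′ lt)))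
        (λ {x} lt → ⇐ c′ (≤-trans (⇒ c lt) (Edge-≤ e x))))
        (sym (trans (cong (G k +_) (δ-off Fi≢k)) (+-identityʳ _)))
  where
  old : ∀ x → k < F′ x → k < F x
  old x lt with i ≟ x
  ... | no  i≢x  = subst (k <_) (Edge-at e (δ-off i≢x)) lt
  ... | yes refl = ≤∧≢⇒< (s≤s⁻¹ (subst (k <_) (trans (at e i) (trans (cong (F i +_) (δ-diag i)) (+-comm _ 1))) lt))
                         (Fi≢k ∘ sym)
... | yes refl = trans G′≡ (trans (+-comm 1 i) (cong₂ _+_ (sym G≡) (sym (δ-diag (F i)))))
  where
  F′i : F′ i ≡ suc (F i)
  F′i = trans (at e i) (trans (cong (F i +_) (δ-diag i)) (+-comm _ 1))
  i<G′ : i < G′ (F i)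
  i<G′ = ⇐ c′ (≤-reflexive (sym F′i))
  -- Column `F i` ends just above row `i`: after the addition it reaches row `i`, hence all rows
  -- above, and those were not changed.
  G≡ : G (F i) ≡ i
  G≡ = <-ext (λ {x} lt → ≰⇒> λ i≤x → <-irrefl refl (⇒ c (≤-<-trans i≤x lt)))
             (λ {x} lt → ⇐ c (subst (F i <_) (Edge-at e (δ-off (<⇒≢ lt ∘ sym))) (⇒ c′ (<-trans lt i<G′))))
  G′≡ : G′ (F i) ≡ suc i
  G′≡ = ≤-antisym (≮⇒≥ λ lt → <-irrefl refl (<-trans (n<1+n i)
          (subst (suc i <_) G≡ (⇐ c (subst (F i <_) (Edge-at e (δ-off {i} {suc i} λ ())) (⇒ c′ lt))))))
          i<G′

nth-beyond : ∀ xs i → length xs ≤ i → nth xs i ≡ 0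
nth-beyond []       i       le       = refl
nth-beyond (x ∷ xs) (suc i) (s≤s le) = nth-beyond xs i le

nth-Decr : ∀ {xs} → Linked _≥ℕ_ xs → Decr (nth xs)
nth-Decr []        k       = z≤n
nth-Decr [-]       zero    = z≤n
nth-Decr [-]       (suc k) = z≤n
nth-Decr (r ∷ l)   zero    = r
nth-Decr (r ∷ l)   (suc k) = nth-Decr l k

ht : IntPartition → Shape
ht p = conjugate (rows p) (nth (parts p))

ht-Conj : ∀ p → Conj (nth (parts p)) (ht p)
ht-Conj p = conjugate-Conj (rows p) (nth-Decr (decr p)) (nth-beyond (parts p))

Conj-Decr : ∀ {F G} → Conj F G → Decr G
Conj-Decr c k = ≮⇒≥ λ lt → <-irrefl refl (⇐ c (<-trans (n<1+n k) (⇒ c lt)))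

nth-applyUpTo : ∀ f n {i} → i < n → nth (applyUpTo f n) i ≡ f i
nth-applyUpTo f (suc n) {zero}  lt       = refl
nth-applyUpTo f (suc n) {suc i} (s≤s lt) = nth-applyUpTo (f ∘ suc) n lt

nth-applyUpTo-beyond : ∀ f n {i} → n ≤ i → nth (applyUpTo f n) i ≡ 0
nth-applyUpTo-beyond f zero    {i}     le       = refl
nth-applyUpTo-beyond f (suc n) {suc i} (s≤s le) = nth-applyUpTo-beyond (f ∘ suc) n le

-- With `suc K` in place of `K` column 0 is always counted. The parts are then positive and
-- decreasing for every `G`, and the conditions on `G` enter only in `fromHeights-Conj`.
fromHeights : ℕ → Shape → IntPartition
fromHeights K G .parts = applyUpTo (conjugate (suc K) G) (G 0)
fromHeights K G .decr  = Linked.applyUpTo⁺₂ (conjugate (suc K) G) (G 0)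
  λ i → count-mono (suc K) {λ k → suc i <ᵇ G k} {λ k → i <ᵇ G k}
    λ k eq → <⇒<ᵇ-true (<-trans (n<1+n i) (<ᵇ-true⇒< {suc i} {G k} eq))
fromHeights K G .pos   = All.applyUpTo⁺₁ (conjugate (suc K) G) (G 0) λ {i} → positive i
  where
  positive : ∀ i → i < G 0 → 0 < conjugate (suc K) G i
  positive i lt rewrite <⇒<ᵇ-true lt = s≤s z≤n

fromHeights-Conj : ∀ K {G} → Decr G → (∀ k → K ≤ k → G k ≡ 0) → Conj (nth (parts (fromHeights K G))) G
fromHeights-Conj K {G} D z = conj right left
  where
  c : Conj G (conjugate (suc K) G)
  c = conjugate-Conj (suc K) D (λ k le → z k (<⇒≤ le))
  D₀ : ∀ k → G k ≤ G 0
  D₀ zero    = ≤-refl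
  D₀ (suc k) = ≤-trans (D k) (D₀ k)
  right : ∀ {i k} → i < G k → k < nth (parts (fromHeights K G)) i
  right {i} {k} lt = subst (k <_) (sym (nth-applyUpTo _ (G 0) (<-≤-trans lt (D₀ k)))) (⇐ c lt)
  left : ∀ {i k} → k < nth (parts (fromHeights K G)) i → i < G k
  left {i} {k} lt with i <? G 0
  ... | yes i<G = ⇒ c (subst (k <_) (nth-applyUpTo _ (G 0) i<G) lt)
  ... | no  i≮G = contradiction (subst (k <_) (nth-applyUpTo-beyond _ (G 0) (≮⇒≥ i≮G)) lt) λ ()

ht-fromHeights : ∀ K {G} → Decr G → (∀ k → K ≤ k → G k ≡ 0) → ∀ k → ht (fromHeights K G) k ≡ G k
ht-fromHeights K {G} D z = Conj-unique (ht-Conj (fromHeights K G)) (fromHeights-Conj K D z) (λ _ → refl)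

nth-injective : ∀ {xs ys} → All (0 <_) xs → All (0 <_) ys → (∀ i → nth xs i ≡ nth ys i) → xs ≡ ys
nth-injective []       []       eq = refl
nth-injective []       (q ∷ qs) eq = contradiction (eq 0) (<⇒≢ q)
nth-injective (p ∷ ps) []       eq = contradiction (sym (eq 0)) (<⇒≢ p)
nth-injective (p ∷ ps) (q ∷ qs) eq = cong₂ _∷_ (eq 0) (nth-injective ps qs (eq ∘ suc))

ht-injective : ∀ p q → (∀ k → ht p k ≡ ht q k) → parts p ≡ parts q
ht-injective p q eq = nth-injective (pos p) (pos q)
  (Conj-unique (Conj-sym (ht-Conj p)) (Conj-sym (ht-Conj q)) eq)

ht-cong : ∀ {p q} → parts p ≡ parts q → ∀ k → ht p k ≡ ht q k
ht-cong eq k = cong (λ xs → conjugate (length xs) (nth xs) k) eq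

rows≡ht : ∀ p → rows p ≡ ht p 0
rows≡ht p = <-ext (λ lt → ⇐ (ht-Conj p) (positive (pos p) lt))
                  (λ {i} lt → ≰⇒> λ le → contradiction (subst (0 <_) (nth-beyond (parts p) i le) (⇒ (ht-Conj p) lt)) λ ())
  where
  positive : ∀ {xs i} → All (0 <_) xs → i < length xs → 0 < nth xs i
  positive {i = zero}  (px ∷ _)  lt       = px
  positive {i = suc i} (_ ∷ pxs) (s≤s lt) = positive pxs lt

cols≡nth : ∀ p → cols p ≡ nth (parts p) 0
cols≡nth p = go (decr p)
  where
  go : ∀ {xs} → Linked _≥ℕ_ xs → foldr _⊔_ 0 xs ≡ nth xs 0
  go []          = refl
  go ([-] {x})   = ⊔-identityʳ x
  go (_∷_ {x} r l) = trans (cong (x ⊔_) (go l)) (m≥n⇒m⊔n≡m r)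

<cols⇒ : ∀ p {m} → m < cols p → 0 < ht p m
<cols⇒ p {m} lt = ⇐ (ht-Conj p) (subst (m <_) (cols≡nth p) lt)

⇒<cols : ∀ p {m} → 0 < ht p m → m < cols p
⇒<cols p {m} lt = subst (m <_) (sym (cols≡nth p)) (⇒ (ht-Conj p) lt)

Conj-mono : ∀ {F G F′ G′} → Conj F G → Conj F′ G′ → (∀ i → F i ≤ F′ i) → ∀ k → G k ≤ G′ k
Conj-mono c c′ le k = ≮⇒≥ λ lt → <-irrefl refl (⇐ c′ (<-≤-trans (⇒ c lt) (le _)))

-- Adding one box: sizes against edges

Σ< : ℕ → Shape → ℕ
Σ< zero    f = 0
Σ< (suc n) f = f 0 + Σ< n (f ∘ suc)

Σ<-mono : ∀ n {f g} → (∀ i → f i ≤ g i) → Σ< n f ≤ Σ< n g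
Σ<-mono zero    le = z≤n
Σ<-mono (suc n) le = +-mono-≤ (le 0) (Σ<-mono n (le ∘ suc))

Σ<-zero : ∀ n {f} → (∀ i → f i ≡ 0) → Σ< n f ≡ 0
Σ<-zero zero    z = refl
Σ<-zero (suc n) z = cong₂ _+_ (z 0) (Σ<-zero n (z ∘ suc))

sum≡Σ< : ∀ xs n → length xs ≤ n → sum xs ≡ Σ< n (nth xs)
sum≡Σ< []       n       le       = sym (Σ<-zero n (λ _ → refl))
sum≡Σ< (x ∷ xs) (suc n) (s≤s le) = cong (x +_) (sum≡Σ< xs n le)

Σ<-equal : ∀ n {f g} → (∀ i → f i ≤ g i) → Σ< n g ≤ Σ< n f → ∀ i → i < n → g i ≡ f i
Σ<-equal (suc n) {f} {g} le ge zero lt = ≤-antisym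
  (+-cancelʳ-≤ (Σ< n (g ∘ suc)) _ _ (≤-trans ge (+-monoʳ-≤ (f 0) (Σ<-mono n (le ∘ suc))))) (le 0)
Σ<-equal (suc n) {f} {g} le ge (suc i) (s≤s lt) = Σ<-equal n (le ∘ suc)
  (+-cancelˡ-≤ (f 0) _ _ (≤-trans (+-monoˡ-≤ _ (le 0)) ge)) i lt

Σ<-Edge : ∀ n {f g i} → Edge f (just i) g → i < n → Σ< n g ≡ suc (Σ< n f)
Σ<-Edge (suc n) {f} {g} {zero} e lt = cong₂ _+_ (trans (at e 0) (+-comm (f 0) 1)) (go n λ i → trans (at e (suc i)) (+-identityʳ _))
  where
  go : ∀ n {f g} → (∀ i → g i ≡ f i) → Σ< n g ≡ Σ< n f
  go zero    eq = refl
  go (suc n) eq = cong₂ _+_ (eq 0) (go n (eq ∘ suc))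
Σ<-Edge (suc n) {f} {g} {suc i} e (s≤s lt) = trans
  (cong₂ _+_ (trans (at e 0) (+-identityʳ _)) (Σ<-Edge n (edge (at e ∘ suc)) lt)) (+-suc (f 0) _)

-- The surplus is one box. The first entry that differs uses it up, and the remaining entries, being
-- ordered with equal sums, coincide.
Σ<-Edge⁻ : ∀ n {f g} → (∀ i → f i ≤ g i) → (∀ i → n ≤ i → g i ≡ f i) → Σ< n g ≡ suc (Σ< n f) →
           ∃ λ i → Edge f (just i) g
Σ<-Edge⁻ (suc n) {f} {g} le out eq with g 0 ≟ f 0
... | yes g≡f = let i , e = Σ<-Edge⁻ n (le ∘ suc) (λ i l → out (suc i) (s≤s l))
                              (+-cancelˡ-≡ (f 0) _ _ (trans (cong (_+ _) (sym g≡f)) (trans eq (sym (+-suc (f 0) _)))))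
                in suc i , edge λ { zero → trans g≡f (sym (+-identityʳ _)) ; (suc k) → at e k }
... | no  g≢f = 0 , edge λ { zero → trans g0≡ (+-comm 1 _) ; (suc k) → trans (rest k) (sym (+-identityʳ _)) }
  where
  f0<g0 : suc (f 0) ≤ g 0
  f0<g0 = ≤∧≢⇒< (le 0) (g≢f ∘ sym)
  tail-le : Σ< n (g ∘ suc) ≤ Σ< n (f ∘ suc)
  tail-le = +-cancelˡ-≤ (suc (f 0)) _ _ (≤-trans (+-monoˡ-≤ _ f0<g0) (≤-reflexive eq))
  rest : ∀ k → g (suc k) ≡ f (suc k)
  rest k with k <? n
  ... | yes lt = Σ<-equal n (le ∘ suc) tail-le k lt
  ... | no  nl = out (suc k) (s≤s (≮⇒≥ nl))
  g0≡ : g 0 ≡ suc (f 0)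
  g0≡ = ≤-antisym (+-cancelʳ-≤ (Σ< n (g ∘ suc)) _ _ (≤-trans (≤-reflexive eq) (s≤s (+-monoʳ-≤ (f 0) (Σ<-mono n (le ∘ suc)))))) f0<g0

AddY⇒Edge : ∀ {p q} → AddY p q → ∃ λ k → Edge (ht p) (just k) (ht q)
AddY⇒Edge {p} {q} (sub , sz) =
  let n = rows p ⊔ rows q
      i , e = Σ<-Edge⁻ n sub
        (λ i le → trans (nth-beyond (parts q) i (≤-trans (m≤n⊔m (rows p) (rows q)) le))
                    (sym (nth-beyond (parts p) i (≤-trans (m≤m⊔n (rows p) (rows q)) le))))
        (trans (sym (sum≡Σ< (parts q) n (m≤n⊔m (rows p) (rows q))))
          (trans sz (cong suc (sum≡Σ< (parts p) n (m≤m⊔n (rows p) (rows q))))))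
  in nth (parts p) i , Conj-Edge (ht-Conj p) (ht-Conj q) e

Edge⇒AddY : ∀ {p q k} → Edge (ht p) (just k) (ht q) → AddY p q
Edge⇒AddY {p} {q} {k} e = Edge-≤ e′ ,
  trans (sum≡Σ< (parts q) n (m≤n⊔m (rows p) (rows q)))
    (trans (Σ<-Edge n e′ i<n) (cong suc (sym (sum≡Σ< (parts p) n (m≤m⊔n (rows p) (rows q))))))
  where
  n = rows p ⊔ rows q
  i = ht p k
  e′ : Edge (nth (parts p)) (just i) (nth (parts q))
  e′ = Conj-Edge (Conj-sym (ht-Conj p)) (Conj-sym (ht-Conj q)) e
  i<n : i < n
  i<n = ≰⇒> λ le → contradiction
    (trans (sym (at e′ i)) (nth-beyond (parts q) i (≤-trans (m≤n⊔m (rows p) (rows q)) le)))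
    (λ eq → 1+n≢0 (trans (sym (δ-diag i)) (m+n≡0⇒n≡0 (nth (parts p) i) eq)))

⊆Y⇒≤ : ∀ {p q} → p ⊆Y q → ∀ k → ht p k ≤ ht q k
⊆Y⇒≤ {p} {q} = Conj-mono (ht-Conj p) (ht-Conj q)

≤⇒⊆Y : ∀ {p q} → (∀ k → ht p k ≤ ht q k) → p ⊆Y q
≤⇒⊆Y {p} {q} = Conj-mono (Conj-sym (ht-Conj p)) (Conj-sym (ht-Conj q))

-- Arc systems

-- The arcs of a colored partition without its blocks. `row` and `column` range over all colors at
-- once, so the arcs form disjoint paths, and every arc has one color.
record ArcSystem (N r : ℕ) : Set where
  field
    marks  : Fin r → ℕ → ℕ → Bool
    ordered : ∀ {c s t} → marks c s t ≡ true → s < t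
    bounded : ∀ {c s t} → marks c s t ≡ true → t < N
    row    : ∀ {c c′ s t t′} → marks c s t ≡ true → marks c′ s t′ ≡ true → t ≡ t′ × c ≡ c′
    column : ∀ {c c′ s s′ t} → marks c s t ≡ true → marks c′ s′ t ≡ true → s ≡ s′ × c ≡ c′

open ArcSystem

≡-from-true : ∀ {x y : Bool} → (x ≡ true → y ≡ true) → (y ≡ true → x ≡ true) → x ≡ y
≡-from-true {true}  {_}     f g = sym (f refl)
≡-from-true {false} {true}  f g = g refl
≡-from-true {false} {false} f g = refl

does-true : ∀ {a} {A : Set a} (d : Dec A) → does d ≡ true → A
does-true (yes a) _ = a

-- From colored partitions to arc systems

module _ {n} (P : SetPartition n) where

  Arc? : ∀ i j → Dec (Arc P i j)
  Arc? i j = (same P i j Bool.≟ true) ×-dec ((i F.<? j) ×-dec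
    all? λ k → (i F.<? k) →-dec ((k F.<? j) →-dec (same P i k Bool.≟ false)))

  Arc-right-unique : ∀ {i j j′} → Arc P i j → Arc P i j′ → j ≡ j′
  Arc-right-unique {i} {j} {j′} (p , l , m) (p′ , l′ , m′) with F.<-cmp j j′
  ... | tri≈ _ eq _ = eq
  ... | tri< lt _ _ = contradiction (trans (sym p) (m′ j l lt)) λ ()
  ... | tri> _ _ gt = contradiction (trans (sym p′) (m j′ l′ gt)) λ ()

  Arc-left-unique : ∀ {i i′ j} → Arc P i j → Arc P i′ j → i ≡ i′
  Arc-left-unique {i} {i′} {j} (p , l , m) (p′ , l′ , m′) with F.<-cmp i i′
  ... | tri≈ _ eq _ = eq
  ... | tri< lt _ _ = contradiction
    (trans (sym (same-trans P i j i′ p (trans (same-sym P j i′) p′))) (m i′ lt l′)) λ ()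
  ... | tri> _ _ gt = contradiction
    (trans (sym (same-trans P i′ j i p′ (trans (same-sym P j i) p))) (m′ i gt l)) λ ()

  -- As long as the block has an element strictly between `i` and `j`, move `i` up to it; when none
  -- is left, `i` is the predecessor of `j`.
  Arc-exists : ∀ {i j} → i F.< j → same P i j ≡ true → ∃ λ z → i F.≤ z × Arc P z j
  Arc-exists {i} {j} i<j p = go (toℕ j ∸ toℕ i) i i<j p ≤-refl
    where
    go : ∀ m i → i F.< j → same P i j ≡ true → toℕ j ∸ toℕ i ≤ m → ∃ λ z → i F.≤ z × Arc P z j
    go zero    i i<j p le = contradiction (m∸n≡0⇒m≤n (n≤0⇒n≡0 le)) (<⇒≱ i<j)
    go (suc m) i i<j p le with any? (λ k → (i F.<? k) ×-dec ((k F.<? j) ×-dec (same P i k Bool.≟ true)))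
    ... | no none = i , ≤-refl , p , i<j , λ k i<k k<j → Bool.¬-not λ q → none (k , i<k , k<j , q)
    ... | yes (k , i<k , k<j , q)
      with go m k k<j (same-trans P k i j (trans (same-sym P k i) q) p)
             (s≤s⁻¹ (≤-trans (∸-monoʳ-< i<k (<⇒≤ k<j)) le))
    ...   | z , k≤z , a = z , ≤-trans (<⇒≤ i<k) k≤z , a

IsArc : ∀ {n r} → ColPartition n r → Fin r → ℕ → ℕ → Set
IsArc {n} Λ c s t = ∃ λ (i : Fin n) → ∃ λ (j : Fin n) →
  toℕ i ≡ s × toℕ j ≡ t × Arc (part Λ) i j × col Λ i j ≡ c

IsArc? : ∀ {n r} (Λ : ColPartition n r) c s t → Dec (IsArc Λ c s t)
IsArc? Λ c s t = any? λ i → any? λ j →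
  (toℕ i ≟ s) ×-dec ((toℕ j ≟ t) ×-dec (Arc? (part Λ) i j ×-dec (col Λ i j F.≟ c)))

abstract
  arcs : ∀ {n r} → ColPartition n r → ArcSystem n r
  arcs Λ .marks c s t = does (IsArc? Λ c s t)
  arcs Λ .ordered {c} {s} {t} m with does-true (IsArc? Λ c s t) m
  ... | i , j , refl , refl , (_ , lt , _) , _ = lt
  arcs Λ .bounded {c} {s} {t} m with does-true (IsArc? Λ c s t) m
  ... | i , j , refl , refl , _ = toℕ<n j
  arcs Λ .row {c} {c′} {s} {t} {t′} m m′
    with does-true (IsArc? Λ c s t) m | does-true (IsArc? Λ c′ s t′) m′
  ... | i , j , refl , refl , a , refl | i′ , j′ , eq , refl , a′ , refl with toℕ-injective eq
  ...   | refl with Arc-right-unique (part Λ) a a′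
  ...     | refl = refl , refl
  arcs Λ .column {c} {c′} {s} {s′} {t} m m′
    with does-true (IsArc? Λ c s t) m | does-true (IsArc? Λ c′ s′ t) m′
  ... | i , j , refl , refl , a , refl | i′ , j′ , refl , eq , a′ , refl with toℕ-injective eq
  ...   | refl with Arc-left-unique (part Λ) a a′
  ...     | refl = refl , refl

  marks⇒IsArc : ∀ {n r} (Λ : ColPartition n r) {c s t} → marks (arcs Λ) c s t ≡ true → IsArc Λ c s t
  marks⇒IsArc Λ {c} {s} {t} = does-true (IsArc? Λ c s t)

  IsArc⇒marks : ∀ {n r} (Λ : ColPartition n r) {c s t} → IsArc Λ c s t → marks (arcs Λ) c s t ≡ true
  IsArc⇒marks Λ {c} {s} {t} = dec-true (IsArc? Λ c s t)

IsArc-cong : ∀ {n r} {Λ Λ′ : ColPartition n r} → Λ ≈CP Λ′ → ∀ {c s t} → IsArc Λ c s t → IsArc Λ′ c s t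
IsArc-cong (eq , eqc) (i , j , p , q , a@(x , y , z) , refl) =
  i , j , p , q , (trans (sym (eq i j)) x , y , λ k l m → trans (sym (eq i k)) (z k l m)) , sym (eqc i j a)

≈CP-sym : ∀ {n r} {Λ Λ′ : ColPartition n r} → Λ ≈CP Λ′ → Λ′ ≈CP Λ
≈CP-sym (eq , eqc) = (λ i j → sym (eq i j)) , λ i j (x , y , z) →
  sym (eqc i j (trans (eq i j) x , y , λ k l m → trans (eq i k) (z k l m)))

arcs-cong : ∀ {n r} {Λ Λ′ : ColPartition n r} → Λ ≈CP Λ′ →
            ∀ c s t → marks (arcs Λ) c s t ≡ marks (arcs Λ′) c s t
arcs-cong {Λ = Λ} {Λ′} eq c s t = ≡-from-true
  (λ m → IsArc⇒marks Λ′ (IsArc-cong {Λ = Λ} {Λ′} eq (marks⇒IsArc Λ m)))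
  (λ m → IsArc⇒marks Λ (IsArc-cong {Λ = Λ′} {Λ} (≈CP-sym {Λ = Λ} {Λ′} eq) (marks⇒IsArc Λ′ m)))

-- From arc systems to colored partitions

module Blocks {N r} (S : ArcSystem N r) where

  opener? : ∀ t → Dec (∃ λ (s : Fin t) → ∃ λ c → marks S c (toℕ s) t ≡ true)
  opener? t = any? λ s → any? λ c → marks S c (toℕ s) t Bool.≟ true

  opener : ℕ → Maybe ℕ
  opener t with opener? t
  ... | yes (s , _) = just (toℕ s)
  ... | no  _       = nothing

  opener⇒mark : ∀ {s t} → opener t ≡ just s → ∃ λ c → marks S c s t ≡ true
  opener⇒mark {s} {t} eq with opener? t
  opener⇒mark refl | yes (s , c , m) = c , m

  mark⇒opener : ∀ {c s t} → marks S c s t ≡ true → opener t ≡ just s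
  mark⇒opener {c} {s} {t} m with opener? t
  ... | yes (s′ , c′ , m′) = cong just (proj₁ (column S m′ m))
  ... | no none = contradiction
    (fromℕ< (ordered S m) , c , subst (λ u → marks S c u t ≡ true) (sym (toℕ-fromℕ< (ordered S m))) m) none

  opener-< : ∀ {s t} → opener t ≡ just s → s < t
  opener-< eq = ordered S (proj₂ (opener⇒mark eq))

  opener-injective : ∀ {s t t′} → opener t ≡ just s → opener t′ ≡ just s → t ≡ t′
  opener-injective p q = proj₁ (row S (proj₂ (opener⇒mark p)) (proj₂ (opener⇒mark q)))

  -- Follows openers back to the first element of the block. Openers decrease strictly, so `t` steps
  -- are enough from `t`, and any larger allowance gives the same root.
  rootF : ℕ → ℕ → ℕ
  rootF zero    t = t
  rootF (suc f) t with opener t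
  ... | nothing = t
  ... | just s  = rootF f s

  root : ℕ → ℕ
  root t = rootF t t

  rootF-stable : ∀ f f′ t → t ≤ f → t ≤ f′ → rootF f t ≡ rootF f′ t
  rootF-stable zero    zero     t _ _ = refl
  rootF-stable zero    (suc f′) t t≤0 _ with opener t in eq
  ... | nothing = refl
  ... | just s  = contradiction (<-≤-trans (opener-< eq) t≤0) λ ()
  rootF-stable (suc f) zero     t _ t≤0 with opener t in eq
  ... | nothing = refl
  ... | just s  = contradiction (<-≤-trans (opener-< eq) t≤0) λ ()
  rootF-stable (suc f) (suc f′) t le le′ with opener t in eq
  ... | nothing = refl
  ... | just s  = rootF-stable f f′ s (s≤s⁻¹ (≤-trans (opener-< eq) le)) (s≤s⁻¹ (≤-trans (opener-< eq) le′))

  root-first : ∀ {t} → opener t ≡ nothing → root t ≡ t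
  root-first {zero}  eq = refl
  root-first {suc t} eq rewrite eq = refl

  root-step : ∀ {s t} → opener t ≡ just s → root t ≡ root s
  root-step {s} {zero}  eq = contradiction (opener-< {t = 0} eq) λ ()
  root-step {s} {suc t} eq = trans (unfold eq) (rootF-stable t s s (s≤s⁻¹ (opener-< eq)) ≤-refl)
    where
    unfold : ∀ {s} → opener (suc t) ≡ just s → root (suc t) ≡ rootF t s
    unfold eq rewrite eq = refl

  rootF-≤ : ∀ f t → rootF f t ≤ t
  rootF-≤ zero    t = ≤-refl
  rootF-≤ (suc f) t with opener t in eq
  ... | nothing = ≤-refl
  ... | just s  = ≤-trans (rootF-≤ f s) (<⇒≤ (opener-< eq))

  root-≤ : ∀ t → root t ≤ t
  root-≤ t = rootF-≤ t t

  has-opener : ∀ {x y} → x < y → root x ≡ root y → ∃ λ z → opener y ≡ just z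
  has-opener {x} {y} x<y eq with opener y in eqy
  ... | just z  = z , refl
  ... | nothing = contradiction (≤-<-trans (≤-trans (≤-reflexive (sym (trans eq (root-first eqy)))) (root-≤ x)) x<y) (<-irrefl refl)

  -- Suppose z < x < y, and let w be the opener of x, which exists as z is an earlier point of the
  -- same class. If w = z, two arcs begin at z. If w < z, the claim for the arc from w to x and the
  -- point z is violated; if z < w, the claim for the arc from z to y and the point w. Either
  -- instance has a smaller sum than `y + x`.
  no-gap : ∀ {x y z} → opener y ≡ just z → root x ≡ root y → x < y → x ≤ z
  no-gap {x} {y} = go (suc (y + x)) y x ≤-refl
    where
    go : ∀ m y x {z} → y + x < m → opener y ≡ just z → root x ≡ root y → x < y → x ≤ z
    go (suc m) y x {z} le op eq x<y = ≮⇒≥ λ z<x → absurd z<x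
      where
      absurd : z < x → ⊥
      absurd z<x with has-opener z<x (trans (sym (root-step op)) (sym eq))
      ... | w , opx with <-cmp w z
      ...   | tri≈ _ refl _ = <⇒≢ x<y (opener-injective opx op)
      ...   | tri< w<z _ _ = <⇒≱ w<z (go m x z
                (s≤s⁻¹ (≤-trans (s≤s (subst (_< y + x) (+-comm z x) (+-monoˡ-< x (opener-< op)))) le))
                opx (trans (sym (root-step op)) (sym eq)) z<x)
      ...   | tri> _ _ z<w = <⇒≱ z<w (go m y w
                (s≤s⁻¹ (≤-trans (s≤s (+-monoʳ-< y (opener-< opx))) le))
                op (trans (sym (root-step opx)) eq) (<-trans (opener-< opx) x<y))

  blocks : SetPartition N
  blocks .same i j = does (root (toℕ i) ≟ root (toℕ j))
  blocks .same-refl i = dec-true (root (toℕ i) ≟ root (toℕ i)) refl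
  blocks .same-sym i j = ≡-from-true
    (λ p → dec-true (root (toℕ j) ≟ root (toℕ i)) (sym (does-true (root (toℕ i) ≟ root (toℕ j)) p)))
    (λ p → dec-true (root (toℕ i) ≟ root (toℕ j)) (sym (does-true (root (toℕ j) ≟ root (toℕ i)) p)))
  blocks .same-trans i j k p q = dec-true (root (toℕ i) ≟ root (toℕ k))
    (trans (does-true (root (toℕ i) ≟ root (toℕ j)) p) (does-true (root (toℕ j) ≟ root (toℕ k)) q))

  same⇒root : ∀ i j → same blocks i j ≡ true → root (toℕ i) ≡ root (toℕ j)
  same⇒root i j = does-true (root (toℕ i) ≟ root (toℕ j))

  mark⇒Arc : ∀ {c} {i j : Fin N} → marks S c (toℕ i) (toℕ j) ≡ true → Arc blocks i j
  mark⇒Arc {c} {i} {j} m =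
    dec-true (root (toℕ i) ≟ root (toℕ j)) (sym (root-step op)) , ordered S m ,
    λ k i<k k<j → dec-false (root (toℕ i) ≟ root (toℕ k)) λ eq →
      <⇒≱ i<k (no-gap op (trans (sym eq) (sym (root-step op))) k<j)
    where
    op : opener (toℕ j) ≡ just (toℕ i)
    op = mark⇒opener m

  Arc⇒mark : ∀ {i j : Fin N} → Arc blocks i j → ∃ λ c → marks S c (toℕ i) (toℕ j) ≡ true
  Arc⇒mark {i} {j} (p , i<j , gap) with has-opener i<j (same⇒root i j p)
  ... | z , op with m≤n⇒m<n∨m≡n (no-gap op (same⇒root i j p) i<j)
  ...   | inj₂ refl = opener⇒mark op
  ...   | inj₁ i<z = contradiction
    (trans (sym (gap k (subst (toℕ i <_) (sym k≡) i<z) (subst (_< toℕ j) (sym k≡) (opener-< op))))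
      (dec-true (root (toℕ i) ≟ root (toℕ k)) (trans (same⇒root i j p) (trans (root-step op) (cong root (sym k≡))))))
    λ ()
    where
    z<N : z < N
    z<N = <-trans (opener-< op) (toℕ<n j)
    k : Fin N
    k = fromℕ< z<N
    k≡ : toℕ k ≡ z
    k≡ = toℕ-fromℕ< z<N

  module _ (c₀ : Fin r) where

    -- `c₀` is the color of pairs that are no arcs; `_≈CP_` does not look at them.
    color : Fin N → Fin N → Fin r
    color i j with any? (λ c → marks S c (toℕ i) (toℕ j) Bool.≟ true)
    ... | yes (c , _) = c
    ... | no  _       = c₀

    color-mark : ∀ {c i j} → marks S c (toℕ i) (toℕ j) ≡ true → color i j ≡ c
    color-mark {c} {i} {j} m with any? (λ c → marks S c (toℕ i) (toℕ j) Bool.≟ true)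
    ... | yes (c′ , m′) = proj₂ (row S m′ m)
    ... | no none = contradiction (c , m) none

    colPartition : ColPartition N r
    colPartition .part = blocks
    colPartition .col  = color

    arcs-colPartition : ∀ c s t → marks (arcs colPartition) c s t ≡ marks S c s t
    arcs-colPartition c s t = ≡-from-true fore back
      where
      fore : marks (arcs colPartition) c s t ≡ true → marks S c s t ≡ true
      fore m with marks⇒IsArc colPartition m
      ... | i , j , refl , refl , a , refl with Arc⇒mark a
      ...   | c′ , m′ rewrite color-mark {i = i} {j} m′ = m′
      back : marks S c s t ≡ true → marks (arcs colPartition) c s t ≡ true
      back m = IsArc⇒marks colPartition (i , j , i≡ , j≡ , mark⇒Arc m′ , color-mark m′)
        where
        t<N = bounded S m
        s<N = <-trans (ordered S m) t<N
        i = fromℕ< s<N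
        j = fromℕ< t<N
        i≡ = toℕ-fromℕ< s<N
        j≡ = toℕ-fromℕ< t<N
        m′ : marks S c (toℕ i) (toℕ j) ≡ true
        m′ = subst₂ (λ u w → marks S c u w ≡ true) (sym i≡) (sym j≡) m

open Blocks using (blocks; colPartition; arcs-colPartition)

module _ {N r} {S S′ : ArcSystem N r} (eq : ∀ c s t → marks S c s t ≡ marks S′ c s t) where
  open Blocks

  opener-cong : ∀ t → opener S t ≡ opener S′ t
  opener-cong t with opener S t in p
  ... | just s  = let c , m = opener⇒mark S p in sym (mark⇒opener S′ (trans (sym (eq c s t)) m))
  ... | nothing with opener S′ t in q
  ...   | nothing = refl
  ...   | just s  = let c , m = opener⇒mark S′ q in trans (sym p) (mark⇒opener S (trans (eq c s t) m))

  rootF-cong : ∀ f t → rootF S f t ≡ rootF S′ f t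
  rootF-cong zero    t = refl
  rootF-cong (suc f) t with opener S t | opener S′ t | opener-cong t
  ... | nothing | .nothing  | refl = refl
  ... | just s  | .(just s) | refl = rootF-cong f s

  colPartition-cong : ∀ c₀ → colPartition S c₀ ≈CP colPartition S′ c₀
  colPartition-cong c₀ =
    (λ i j → cong₂ (λ x y → does (x ≟ y)) (rootF-cong (toℕ i) (toℕ i)) (rootF-cong (toℕ j) (toℕ j))) ,
    λ i j a → let c , m = Arc⇒mark S a in
      trans (color-mark S c₀ m) (sym (color-mark S′ c₀ (trans (sym (eq c (toℕ i) (toℕ j))) m)))

module _ {n r} (Λ : ColPartition n r) (c₀ : Fin r) where
  open Blocks (arcs Λ) hiding (colPartition)

  private
    P : SetPartition n
    P = part Λ

  Arc⇒opener : ∀ {i j} → Arc P i j → opener (toℕ j) ≡ just (toℕ i)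
  Arc⇒opener {i} {j} a = mark⇒opener (IsArc⇒marks Λ (i , j , refl , refl , a , refl))

  opener⇒Arc : ∀ {z} j → opener (toℕ j) ≡ just z → ∃ λ i → toℕ i ≡ z × Arc P i j
  opener⇒Arc j op with marks⇒IsArc Λ (proj₂ (opener⇒mark op))
  ... | i , j′ , p , q , a , _ with toℕ-injective q
  ...   | refl = i , p , a

  same⇒root≡ : ∀ m i j → toℕ j < m → i F.≤ j → same P i j ≡ true → root (toℕ i) ≡ root (toℕ j)
  same⇒root≡ (suc m) i j le i≤j p with m≤n⇒m<n∨m≡n i≤j
  ... | inj₂ eq = cong root eq
  ... | inj₁ i<j with Arc-exists P i<j p
  ...   | z , i≤z , a@(q , z<j , _) = trans
    (same⇒root≡ m i z (s≤s⁻¹ (≤-trans (s≤s z<j) le)) i≤z (same-trans P i j z p (trans (same-sym P j z) q)))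
    (sym (root-step (Arc⇒opener a)))

  root≡⇒same : ∀ m i j → toℕ j < m → i F.≤ j → root (toℕ i) ≡ root (toℕ j) → same P i j ≡ true
  root≡⇒same (suc m) i j le i≤j eq with m≤n⇒m<n∨m≡n i≤j
  ... | inj₂ i≡j = subst (λ k → same P i k ≡ true) (toℕ-injective i≡j) (same-refl P i)
  ... | inj₁ i<j with has-opener i<j eq
  ...   | z , op with opener⇒Arc j op
  ...     | z′ , refl , a@(q , z<j , _) = same-trans P i z′ j
    (root≡⇒same m i z′ (s≤s⁻¹ (≤-trans (s≤s z<j) le)) (no-gap op eq i<j) (trans eq (root-step op))) q

  colPartition-arcs : colPartition (arcs Λ) c₀ ≈CP Λ
  colPartition-arcs = same≡ , λ i j a → color≡ i j (Arc⇒mark a)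
    where
    same≡ : ∀ i j → does (root (toℕ i) ≟ root (toℕ j)) ≡ same P i j
    same≡ i j = ≡-from-true (λ p → fore (does-true (root (toℕ i) ≟ root (toℕ j)) p))
                            (λ p → dec-true (root (toℕ i) ≟ root (toℕ j)) (back p))
      where
      fore : root (toℕ i) ≡ root (toℕ j) → same P i j ≡ true
      fore eq with ≤-total (toℕ i) (toℕ j)
      ... | inj₁ le = root≡⇒same (suc (toℕ j)) i j ≤-refl le eq
      ... | inj₂ ge = trans (same-sym P i j) (root≡⇒same (suc (toℕ i)) j i ≤-refl ge (sym eq))
      back : same P i j ≡ true → root (toℕ i) ≡ root (toℕ j)
      back p with ≤-total (toℕ i) (toℕ j)
      ... | inj₁ le = same⇒root≡ (suc (toℕ j)) i j ≤-refl le p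
      ... | inj₂ ge = sym (same⇒root≡ (suc (toℕ i)) j i ≤-refl ge (trans (same-sym P j i) p))
    color≡ : ∀ i j → (∃ λ c → marks (arcs Λ) c (toℕ i) (toℕ j) ≡ true) → color c₀ i j ≡ col Λ i j
    color≡ i j (c , m) with marks⇒IsArc Λ m
    ... | i′ , j′ , p , q , a , refl with toℕ-injective p | toℕ-injective q
    ...   | refl | refl = color-mark c₀ m

-- Arc systems and colored staircases

-- One step of a tableau changes one component only, so at most one color carries a label.
Exclusive : ∀ {r} → (Fin r → Label) → Set
Exclusive l = ∀ {c c′} → l c ≢ nothing → l c′ ≢ nothing → c ≡ c′

record ColStair (N r : ℕ) : Set where
  field
    stairOf : Fin r → Stair N
    exclᵃ   : ∀ t → Exclusive (λ c → a (stairOf c) t)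
    exclᵇ   : ∀ t → Exclusive (λ c → b (stairOf c) t)

open ColStair

reflect : ∀ {N t} → t < N → N ∸ suc (N ∸ suc t) ≡ t
reflect {suc N} (s≤s t≤N) = m∸[m∸n]≡n t≤N

t+[N∸1+t] : ∀ {N t} → t < N → suc (t + (N ∸ suc t)) ≡ N
t+[N∸1+t] = m+[n∸m]≡n

just⇒≢nothing : ∀ {l : Label} {i} → l ≡ just i → l ≢ nothing
just⇒≢nothing refl ()

≢nothing⇒just : ∀ {l : Label} → l ≢ nothing → ∃ λ i → l ≡ just i
≢nothing⇒just {just i}  _  = i , refl
≢nothing⇒just {nothing} ne = contradiction refl ne

module _ {N r} (S : ArcSystem N r) where

  -- The second coordinate counts closers from the right.  For d ≥ N truncated subtraction gives
  -- closer 0, which ends no arc.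
  filling : Fin r → Filling
  filling c s d = marks S c s (N ∸ suc d)

  filling-row : ∀ {c s d d′} → filling c s d ≡ true → filling c s d′ ≡ true → d ≡ d′
  filling-row {c} {s} {d} {d′} m m′ = suc-injective
    (∸-cancelˡ-≡ (inside m) (inside m′) (proj₁ (row S m m′)))
    where
    inside : ∀ {d} → filling c s d ≡ true → d < N
    inside {d} m = <⇒≤ (m∸n≢0⇒n<m λ eq → contradiction (subst (s <_) eq (ordered S m)) λ ())

  abstract
    growthOf : ∀ c → Growth (filling c)
    growthOf c = Forward.growth (filling c) filling-row (λ m m′ → proj₁ (column S m m′))

  filling-mark : ∀ {c s t} → marks S c s t ≡ true → filling c s (N ∸ suc t) ≡ true
  filling-mark {c} {s} m = subst (λ u → marks S c s u ≡ true) (sym (reflect (bounded S m))) m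

  stairAt : Fin r → Stair N
  stairAt c = stair (growthOf c) N

  label-inside : ∀ t (f : ℕ → Label) → f 0 ≡ nothing → f (N ∸ t) ≢ nothing → t < N
  label-inside t f z ne = m∸n≢0⇒n<m λ eq → ne (trans (cong f eq) z)

  -- With the three lemmas that follow: in color `c`, point `t` begins an arc exactly if the edge
  -- `a` at `t` adds a box, and ends an arc exactly if the edge `b` at `t` stands for a removed one.
  stair-opener : ∀ {c t} → a (stairAt c) t ≢ nothing → ∃ λ u → marks S c t u ≡ true
  stair-opener {c} {t} ne = N ∸ suc (proj₁ src) , proj₂ (proj₂ src)
    where
    t<N = label-inside t (aAt (growthOf c) t) refl ne
    src = H-source (growthOf c) t (N ∸ suc t)
      (trans (sym (stair-a (growthOf c) N t (N ∸ suc t) (t+[N∸1+t] t<N))) (proj₂ (≢nothing⇒just ne)))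

  stair-closer : ∀ {c t} → b (stairAt c) t ≢ nothing → ∃ λ s → marks S c s t ≡ true
  stair-closer {c} {t} ne = proj₁ src , subst (λ u → marks S c (proj₁ src) u ≡ true) (reflect t<N) (proj₂ (proj₂ src))
    where
    t<N = label-inside t (bAt (growthOf c) t) refl ne
    src = H-source (transpose (growthOf c)) (N ∸ suc t) t
      (trans (sym (stair-b (growthOf c) N t (N ∸ suc t) (t+[N∸1+t] t<N))) (proj₂ (≢nothing⇒just ne)))

  opener-stair : ∀ {c t u} → marks S c t u ≡ true → a (stairAt c) t ≢ nothing
  opener-stair {c} {t} {u} m eq = H-persists (growthOf c) t (filling-mark m)
    (∸-monoʳ-< (s≤s (ordered S m)) (bounded S m))
    (trans (sym (stair-a (growthOf c) N t (N ∸ suc t) (t+[N∸1+t] (<-trans (ordered S m) (bounded S m))))) eq)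

  closer-stair : ∀ {c s t} → marks S c s t ≡ true → b (stairAt c) t ≢ nothing
  closer-stair {c} {s} {t} m eq = H-persists (transpose (growthOf c)) (N ∸ suc t) (filling-mark m)
    (ordered S m) (trans (sym (stair-b (growthOf c) N t (N ∸ suc t) (t+[N∸1+t] (bounded S m)))) eq)

  toStair : ColStair N r
  toStair .stairOf = stairAt
  toStair .exclᵃ t p q = proj₂ (row S (proj₂ (stair-opener {t = t} p)) (proj₂ (stair-opener {t = t} q)))
  toStair .exclᵇ t p q = proj₂ (column S (proj₂ (stair-closer {t = t} p)) (proj₂ (stair-closer {t = t} q)))

module _ {N r} (Z : ColStair N r) where

  private
    module B c = Backward (a (stairOf Z c)) (b (stairOf Z c))

  -- Opener `s` and closer `s + 1 + g` form cell `g` of `s`. The guard is there because truncated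
  -- subtraction would give `g = 0` for every `t` up to `s` as well.
  stairMarks : Fin r → ℕ → ℕ → Bool
  stairMarks c s t = (s <ᵇ t) ∧ B.M c (t ∸ suc s) s

  stairMarks⇒ : ∀ c s t → stairMarks c s t ≡ true → s < t × B.M c (t ∸ suc s) s ≡ true
  stairMarks⇒ c s t m with s <ᵇ t in eq
  ... | true = <ᵇ-true⇒< eq , m

  ⇒stairMarks : ∀ {c s t} → s < t → stairMarks c s t ≡ B.M c (t ∸ suc s) s
  ⇒stairMarks {c} {s} {t} s<t with s <ᵇ t in eq
  ... | true  = refl
  ... | false = contradiction (trans (sym eq) (<⇒<ᵇ-true s<t)) λ ()

  marks-opener : ∀ {c s t} → stairMarks c s t ≡ true → a (stairOf Z c) s ≢ nothing
  marks-opener {c} {s} {t} m = B.M-opener c {t ∸ suc s} {s} (proj₂ (stairMarks⇒ c s t m))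

  marks-closer : ∀ {c s t} → stairMarks c s t ≡ true → b (stairOf Z c) t ≢ nothing
  marks-closer {c} {s} {t} m = subst (λ u → b (stairOf Z c) u ≢ nothing) (m+[n∸m]≡n (proj₁ (stairMarks⇒ c s t m)))
    (B.M-closer c {t ∸ suc s} {s} (proj₂ (stairMarks⇒ c s t m)))

  fromStair : ArcSystem N r
  fromStair .marks = stairMarks
  fromStair .ordered {c} {s} {t} m = proj₁ (stairMarks⇒ c s t m)
  fromStair .bounded {c} {s} {t} m = subst (_< N) (m+[n∸m]≡n (proj₁ (stairMarks⇒ c s t m)))
    (M-bound (stairOf Z c) {t ∸ suc s} {s} (proj₂ (stairMarks⇒ c s t m)))
  fromStair .row {c} {c′} {s} {t} {t′} m m′ with exclᵃ Z s {c} {c′} (marks-opener {c} {s} {t} m) (marks-opener {c′} {s} {t′} m′)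
  ... | refl = t≡t′ , refl
    where
    p = stairMarks⇒ c s t m
    p′ = stairMarks⇒ c s t′ m′
    t≡t′ : t ≡ t′
    t≡t′ with <-cmp (t ∸ suc s) (t′ ∸ suc s)
    ... | tri< lt _ _ = contradiction lt (B.M-row c {t ∸ suc s} {t′ ∸ suc s} (proj₂ p) (proj₂ p′))
    ... | tri≈ _ eq _ = ∸-cancelʳ-≡ (proj₁ p) (proj₁ p′) eq
    ... | tri> _ _ gt = contradiction gt (B.M-row c {t′ ∸ suc s} {t ∸ suc s} (proj₂ p′) (proj₂ p))
  fromStair .column {c} {c′} {s} {s′} {t} m m′ with exclᵇ Z t {c} {c′} (marks-closer {c} {s} {t} m) (marks-closer {c′} {s′} {t} m′)
  ... | refl = s≡s′ , refl
    where
    p = stairMarks⇒ c s t m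
    p′ = stairMarks⇒ c s′ t m′
    sum≡ : s + (t ∸ suc s) ≡ s′ + (t ∸ suc s′)
    sum≡ = suc-injective (trans (m+[n∸m]≡n (proj₁ p)) (sym (m+[n∸m]≡n (proj₁ p′))))
    s≡s′ : s ≡ s′
    s≡s′ with <-cmp s s′
    ... | tri< lt _ _ = contradiction lt (B.M-column c {t ∸ suc s′} {t ∸ suc s} {s′} {s} (proj₂ p′) (proj₂ p) (sym sum≡))
    ... | tri≈ _ eq _ = eq
    ... | tri> _ _ gt = contradiction gt (B.M-column c {t ∸ suc s} {t ∸ suc s′} {s} {s′} (proj₂ p) (proj₂ p′) sum≡)

record _≈S_ {N r} (Z Z′ : ColStair N r) : Set where
  field
    E≡ : ∀ c t k → E (stairOf Z c) t k ≡ E (stairOf Z′ c) t k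
    O≡ : ∀ c t k → O (stairOf Z c) t k ≡ O (stairOf Z′ c) t k

  a≡ : ∀ c t → a (stairOf Z c) t ≡ a (stairOf Z′ c) t
  a≡ c = a-determined (stairOf Z c) (stairOf Z′ c) (E≡ c) (O≡ c)

  b≡ : ∀ c t → b (stairOf Z c) t ≡ b (stairOf Z′ c) t
  b≡ c = b-determined (stairOf Z c) (stairOf Z′ c) (E≡ c) (O≡ c)

open _≈S_

module _ {N r} (Z : ColStair N r) (S : ArcSystem N r) where

  private
    module B c = Backward (a (stairOf Z c)) (b (stairOf Z c))

  -- A staircase read back from a tableau agrees with `toStair S` only in its heights, hence the
  -- hypothesis up to `_≈S_`. In this form the two round trips also yield the congruences
  -- `toStair-cong` and `fromStair-cong`.
  fromStair-toStair : Z ≈S toStair S → ∀ c s t → marks (fromStair Z) c s t ≡ marks S c s t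
  fromStair-toStair eq c s t = ≡-from-true
    (λ m → trans (sym (agree (ordered (fromStair Z) m) (bounded (fromStair Z) m))) m)
    (λ m → trans (agree (ordered S m) (bounded S m)) m)
    where
    G = growthOf S c
    base : ∀ s d → suc (s + d) ≡ N → Agree (stairOf Z c) G 0 s d
    base s d e = trans (sym (stair-a G N s d e)) (sym (a≡ eq c s)) ,
                 trans (sym (stair-b G N s d e)) (sym (b≡ eq c s))
    agree : s < t → t < N → marks (fromStair Z) c s t ≡ marks S c s t
    agree s<t t<N = begin
      stairMarks Z c s t          ≡⟨ ⇒stairMarks Z s<t ⟩
      B.M c (t ∸ suc s) s         ≡⟨ marks-backward (stairOf Z c) G base (t ∸ suc s) s (N ∸ suc t) total ⟨
      filling S c s (N ∸ suc t)   ≡⟨ cong (marks S c s) (reflect t<N) ⟩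
      marks S c s t               ∎
      where
      open ≡-Reasoning
      total : suc (suc (t ∸ suc s)) + (s + (N ∸ suc t)) ≡ N
      total = begin
        suc (suc (t ∸ suc s) + (s + (N ∸ suc t))) ≡⟨ cong suc (+-assoc (suc (t ∸ suc s)) s _) ⟨
        suc (suc (t ∸ suc s) + s + (N ∸ suc t))   ≡⟨ cong (λ u → suc (u + (N ∸ suc t))) (+-suc (t ∸ suc s) s) ⟨
        suc (t ∸ suc s + suc s + (N ∸ suc t))     ≡⟨ cong (λ u → suc (u + (N ∸ suc t))) (m∸n+n≡m s<t) ⟩
        suc (t + (N ∸ suc t))                     ≡⟨ t+[N∸1+t] t<N ⟩
        N                                         ∎

  toStair-fromStair : (∀ c s t → marks S c s t ≡ marks (fromStair Z) c s t) → toStair S ≈S Z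
  toStair-fromStair eq = record
    { E≡ = λ c → E-determined (stairAt S c) (stairOf Z c) (a-eq c) (b-eq c)
    ; O≡ = λ c → O-determined (stairAt S c) (stairOf Z c) (a-eq c) (b-eq c) }
    where
    module _ (c : Fin r) where
      G = growthOf S c
      agree : ∀ g s d → suc (suc g) + (s + d) ≡ N → filling S c s d ≡ B.M c g s
      agree g s d e = begin
        marks S c s (N ∸ suc d)                 ≡⟨ cong (marks S c s) t≡ ⟩
        marks S c s (suc s + g)                 ≡⟨ eq c s (suc s + g) ⟩
        stairMarks Z c s (suc s + g)            ≡⟨ ⇒stairMarks Z (m≤m+n (suc s) g) ⟩
        B.M c (suc s + g ∸ suc s) s             ≡⟨ cong (λ u → B.M c u s) (m+n∸m≡n (suc s) g) ⟩
        B.M c g s                               ∎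
        where
        open ≡-Reasoning
        t≡ : N ∸ suc d ≡ suc s + g
        t≡ = trans (cong (_∸ suc d) (trans (sym e) (begin
          suc (suc (g + (s + d)))   ≡⟨ cong (suc ∘ suc) (+-assoc g s d) ⟨
          suc (suc (g + s + d))     ≡⟨ cong (λ u → suc (suc (u + d))) (+-comm g s) ⟩
          suc (suc (s + g + d))     ≡⟨ cong suc (+-suc (s + g) d) ⟨
          suc (s + g + suc d)       ∎))) (m+n∸n≡m (suc s + g) (suc d))
      a-eq : ∀ t → a (stairAt S c) t ≡ a (stairOf Z c) t
      a-eq t with t <? N
      ... | yes t<N = trans (stair-a G N t (N ∸ suc t) (t+[N∸1+t] t<N))
                            (agreeᴴ (stairOf Z c) G agree 0 t (N ∸ suc t) (t+[N∸1+t] t<N))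
      ... | no  t≮N = trans (cong (aAt G t) (m≤n⇒m∸n≡0 (≮⇒≥ t≮N)))
        (sym (A-out (stairOf Z c) 0 t (≤-trans (≮⇒≥ t≮N) (≤-trans (n≤1+n t) (m≤m+n (suc t) 0)))))
      b-eq : ∀ t → b (stairAt S c) t ≡ b (stairOf Z c) t
      b-eq t with t <? N
      ... | yes t<N = trans (stair-b G N t (N ∸ suc t) (t+[N∸1+t] t<N))
                            (agreeⱽ (stairOf Z c) G agree 0 t (N ∸ suc t) (t+[N∸1+t] t<N))
      ... | no  t≮N = trans (cong (bAt G t) (m≤n⇒m∸n≡0 (≮⇒≥ t≮N)))
        (sym (B-end (stairOf Z c) 0 t (≤-trans (≮⇒≥ t≮N) (m≤m+n t 0))))

≈S-refl : ∀ {N r} {Z : ColStair N r} → Z ≈S Z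
≈S-refl = record { E≡ = λ _ _ _ → refl ; O≡ = λ _ _ _ → refl }

≈S-sym : ∀ {N r} {Z Z′ : ColStair N r} → Z ≈S Z′ → Z′ ≈S Z
≈S-sym eq = record { E≡ = λ c t k → sym (E≡ eq c t k) ; O≡ = λ c t k → sym (O≡ eq c t k) }

≈S-trans : ∀ {N r} {Z Z′ Z″ : ColStair N r} → Z ≈S Z′ → Z′ ≈S Z″ → Z ≈S Z″
≈S-trans p q = record { E≡ = λ c t k → trans (E≡ p c t k) (E≡ q c t k)
                      ; O≡ = λ c t k → trans (O≡ p c t k) (O≡ q c t k) }

toStair-cong : ∀ {N r} (S S′ : ArcSystem N r) → (∀ c s t → marks S c s t ≡ marks S′ c s t) →
               toStair S ≈S toStair S′
toStair-cong S S′ eq = toStair-fromStair (toStair S′) S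
  (λ c s t → trans (eq c s t) (sym (fromStair-toStair (toStair S′) S′ ≈S-refl c s t)))

fromStair-cong : ∀ {N r} (Z Z′ : ColStair N r) → Z ≈S Z′ →
                 ∀ c s t → marks (fromStair Z) c s t ≡ marks (fromStair Z′) c s t
fromStair-cong Z Z′ eq = fromStair-toStair Z (fromStair Z′)
  (≈S-trans eq (≈S-sym (toStair-fromStair Z′ (fromStair Z′) (λ _ _ _ → refl))))

-- Crossings and nestings as chains

module _ {R : Point → Point → Set} {Q : Point → Set} where

  chain⇒family : (∀ {p q s} → R p q → R q s → R p s) → ∀ {B k} → (∀ {p q} → B p → R p q → B q) →
    Chain R Q B k → Σ (Fin k → Point) λ f →
      (∀ x → B (f x)) × (∀ x y → x F.< y → R (f x) (f y)) × (∀ x → Q (f x))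
  chain⇒family tr cl [] = (λ ()) , (λ ()) , (λ ()) , (λ ())
  chain⇒family tr {B} cl (cons {k} p bp qp ch) with chain⇒family tr tr ch
  ... | f , bf , mono , qf = f′ , b′ , mono′ , q′
    where
    f′ : Fin (suc k) → Point
    f′ F.zero    = p
    f′ (F.suc x) = f x
    b′ : ∀ x → B (f′ x)
    b′ F.zero    = bp
    b′ (F.suc x) = cl bp (bf x)
    mono′ : ∀ x y → x F.< y → R (f′ x) (f′ y)
    mono′ F.zero    (F.suc y) _        = bf y
    mono′ (F.suc x) (F.suc y) (s≤s lt) = mono x y lt
    q′ : ∀ x → Q (f′ x)
    q′ F.zero    = qp
    q′ (F.suc x) = qf x

  family⇒chain : ∀ {B} k (f : Fin k → Point) → (∀ x → B (f x)) →
    (∀ x y → x F.< y → R (f x) (f y)) → (∀ x → Q (f x)) → Chain R Q B k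
  family⇒chain zero    f bf mono qf = []
  family⇒chain (suc k) f bf mono qf = cons (f F.zero) (bf F.zero) (qf F.zero)
    (family⇒chain k (f ∘ F.suc) (λ x → mono F.zero (F.suc x) (s≤s z≤n))
      (λ x y lt → mono (F.suc x) (F.suc y) (s≤s lt)) (qf ∘ F.suc))

module _ {N r} (Λ : ColPartition N r) where

  private
    G : ∀ c → Growth (filling (arcs Λ) c)
    G = growthOf (arcs Λ)

    closer-< : ∀ {e e′} → e < N → e′ < e → N ∸ suc e < N ∸ suc e′
    closer-< e<N e′<e = ∸-monoʳ-< (s≤s e′<e) e<N

    point : Fin N → Fin N → Point
    point i j = toℕ i , N ∸ suc (toℕ j)

    -- The marks below the vertex `(t , N ∸ t)` are the arcs that begin before `t` and end at `t` or
    -- later.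
    point-In : ∀ {c t i j} → toℕ i < t → t ≤ toℕ j → Arc (part Λ) i j → col Λ i j ≡ c →
               In (filling (arcs Λ) c) t (N ∸ t) (point i j)
    point-In {i = i} {j} i<t t≤j arc eq = i<t , ∸-monoʳ-< (s≤s t≤j) (toℕ<n j) ,
      filling-mark (arcs Λ) (IsArc⇒marks Λ (i , j , refl , refl , arc , eq))

    module _ {c : Fin r} {s d : ℕ} (s+d≤N : s + d ≤ N) where

      left right : ∀ {p} → In (filling (arcs Λ) c) s d p → Fin N
      left  (_ , _ , m) = proj₁ (marks⇒IsArc Λ m)
      right (_ , _ , m) = proj₁ (proj₂ (marks⇒IsArc Λ m))

      left≡ : ∀ {p} (q : In (filling (arcs Λ) c) s d p) → toℕ (left q) ≡ proj₁ p
      left≡ (_ , _ , m) = proj₁ (proj₂ (proj₂ (marks⇒IsArc Λ m)))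

      right≡ : ∀ {p} (q : In (filling (arcs Λ) c) s d p) → toℕ (right q) ≡ N ∸ suc (proj₂ p)
      right≡ (_ , _ , m) = proj₁ (proj₂ (proj₂ (proj₂ (marks⇒IsArc Λ m))))

      is-arc : ∀ {p} (q : In (filling (arcs Λ) c) s d p) →
               Arc (part Λ) (left q) (right q) × col Λ (left q) (right q) ≡ c
      is-arc (_ , _ , m) = proj₂ (proj₂ (proj₂ (proj₂ (marks⇒IsArc Λ m))))

      -- Below a vertex with `s + d ≤ N` every opener is less than `s`, and every closer is at least
      -- `N ∸ d`, hence at least `s`. This turns a chain of marks into arcs that all overlap, as a
      -- crossing or a nesting requires.
      left<right : ∀ {p p′} (q : In (filling (arcs Λ) c) s d p) (q′ : In (filling (arcs Λ) c) s d p′) →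
                   left q F.< right q′
      left<right q@(i<s , _) q′@(_ , e<d , _) = subst₂ _<_ (sym (left≡ q)) (sym (right≡ q′))
        (<-≤-trans i<s (≤-trans (m+n≤o⇒m≤o∸n s s+d≤N) (∸-monoʳ-≤ N e<d)))

      left-mono : ∀ {p p′} (q : In (filling (arcs Λ) c) s d p) (q′ : In (filling (arcs Λ) c) s d p′) →
                  proj₁ p < proj₁ p′ → left q F.< left q′
      left-mono q q′ lt = subst₂ _<_ (sym (left≡ q)) (sym (left≡ q′)) lt

      right-anti : ∀ {p p′} (q : In (filling (arcs Λ) c) s d p) (q′ : In (filling (arcs Λ) c) s d p′) →
                   proj₂ p′ < proj₂ p → right q F.< right q′
      right-anti q@(_ , e<d , _) q′ lt = subst₂ _<_ (sym (right≡ q)) (sym (right≡ q′))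
        (closer-< (<-≤-trans e<d (≤-trans (m≤n+m d s) s+d≤N)) lt)

  crossing⇒γ : ∀ {k} → Crossing Λ (suc k) → ∃ λ c → ∃ λ t → 0 < γ (G c) t (N ∸ t) k
  crossing⇒γ {k} (is , js , c , is< , js< , is<js , arc) = c , t , ⟍-length (G c) k
    (family⇒chain (suc k) (λ x → point (is x) (js x)) (λ _ → tt)
      (λ x y lt → is< x y lt , closer-< (toℕ<n (js y)) (js< x y lt))
      (λ x → point-In (is<js x F.zero) (js₀≤ x) (proj₁ (arc x)) (proj₂ (arc x))))
    where
    -- The first closer: all arcs of the crossing begin before it and end no earlier.
    t = toℕ (js F.zero)
    js₀≤ : ∀ x → t ≤ toℕ (js x)
    js₀≤ F.zero    = ≤-refl
    js₀≤ (F.suc x) = <⇒≤ (js< F.zero (F.suc x) (s≤s z≤n))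

  nesting⇒γ : ∀ {k} → Nesting Λ (suc k) → ∃ λ c → ∃ λ t → k < γ (G c) t (N ∸ t) 0
  nesting⇒γ {k} (is , js , c , is< , js< , is<js , arc) = c , t , ⟋-length (G c)
    (family⇒chain (suc k) (λ x → point (is x) (js x)) (λ _ → tt)
      (λ x y lt → is< x y lt , closer-< (toℕ<n (js x)) (js< x y lt))
      (λ x → point-In (is<js x (fromℕ k)) (jsₖ≤ x) (proj₁ (arc x)) (proj₂ (arc x))))
    where
    -- In a nesting the first closer belongs to the last, innermost arc.
    t = toℕ (js (fromℕ k))
    jsₖ≤ : ∀ x → t ≤ toℕ (js x)
    jsₖ≤ x with m≤n⇒m<n∨m≡n (F.≤fromℕ x)
    ... | inj₁ lt = <⇒≤ (js< x (fromℕ k) lt)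
    ... | inj₂ eq = ≤-reflexive (cong (toℕ ∘ js) (sym (toℕ-injective eq)))

  γ⇒crossing : ∀ {c s d k} → s + d ≤ N → 0 < γ (G c) s d k → Crossing Λ (suc k)
  γ⇒crossing {c} {s} {d} {k} le lt
    with chain⇒family (λ (p , q) (p′ , q′) → <-trans p p′ , <-trans q′ q) (λ _ _ → tt) (⟍-chain (G c) {s} {d} k lt)
  ... | f , _ , mono , q = (λ x → left le (q x)) , (λ x → right le (q x)) , c ,
    (λ x y x<y → left-mono le (q x) (q y) (proj₁ (mono x y x<y))) ,
    (λ x y x<y → right-anti le (q x) (q y) (proj₂ (mono x y x<y))) ,
    (λ x y → left<right le (q x) (q y)) , (λ x → is-arc le (q x))

  γ⇒nesting : ∀ {c s d k} → s + d ≤ N → k ≤ γ (G c) s d 0 → Nesting Λ k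
  γ⇒nesting {c} {s} {d} {k} le lt
    with chain⇒family (λ (p , q) (p′ , q′) → <-trans p p′ , <-trans q q′) (λ _ _ → tt) (⟋-chain (G c) s d k lt)
  ... | f , _ , mono , q = (λ x → left le (q x)) , (λ x → right le (q x)) , c ,
    (λ x y x<y → left-mono le (q x) (q y) (proj₁ (mono x y x<y))) ,
    (λ x y x<y → right-anti le (q y) (q x) (proj₂ (mono x y x<y))) ,
    (λ x y → left<right le (q x) (q y)) , (λ x → is-arc le (q x))

-- Multipartitions in terms of column heights

Edge-cong : ∀ {f f′ g g′ l} → (∀ k → f k ≡ f′ k) → (∀ k → g k ≡ g′ k) → Edge f l g → Edge f′ l g′
Edge-cong {l = l} p q e .at k = trans (sym (q k)) (trans (at e k) (cong (_+ δ l k) (p k)))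

Edge-refl : ∀ {f g} → (∀ k → f k ≡ g k) → Edge f nothing g
Edge-refl eq .at k = trans (sym (eq k)) (sym (+-identityʳ _))

Edge-≡ : ∀ {f l g} → Edge f l g → l ≡ nothing → ∀ k → g k ≡ f k
Edge-≡ e refl k = Edge-at e refl

Up : ∀ {r} → (A B : Fin r → Shape) → Set
Up {r} A B = Σ (Fin r → Label) λ l → (∀ c → Edge (A c) (l c) (B c)) × Exclusive l

hts : ∀ {r} → MultiPart r → Fin r → Shape
hts L c = ht (L c)

labelAt : ∀ {r} → Fin r → ℕ → Fin r → Label
labelAt c k c′ with c′ F.≟ c
... | yes _ = just k
... | no  _ = nothing

labelAt-diag : ∀ {r} (c : Fin r) k → labelAt c k c ≡ just k
labelAt-diag c k with c F.≟ c
... | yes _ = refl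
... | no ne = contradiction refl ne

labelAt-only : ∀ {r} {c : Fin r} {k c′} → labelAt c k c′ ≢ nothing → c′ ≡ c
labelAt-only {c = c} {c′ = c′} ne with c′ F.≟ c
... | yes eq = eq
... | no  _  = contradiction refl ne

AddM⇒Up : ∀ {r} {L M : MultiPart r} → AddM L M → Σ (Up (hts L) (hts M)) λ u → ∃ λ c → proj₁ u c ≢ nothing
AddM⇒Up {r} {L} {M} (c , add , rest) =
  (labelAt c k , edges , λ p q → trans (labelAt-only p) (sym (labelAt-only q))) ,
  c , just⇒≢nothing (labelAt-diag c k)
  where
  k = proj₁ (AddY⇒Edge {L c} {M c} add)
  edges : ∀ c′ → Edge (ht (L c′)) (labelAt c k c′) (ht (M c′))
  edges c′ with c′ F.≟ c
  ... | yes refl = proj₂ (AddY⇒Edge {L c} {M c} add)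
  ... | no  ne   = Edge-refl (ht-cong {L c′} {M c′} (rest c′ ne))

≈M⇒Up : ∀ {r} {L M : MultiPart r} → L ≈M M → Up (hts L) (hts M)
≈M⇒Up {L = L} {M} eq = (λ _ → nothing) , (λ c → Edge-refl (ht-cong {L c} {M c} (eq c))) , λ ne → contradiction refl ne

≢nothing? : (l : Label) → Dec (l ≢ nothing)
≢nothing? (just _) = yes λ ()
≢nothing? nothing  = no λ ne → ne refl

≢nothing-stable : ∀ {l : Label} → ¬ (l ≢ nothing) → l ≡ nothing
≢nothing-stable {just _}  f = contradiction (λ ()) f
≢nothing-stable {nothing} f = refl

Up⇒AddM : ∀ {r} {L M : MultiPart r} → Up (hts L) (hts M) → AddM L M ⊎ L ≈M M
Up⇒AddM {L = L} {M} (l , edges , excl) with any? (λ c → ≢nothing? (l c))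
... | no none = inj₂ λ c → ht-injective (L c) (M c) λ k →
        sym (Edge-≡ (edges c) (≢nothing-stable (λ ne → none (c , ne))) k)
... | yes (c , ne) = inj₁ (c ,
        Edge⇒AddY {L c} {M c} (subst (λ u → Edge (ht (L c)) u (ht (M c))) (proj₂ (≢nothing⇒just ne)) (edges c)) ,
        λ c′ c′≢c → ht-injective (L c′) (M c′) λ k →
          sym (Edge-≡ (edges c′) (≢nothing-stable (λ ne′ → c′≢c (excl ne′ ne))) k))

Up⇒⊆M : ∀ {r} {L M : MultiPart r} → Up (hts L) (hts M) → L ⊆M M
Up⇒⊆M {L = L} {M} (_ , edges , _) c = ≤⇒⊆Y {L c} {M c} (Edge-≤ (edges c))

Step∧⊆⇒Up : ∀ {r} {L M : MultiPart r} → StepM L M → L ⊆M M → Up (hts L) (hts M)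
Step∧⊆⇒Up {L = L} {M} (inj₁ add) sub = proj₁ (AddM⇒Up {L = L} {M} add)
Step∧⊆⇒Up {L = L} {M} (inj₂ (inj₂ eq)) sub = ≈M⇒Up {L = L} {M} eq
Step∧⊆⇒Up {L = L} {M} (inj₂ (inj₁ (c , add , _))) sub with AddY⇒Edge {M c} {L c} add
... | k , e = contradiction (⊆Y⇒≤ {L c} {M c} (sub c) k)
  (<⇒≱ (≤-reflexive (sym (trans (at e k) (trans (cong (ht (M c) k +_) (δ-diag k)) (+-comm _ 1))))))

-- Semi-oscillating tableaux as walks of column heights

-- `K` bounds the number of columns, which `fromHeights` needs to turn heights into partitions.
record Walk (r m K : ℕ) : Set where
  field
    at-time : ℕ → Fin r → Shape
    w-Decr  : ∀ i c → Decr (at-time i c)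
    w-bound : ∀ i c k → K ≤ k → at-time i c k ≡ 0
    w-start : ∀ c k → at-time 0 c k ≡ 0
    w-end   : ∀ i → m ≤ i → ∀ c k → at-time i c k ≡ 0
    w-step  : ∀ i → Up (at-time i) (at-time (suc i)) ⊎ Up (at-time (suc i)) (at-time i)
open Walk

module _ {r m K} (w : Walk r m K) where

  private
    tab : ℕ → MultiPart r
    tab i c = fromHeights K (at-time w i c)

  ht-tab : ∀ i c k → ht (tab i c) k ≡ at-time w i c k
  ht-tab i c = ht-fromHeights K (w-Decr w i c) (w-bound w i c)

  tab-Up : ∀ {i j} → Up (at-time w i) (at-time w j) → Up (hts (tab i)) (hts (tab j))
  tab-Up {i} {j} (l , edges , excl) =
    l , (λ c → Edge-cong (λ k → sym (ht-tab i c k)) (λ k → sym (ht-tab j c k)) (edges c)) , excl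

  tab-step : ∀ i → StepM (tab i) (tab (suc i))
  tab-step i with w-step w i
  ... | inj₁ up with Up⇒AddM {L = tab i} {tab (suc i)} (tab-Up {i} {suc i} up)
  ...   | inj₁ add = inj₁ add
  ...   | inj₂ eq  = inj₂ (inj₂ eq)
  tab-step i | inj₂ down with Up⇒AddM {L = tab (suc i)} {tab i} (tab-Up {suc i} {i} down)
  ...   | inj₁ add = inj₂ (inj₁ add)
  ...   | inj₂ eq  = inj₂ (inj₂ (λ c → sym (eq c)))

  tab-empty : ∀ {i} → (∀ c k → at-time w i c k ≡ 0) → IsEmptyM (tab i)
  tab-empty {i} z c rewrite z c 0 = refl

  tableau : SemiOsc r m
  tableau .seq i   = tab (toℕ i)
  tableau .start   = tab-empty {0} (w-start w)
  tableau .end     = tab-empty {toℕ (fromℕ m)} (w-end w (toℕ (fromℕ m)) (≤-reflexive (sym (toℕ-fromℕ m))))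
  tableau .step i  = subst (λ j → StepM (tab j) (tab (suc (toℕ i)))) (sym (toℕ-inject₁ i)) (tab-step (toℕ i))

  ht-tableau : ∀ i c k → ht (seq tableau i c) k ≡ at-time w (toℕ i) c k
  ht-tableau i = ht-tab (toℕ i)

∅ : IntPartition
∅ = record { parts = [] ; decr = [] ; pos = [] }

module _ {r m} (T : SemiOsc r m) where

  -- Padding with empty diagrams after time `m` matches the staircase, whose shapes are indexed by
  -- all natural numbers and vanish from its end on.
  extend : ℕ → MultiPart r
  extend i with i <? suc m
  ... | yes p = seq T (fromℕ< p)
  ... | no  _ = λ _ → ∅

  extend-toℕ : ∀ i → extend (toℕ i) ≡ seq T i
  extend-toℕ i with toℕ i <? suc m
  ... | yes p = cong (seq T) (fromℕ<-toℕ i p)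
  ... | no np = contradiction (toℕ<n i) np

  extend-end : ∀ {i} → m ≤ i → IsEmptyM (extend i)
  extend-end {i} m≤i with i <? suc m
  ... | no  _ = λ _ → refl
  ... | yes p = subst (IsEmptyM ∘ seq T)
    (toℕ-injective (trans (toℕ-fromℕ m) (trans (≤-antisym m≤i (s≤s⁻¹ p)) (sym (toℕ-fromℕ< p))))) (end T)

  extend-step′ : ∀ i → (∃ λ (j : Fin m) → toℕ j ≡ i × seq T (inject₁ j) ≡ extend i × seq T (F.suc j) ≡ extend (suc i))
                     ⊎ (m ≤ i × extend i ≈M extend (suc i))
  extend-step′ i with i <? m
  ... | yes i<m = inj₁ (j , j≡ ,
          trans (sym (extend-toℕ (inject₁ j))) (cong extend (trans (toℕ-inject₁ j) j≡)) ,
          trans (sym (extend-toℕ (F.suc j))) (cong (extend ∘ suc) j≡))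
    where
    j = fromℕ< i<m
    j≡ = toℕ-fromℕ< i<m
  ... | no i≮m = inj₂ (≮⇒≥ i≮m , λ c → trans (extend-end (≮⇒≥ i≮m) c)
                   (sym (extend-end (≤-trans (≮⇒≥ i≮m) (n≤1+n i)) c)))

  extend-step : ∀ i → StepM (extend i) (extend (suc i))
  extend-step i with extend-step′ i
  ... | inj₁ (j , _ , p , q) = subst₂ StepM p q (step T j)
  ... | inj₂ (_ , eq) = inj₂ (inj₂ eq)

  heights : ℕ → Fin r → Shape
  heights i = hts (extend i)

  heights-seq : ∀ i c k → heights (toℕ i) c k ≡ ht (seq T i c) k
  heights-seq i c k = cong (λ L → ht (L c) k) (extend-toℕ i)

  heights-start : ∀ c k → heights 0 c k ≡ 0
  heights-start c k = trans (heights-seq F.zero c k) (ht-cong {seq T F.zero c} {∅} (start T c) k)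

  heights-end : ∀ i → m ≤ i → ∀ c k → heights i c k ≡ 0
  heights-end i le c k = ht-cong {extend i c} {∅} (extend-end le c) k

  heights-Decr : ∀ i c → Decr (heights i c)
  heights-Decr i c = Conj-Decr (ht-Conj (extend i c))

_≈W_ : ∀ {r} → (A B : ℕ → Fin r → Shape) → Set
A ≈W B = ∀ i c k → A i c k ≡ B i c k

heights-cong : ∀ {r m} {T T′ : SemiOsc r m} → T ≈T T′ → heights T ≈W heights T′
heights-cong {m = m} {T} {T′} eq i c k = ht-cong {extend T i c} {extend T′ i c} parts≡ k
  where
  parts≡ : parts (extend T i c) ≡ parts (extend T′ i c)
  parts≡ with i <? suc m
  ... | yes p = eq (fromℕ< p) c
  ... | no  _ = refl

heights-injective : ∀ {r m} {T T′ : SemiOsc r m} → heights T ≈W heights T′ → T ≈T T′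
heights-injective {T = T} {T′} eq i c = ht-injective (seq T i c) (seq T′ i c) λ k →
  trans (sym (heights-seq T i c k)) (trans (eq (toℕ i) c k) (heights-seq T′ i c k))

heights-tableau : ∀ {r m K} (w : Walk r m K) → heights (tableau w) ≈W at-time w
heights-tableau {m = m} w i c k with i <? m
... | no i≮m = trans (heights-end (tableau w) i (≮⇒≥ i≮m) c k) (sym (w-end w i (≮⇒≥ i≮m) c k))
... | yes i<m = begin
  heights (tableau w) i c k        ≡⟨ cong (λ j → heights (tableau w) j c k) i≡ ⟨
  heights (tableau w) (toℕ j) c k  ≡⟨ heights-seq (tableau w) j c k ⟩
  ht (seq (tableau w) j c) k       ≡⟨ ht-tableau w j c k ⟩
  at-time w (toℕ j) c k            ≡⟨ cong (λ j → at-time w j c k) i≡ ⟩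
  at-time w i c k                  ∎
  where
  open ≡-Reasoning
  j = fromℕ< (m<n⇒m<1+n i<m)
  i≡ = toℕ-fromℕ< (m<n⇒m<1+n i<m)

-- Crossing and nesting numbers against the size of the diagrams

Vertex : ∀ {N r} (S : ArcSystem N r) → (Fin r → Shape) → Set
Vertex {N} S A = ∃ λ s → ∃ λ d → s + d ≤ N × (∀ c k → A c k ≡ γ (growthOf S c) s d k)

-- A large diagram yields a large crossing or nesting because each diagram sits at some vertex with
-- `s + d ≤ N`. Conversely each crossing or nesting lies below a vertex `(t , N ∸ t)`, so it
-- suffices that the tableau visits all of these.
cr-ne : ∀ {N r m} (Λ : ColPartition N r) (T : SemiOsc r m) →
        (∀ i → Vertex (arcs Λ) (hts (seq T i))) →
        (∀ t → t ≤ N → ∃ λ i → ∀ c k → ht (seq T i c) k ≡ γ (growthOf (arcs Λ) c) t (N ∸ t) k) →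
        ∀ j k → 0 < j → 0 < k →
        (CrLess Λ j × NeLess Λ k → Bounded T j k) × (Bounded T j k → CrLess Λ j × NeLess Λ k)
cr-ne {N} Λ T vertex index (suc j) (suc k) _ _ = fore , λ bd → cr bd , ne bd
  where
  fore : CrLess Λ (suc j) × NeLess Λ (suc k) → Bounded T (suc j) (suc k)
  fore (cr , ne) i c with vertex i
  ... | s , d , le , eq =
    ≰⇒> (λ j<cols → <-irrefl refl (cr (suc j) (γ⇒crossing Λ {c} {s} {d} le (subst (0 <_) (eq c j) (<cols⇒ (seq T i c) j<cols))))) ,
    ≰⇒> (λ k<rows → <-irrefl refl (ne (suc k) (γ⇒nesting Λ {c} {s} {d} le
      (subst (suc k ≤_) (trans (rows≡ht (seq T i c)) (eq c 0)) k<rows))))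
  inside : ∀ {c t k} → 0 < γ (growthOf (arcs Λ) c) t (N ∸ t) k → t ≤ N
  inside {c} {t} {k} lt with t ≤? N
  ... | yes le = le
  ... | no  nl = contradiction
    (subst (0 <_) (trans (cong (λ d → γ (growthOf (arcs Λ) c) t d k) (m≤n⇒m∸n≡0 (<⇒≤ (≰⇒> nl)))) (γ-out (growthOf (arcs Λ) c) t k)) lt)
    λ ()
  cr : Bounded T (suc j) (suc k) → CrLess Λ (suc j)
  cr bd zero    x = s≤s z≤n
  cr bd (suc n) x with crossing⇒γ Λ x
  ... | c , t , lt with index t (inside {c} {t} {n} lt)
  ...   | i , eq = ≤-<-trans (⇒<cols (seq T i c) (subst (0 <_) (sym (eq c n)) lt)) (proj₁ (bd i c))
  ne : Bounded T (suc j) (suc k) → NeLess Λ (suc k)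
  ne bd zero    x = s≤s z≤n
  ne bd (suc n) x with nesting⇒γ Λ x
  ... | c , t , lt with index t (inside {c} {t} {0} (≤-trans (s≤s z≤n) lt))
  ...   | i , eq = ≤-<-trans (subst (n <_) (sym (trans (rows≡ht (seq T i c)) (eq c 0))) lt) (proj₂ (bd i c))

module _ {N r} (S : ArcSystem N r) where

  vertex-E : ∀ t → Vertex S (λ c → E (stairAt S c) t)
  vertex-E t with t ≤? N
  ... | yes le = t , N ∸ t , ≤-reflexive (m+[n∸m]≡n le) , λ _ _ → refl
  -- Past the end the shape is empty, and the vertex `(0 , 0)` represents it.
  ... | no  nl = 0 , 0 , z≤n , λ c k → E-end (stairAt S c) t (<⇒≤ (≰⇒> nl)) k

  vertex-O : ∀ t → Vertex S (λ c → O (stairAt S c) t)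
  vertex-O t with t <? N
  ... | yes lt = t , N ∸ suc t , ≤-trans (n≤1+n _) (≤-reflexive (t+[N∸1+t] lt)) ,
    λ c k → cong (λ d → oAt (growthOf S c) t d k) (+-cancelˡ-≡ t _ _
      (trans (m+[n∸m]≡n (<⇒≤ lt)) (sym (trans (+-suc t _) (t+[N∸1+t] lt)))))
  ... | no  nl = 0 , 0 , z≤n , λ c k →
    trans (cong (λ d → oAt (growthOf S c) t d k) (m≤n⇒m∸n≡0 (≮⇒≥ nl))) (γ-out (growthOf S c) t k)

  vertex-bound : ∀ {A} → Vertex S A → ∀ c k → N ≤ k → A c k ≡ 0
  vertex-bound (s , d , le , eq) c k N≤k =
    trans (eq c k) (γ-bound (growthOf S c) s d k (≤-trans (≤-trans (m≤n+m d s) le) N≤k))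

≈CP-trans : ∀ {n r} {Λ Λ′ Λ″ : ColPartition n r} → Λ ≈CP Λ′ → Λ′ ≈CP Λ″ → Λ ≈CP Λ″
≈CP-trans (eq , eqc) (eq′ , eqc′) = (λ i j → trans (eq i j) (eq′ i j)) , λ i j arc@(x , y , z) →
  trans (eqc i j arc) (eqc′ i j (trans (sym (eq i j)) x , y , λ k l m → trans (sym (eq i k)) (z k l m)))

-- Vacillating tableaux

zigzag : ∀ {A : Set} → (ℕ → A) → (ℕ → A) → ℕ → A
zigzag e o zero          = e 0
zigzag e o (suc zero)    = o 0
zigzag e o (suc (suc i)) = zigzag (e ∘ suc) (o ∘ suc) i

double : ℕ → ℕ
double zero    = zero
double (suc t) = suc (suc (double t))

double≡2* : ∀ t → double t ≡ 2 * t
double≡2* zero    = refl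
double≡2* (suc t) = cong suc (trans (cong suc (double≡2* t)) (sym (+-suc t (t + 0))))

double-mono : ∀ {m n} → m ≤ n → double m ≤ double n
double-mono z≤n     = z≤n
double-mono (s≤s p) = s≤s (s≤s (double-mono p))

isEven-double : ∀ t → isEven (double t) ≡ true
isEven-double zero    = refl
isEven-double (suc t) = isEven-double t

isEven-1+double : ∀ t → isEven (suc (double t)) ≡ false
isEven-1+double zero    = refl
isEven-1+double (suc t) = isEven-1+double t

zigzag-double : ∀ {A : Set} (e o : ℕ → A) t → zigzag e o (double t) ≡ e t
zigzag-double e o zero    = refl
zigzag-double e o (suc t) = zigzag-double (e ∘ suc) (o ∘ suc) t

zigzag-1+double : ∀ {A : Set} (e o : ℕ → A) t → zigzag e o (suc (double t)) ≡ o t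
zigzag-1+double e o zero    = refl
zigzag-1+double e o (suc t) = zigzag-1+double (e ∘ suc) (o ∘ suc) t

zigzag-split : ∀ {A : Set} (f : ℕ → A) i → zigzag (f ∘ double) (f ∘ suc ∘ double) i ≡ f i
zigzag-split f zero          = refl
zigzag-split f (suc zero)    = refl
zigzag-split f (suc (suc i)) = zigzag-split (f ∘ suc ∘ suc) i

zigzag-elim : ∀ {A : Set} {e o : ℕ → A} (P : A → Set) → (∀ t → P (e t)) → (∀ t → P (o t)) →
              ∀ i → P (zigzag e o i)
zigzag-elim P p q zero          = p 0
zigzag-elim P p q (suc zero)    = q 0
zigzag-elim P p q (suc (suc i)) = zigzag-elim P (p ∘ suc) (q ∘ suc) i

zigzag-late : ∀ {A : Set} {e o : ℕ → A} (P : A → Set) N → (∀ t → N ≤ t → P (e t)) → (∀ t → N ≤ t → P (o t)) →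
              ∀ i → double N ≤ i → P (zigzag e o i)
zigzag-late P zero    p q i le = zigzag-elim P (λ t → p t z≤n) (λ t → q t z≤n) i
zigzag-late P (suc N) p q (suc (suc i)) (s≤s (s≤s le)) =
  zigzag-late P N (λ t l → p (suc t) (s≤s l)) (λ t l → q (suc t) (s≤s l)) i le

zigzag-rel : ∀ {A : Set} {e o e′ o′ : ℕ → A} (R : A → A → Set) →
             (∀ t → R (e t) (e′ t)) → (∀ t → R (o t) (o′ t)) → ∀ i → R (zigzag e o i) (zigzag e′ o′ i)
zigzag-rel R p q zero          = p 0
zigzag-rel R p q (suc zero)    = q 0
zigzag-rel R p q (suc (suc i)) = zigzag-rel R (p ∘ suc) (q ∘ suc) i

zigzag-step : ∀ {A : Set} {e o : ℕ → A} (R : A → A → Set) → (∀ t → R (o t) (e t)) → (∀ t → R (o t) (e (suc t))) →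
  ∀ i → (isEven (suc i) ≡ true × R (zigzag e o i) (zigzag e o (suc i))) ⊎
        (isEven (suc i) ≡ false × R (zigzag e o (suc i)) (zigzag e o i))
zigzag-step R down up zero          = inj₂ (refl , down 0)
zigzag-step R down up (suc zero)    = inj₁ (refl , up 0)
zigzag-step R down up (suc (suc i)) = zigzag-step R (down ∘ suc) (up ∘ suc) i

O-end : ∀ {N} (Z : Stair N) t → N ≤ t → ∀ k → O Z t k ≡ 0
O-end Z t le = proj₁ (Edge-to-∅ (edgeᵇ Z t) (E-end Z t le))

even odd : ∀ {N r} → ColStair N r → ℕ → Fin r → Shape
even Z t c = E (stairOf Z c) t
odd  Z t c = O (stairOf Z c) t

module _ {N r} (S : ArcSystem N r) where

  zigzag-Up : ∀ i → let z = zigzag (even (toStair S)) (odd (toStair S)) in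
    (isEven (suc i) ≡ true × Up (z i) (z (suc i))) ⊎ (isEven (suc i) ≡ false × Up (z (suc i)) (z i))
  zigzag-Up = zigzag-step Up
    (λ t → (λ c → b (stairAt S c) t) , (λ c → edgeᵇ (stairAt S c) t) , exclᵇ (toStair S) t)
    (λ t → (λ c → a (stairAt S c) t) , (λ c → edgeᵃ (stairAt S c) t) , exclᵃ (toStair S) t)

  vacillating-vertex : ∀ i → Vertex S (zigzag (even (toStair S)) (odd (toStair S)) i)
  vacillating-vertex = zigzag-elim (Vertex S) (vertex-E S) (vertex-O S)

  vacillating-walk : Walk r (2 * N) N
  vacillating-walk .at-time = zigzag (even (toStair S)) (odd (toStair S))
  vacillating-walk .w-Decr  = zigzag-elim (λ (A : Fin r → Shape) → ∀ c → Decr (A c))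
    (λ t c → E-Decr (stairAt S c) t) (λ t c → O-Decr (stairAt S c) t)
  vacillating-walk .w-bound i = vertex-bound S (vacillating-vertex i)
  vacillating-walk .w-start c k = E-start (stairAt S c) k
  vacillating-walk .w-end i le = zigzag-late (λ (A : Fin r → Shape) → ∀ c k → A c k ≡ 0) N
    (λ t l c → E-end (stairAt S c) t l) (λ t l c → O-end (stairAt S c) t l) i
    (≤-trans (≤-reflexive (double≡2* N)) le)
  vacillating-walk .w-step i with zigzag-Up i
  ... | inj₁ (_ , up)   = inj₁ up
  ... | inj₂ (_ , down) = inj₂ down

  toVacillating : Vacillating r (2 * N)
  toVacillating = tableau w , vac
    where
    w = vacillating-walk
    tab : ℕ → MultiPart r
    tab i c = fromHeights N (at-time w i c)
    vac′ : ∀ i → (isEven (suc i) ≡ true → tab i ⊆M tab (suc i)) × (isEven (suc i) ≡ false → tab (suc i) ⊆M tab i)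
    vac′ i with zigzag-Up i
    ... | inj₁ (even , up)  = (λ _ → Up⇒⊆M {L = tab i} {tab (suc i)} (tab-Up w {i} {suc i} up)) ,
                              (λ odd → contradiction (trans (sym even) odd) λ ())
    ... | inj₂ (odd , down) = (λ even → contradiction (trans (sym even) odd) λ ()) ,
                              (λ _ → Up⇒⊆M {L = tab (suc i)} {tab i} (tab-Up w {suc i} {i} down))
    vac : IsVacillating (tableau w)
    vac i = subst (λ j → (isEven (suc (toℕ i)) ≡ true → tab j ⊆M tab (suc (toℕ i))) ×
                         (isEven (suc (toℕ i)) ≡ false → tab (suc (toℕ i)) ⊆M tab j))
                  (sym (toℕ-inject₁ i)) (vac′ (toℕ i))

module _ {r m} (T : SemiOsc r m) (vac : IsVacillating T) where

  abstract
    heights-Up : ∀ i → isEven (suc i) ≡ true → Up (heights T i) (heights T (suc i))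
    heights-Up i eq with extend-step′ T i
    ... | inj₂ (_ , same) = ≈M⇒Up {L = extend T i} {extend T (suc i)} same
    ... | inj₁ (j , refl , p , q) = subst₂ (λ L M → Up (hts L) (hts M)) p q
      (Step∧⊆⇒Up {L = seq T (inject₁ j)} {seq T (F.suc j)} (step T j) (proj₁ (vac j) eq))

    heights-Down : ∀ i → isEven (suc i) ≡ false → Up (heights T (suc i)) (heights T i)
    heights-Down i eq with extend-step′ T i
    ... | inj₂ (_ , same) = ≈M⇒Up {L = extend T (suc i)} {extend T i} (λ c → sym (same c))
    ... | inj₁ (j , refl , p , q) = subst₂ (λ L M → Up (hts M) (hts L)) p q
      (Step∧⊆⇒Up {L = seq T (F.suc j)} {seq T (inject₁ j)} (reverse {seq T (inject₁ j)} {seq T (F.suc j)} (step T j)) (proj₂ (vac j) eq))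
      where
      reverse : ∀ {L M : MultiPart r} → StepM L M → StepM M L
      reverse (inj₁ add)         = inj₂ (inj₁ add)
      reverse (inj₂ (inj₁ add))  = inj₁ add
      reverse (inj₂ (inj₂ same)) = inj₂ (inj₂ λ c → sym (same c))

module _ N {r} (T : SemiOsc r (2 * N)) (vac : IsVacillating T) where

  vacillating-stair : ColStair N r
  vacillating-stair .stairOf c = record
    { E = λ t → heights T (double t) c
    ; O = λ t → heights T (suc (double t)) c
    ; a = λ t → proj₁ (up t) c
    ; b = λ t → proj₁ (down t) c
    ; edgeᵇ = λ t → proj₁ (proj₂ (down t)) c
    ; edgeᵃ = λ t → proj₁ (proj₂ (up t)) c
    ; E-Decr = λ t → heights-Decr T (double t) c
    ; O-Decr = λ t → heights-Decr T (suc (double t)) c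
    ; E-start = heights-start T c
    ; E-end = λ t le → heights-end T (double t)
        (≤-trans (≤-reflexive (sym (double≡2* N))) (double-mono le)) c }
    where
    up   = λ t → heights-Up T vac (suc (double t)) (isEven-double t)
    down = λ t → heights-Down T vac (double t) (isEven-1+double t)
  vacillating-stair .exclᵃ t = proj₂ (proj₂ (heights-Up T vac (suc (double t)) (isEven-double t)))
  vacillating-stair .exclᵇ t = proj₂ (proj₂ (heights-Down T vac (double t) (isEven-1+double t)))

module _ {N r : ℕ} (c₀ : Fin r) where

  private
    infix 4 _≐_
    _≐_ : (A B : Fin r → Shape) → Set
    A ≐ B = ∀ c k → A c k ≡ B c k

    fromV : Vacillating r (2 * N) → ColPartition N r
    fromV (T , vac) = colPartition (fromStair (vacillating-stair N T vac)) c₀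

  vacillating-bijection : Bij {ColPartition N r} {Vacillating r (2 * N)} _≈CP_ (λ T T′ → proj₁ T ≈T proj₁ T′)
  vacillating-bijection .to Λ = toVacillating (arcs Λ)
  vacillating-bijection .from = fromV
  vacillating-bijection .to-cong {Λ} {Λ′} eq = heights-injective {T = tableau w} {tableau w′} λ i c k → begin
    heights (tableau w) i c k   ≡⟨ heights-tableau w i c k ⟩
    at-time w i c k             ≡⟨ zigzag-rel _≐_ (λ t c → E≡ S≈ c t) (λ t c → O≡ S≈ c t) i c k ⟩
    at-time w′ i c k            ≡⟨ heights-tableau w′ i c k ⟨
    heights (tableau w′) i c k  ∎
    where
    open ≡-Reasoning
    w  = vacillating-walk (arcs Λ)
    w′ = vacillating-walk (arcs Λ′)
    S≈ = toStair-cong (arcs Λ) (arcs Λ′) (arcs-cong {Λ = Λ} {Λ′} eq)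
  vacillating-bijection .from-cong {T , vac} {T′ , vac′} eq = colPartition-cong
    {S = fromStair (vacillating-stair N T vac)} {fromStair (vacillating-stair N T′ vac′)}
    (fromStair-cong (vacillating-stair N T vac) (vacillating-stair N T′ vac′) (record
      { E≡ = λ c t → heights-cong {T = T} {T′} eq (double t) c
      ; O≡ = λ c t → heights-cong {T = T} {T′} eq (suc (double t)) c })) c₀
  vacillating-bijection .from-to Λ =
    ≈CP-trans {Λ = fromV (toVacillating (arcs Λ))} {colPartition (arcs Λ) c₀} {Λ}
      (colPartition-cong {S = fromStair Z} {arcs Λ} (fromStair-toStair Z (arcs Λ) (record
        { E≡ = λ c t k → trans (heights-tableau w (double t) c k) (cong (λ A → A c k) (zigzag-double e o t))
        ; O≡ = λ c t k → trans (heights-tableau w (suc (double t)) c k) (cong (λ A → A c k) (zigzag-1+double e o t)) })) c₀)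
      (colPartition-arcs Λ c₀)
    where
    w = vacillating-walk (arcs Λ)
    Z = vacillating-stair N (proj₁ (toVacillating (arcs Λ))) (proj₂ (toVacillating (arcs Λ)))
    e = even (toStair (arcs Λ))
    o = odd (toStair (arcs Λ))
  vacillating-bijection .to-from (T , vac) = heights-injective {T = tableau w} {T} λ i c k → begin
    heights (tableau w) i c k     ≡⟨ heights-tableau w i c k ⟩
    at-time w i c k               ≡⟨ zigzag-rel _≐_ (λ t c → E≡ S≈ c t) (λ t c → O≡ S≈ c t) i c k ⟩
    zigzag (even Z) (odd Z) i c k ≡⟨ cong (λ A → A c k) (zigzag-split (heights T) i) ⟩
    heights T i c k               ∎
    where
    open ≡-Reasoning
    Z  = vacillating-stair N T vac
    Λ  = fromV (T , vac)
    w  = vacillating-walk (arcs Λ)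
    S≈ = toStair-fromStair Z (arcs Λ) (arcs-colPartition (fromStair Z) c₀)

  vacillating-cr-ne : CrNeProp (λ Λ → Λ) proj₁ (to vacillating-bijection)
  vacillating-cr-ne Λ = cr-ne Λ (tableau w)
    (λ i → let s , d , le , eq = vacillating-vertex (arcs Λ) (toℕ i)
           in s , d , le , λ c k → trans (ht-tableau w i c k) (eq c k))
    (λ t le → let lt = s≤s (≤-trans (double-mono le) (≤-reflexive (double≡2* N))) in
      fromℕ< lt , λ c k → trans (ht-tableau w (fromℕ< lt) c k)
        (cong (λ A → A c k) (trans (cong (at-time w) (toℕ-fromℕ< lt))
          (zigzag-double (even (toStair (arcs Λ))) (odd (toStair (arcs Λ))) t))))
    where
    w = vacillating-walk (arcs Λ)

-- Matchings

-- A point that both ends and begins an arc would lie in a block with three elements.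
Separated : ∀ {N r} → ArcSystem N r → Set
Separated S = ∀ {c c′ s t u} → marks S c s t ≡ true → marks S c′ t u ≡ true → ⊥

matching⇒separated : ∀ {n r} (Λ : ColPartition n r) → IsMatching (part Λ) → Separated (arcs Λ)
matching⇒separated Λ match m m′ with marks⇒IsArc Λ m | marks⇒IsArc Λ m′
... | i , j , refl , refl , (p , i<j , _) , _ | j′ , k , eq , refl , (q , j<k , _) , _ with toℕ-injective eq
...   | refl = contradiction
  (cong toℕ (match j i k (trans (same-sym (part Λ) j i) p) q (λ e → <⇒≢ i<j (cong toℕ e)) (λ e → <⇒≢ j<k (cong toℕ (sym e)))))
  (<⇒≢ (<-trans i<j j<k))

module _ {N r} (S : ArcSystem N r) where
  open Blocks S hiding (blocks; colPartition; arcs-colPartition)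

  -- The opener of `y` has no opener itself, so it is the root of the class and cannot exceed `x`;
  -- `no-gap` gives the other inequality.
  separated⇒opener : Separated S → ∀ {x y} → x < y → root x ≡ root y → opener y ≡ just x
  separated⇒opener sep {x} {y} x<y eq with has-opener x<y eq
  ... | z , op = trans op (cong just (≤-antisym z≤x (no-gap op eq x<y)))
    where
    first : opener z ≡ nothing
    first with opener z in opz
    ... | nothing = refl
    ... | just w  = contradiction (proj₂ (opener⇒mark op)) (sep (proj₂ (opener⇒mark opz)))
    z≤x : z ≤ x
    z≤x = subst (_≤ x) (trans eq (trans (root-step op) (root-first first))) (root-≤ x)

  separated⇒matching : Separated S → IsMatching (blocks S)
  separated⇒matching sep i j k p q j≢i k≢i = go (F.<-cmp i j) (F.<-cmp i k)
    where
    ij = same⇒root i j p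
    ik = same⇒root i k q
    go : Tri (i F.< j) (i ≡ j) (j F.< i) → Tri (i F.< k) (i ≡ k) (k F.< i) → j ≡ k
    go (tri≈ _ eq _) _ = contradiction (sym eq) j≢i
    go _ (tri≈ _ eq _) = contradiction (sym eq) k≢i
    go (tri< i<j _ _) (tri< i<k _ _) = toℕ-injective
      (opener-injective (separated⇒opener sep i<j ij) (separated⇒opener sep i<k ik))
    go (tri> _ _ j<i) (tri> _ _ k<i) = toℕ-injective (just-injective
      (trans (sym (separated⇒opener sep j<i (sym ij))) (separated⇒opener sep k<i (sym ik))))
    go (tri< i<j _ _) (tri> _ _ k<i) = ⊥-elim (sep
      (proj₂ (opener⇒mark (separated⇒opener sep k<i (sym ik)))) (proj₂ (opener⇒mark (separated⇒opener sep i<j ij))))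
    go (tri> _ _ j<i) (tri< i<k _ _) = ⊥-elim (sep
      (proj₂ (opener⇒mark (separated⇒opener sep j<i (sym ij)))) (proj₂ (opener⇒mark (separated⇒opener sep i<k ik))))

SeparatedStair : ∀ {N r} → ColStair N r → Set
SeparatedStair Z = ∀ {t c c′} → b (stairOf Z c) t ≢ nothing → a (stairOf Z c′) t ≢ nothing → ⊥

toStair-separated : ∀ {N r} (S : ArcSystem N r) → Separated S → SeparatedStair (toStair S)
toStair-separated S sep {t} p q = sep (proj₂ (stair-closer S {t = t} p)) (proj₂ (stair-opener S {t = t} q))

fromStair-separated : ∀ {N r} (Z : ColStair N r) → SeparatedStair Z → Separated (fromStair Z)
fromStair-separated Z sep {c} {c′} {s} {t} {u} m m′ =
  sep {t} {c} {c′} (marks-closer Z {c} {s} {t} m) (marks-opener Z {c′} {t} {u} m′)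

-- One of the two edges at `O` is trivial, so `O` equals the smaller of its neighbors. The shapes
-- `E` alone then determine the staircase of a matching.
separated-O : ∀ {N r} (Z : ColStair N r) → SeparatedStair Z →
              ∀ c t k → O (stairOf Z c) t k ≡ E (stairOf Z c) t k ⊓ E (stairOf Z c) (suc t) k
separated-O Z sep c t k with is-nothing? (b (stairOf Z c) t)
... | inj₁ b≡ = let z = stairOf Z c ; eq = Edge-≡ (edgeᵇ z t) b≡ k in
  trans (sym eq) (sym (m≤n⇒m⊓n≡m (≤-trans (≤-reflexive eq) (Edge-≤ (edgeᵃ z t) k))))
... | inj₂ b≢ = let z = stairOf Z c ; eq = Edge-≡ (edgeᵃ z t) (≢nothing-stable (sep {t} {c} {c} b≢)) k in
  trans (sym eq) (sym (m≥n⇒m⊓n≡n (≤-trans (≤-reflexive eq) (Edge-≤ (edgeᵇ z t) k))))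

separated-≈S : ∀ {N r} (Z Z′ : ColStair N r) → SeparatedStair Z → SeparatedStair Z′ →
               even Z ≈W even Z′ → Z ≈S Z′
separated-≈S Z Z′ sep sep′ eq = record
  { E≡ = λ c t → eq t c
  ; O≡ = λ c t k → trans (separated-O Z sep c t k)
      (trans (cong₂ _⊓_ (eq t c k) (eq (suc t) c k)) (sym (separated-O Z′ sep′ c t k))) }

module _ {N r} (S : ArcSystem N r) (sep : Separated S) where

  matching-walk : Walk r N N
  matching-walk .at-time = even (toStair S)
  matching-walk .w-Decr t c = E-Decr (stairAt S c) t
  matching-walk .w-bound t = vertex-bound S (vertex-E S t)
  matching-walk .w-start c = E-start (stairAt S c)
  matching-walk .w-end t le c = E-end (stairAt S c) t le
  matching-walk .w-step t with any? (λ c → ≢nothing? (a (stairAt S c) t))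
  -- An arc begins at `t`, so none ends there in any color, and `O` coincides with `E` at `t`.
  ... | yes (c₁ , ne) = inj₁ ((λ c → a (stairAt S c) t) ,
    (λ c → Edge-cong (λ k → sym (Edge-≡ (edgeᵇ (stairAt S c) t)
               (≢nothing-stable λ ne′ → toStair-separated S sep {t} {c} {c₁} ne′ ne) k))
             (λ _ → refl) (edgeᵃ (stairAt S c) t)) ,
    exclᵃ (toStair S) t)
  ... | no none = inj₂ ((λ c → b (stairAt S c) t) ,
    (λ c → Edge-cong (λ k → sym (Edge-≡ (edgeᵃ (stairAt S c) t) (≢nothing-stable λ ne → none (c , ne)) k))
             (λ _ → refl) (edgeᵇ (stairAt S c) t)) ,
    exclᵇ (toStair S) t)

-- Restores the diagram that a semi-oscillating tableau leaves out between two steps, chosen as the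
-- smaller neighbor. `apart` then makes the staircase separated, and `moved` finds a label whenever
-- the two diagrams differ.
record Wedge {r} (L M : MultiPart r) : Set where
  field
    middle  : Fin r → Shape
    la lb   : Fin r → Label
    wedgeᵇ  : ∀ c → Edge (middle c) (lb c) (ht (L c))
    wedgeᵃ  : ∀ c → Edge (middle c) (la c) (ht (M c))
    la-excl : Exclusive la
    lb-excl : Exclusive lb
    m-Decr  : ∀ c → Decr (middle c)
    apart   : ∀ {c c′} → lb c ≢ nothing → la c′ ≢ nothing → ⊥
    moved   : (∃ λ c → la c ≢ nothing) ⊎ (∃ λ c → lb c ≢ nothing) ⊎ L ≈M M
open Wedge

wedge : ∀ {r} {L M : MultiPart r} → StepM L M → Wedge L M
wedge {L = L} {M} (inj₁ add) with AddM⇒Up {L = L} {M} add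
... | (l , edges , excl) , moves = record
  { middle = hts L ; la = l ; lb = λ _ → nothing
  ; wedgeᵇ = λ c → Edge-refl (λ _ → refl) ; wedgeᵃ = edges ; la-excl = excl
  ; lb-excl = λ ne → contradiction refl ne ; m-Decr = λ c → Conj-Decr (ht-Conj (L c))
  ; apart = λ ne _ → ne refl ; moved = inj₁ moves }
wedge {L = L} {M} (inj₂ (inj₁ add)) with AddM⇒Up {L = M} {L} add
... | (l , edges , excl) , moves = record
  { middle = hts M ; la = λ _ → nothing ; lb = l
  ; wedgeᵇ = edges ; wedgeᵃ = λ c → Edge-refl (λ _ → refl)
  ; la-excl = λ ne → contradiction refl ne ; lb-excl = excl ; m-Decr = λ c → Conj-Decr (ht-Conj (M c))
  ; apart = λ _ ne → ne refl ; moved = inj₂ (inj₁ moves) }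
wedge {L = L} {M} (inj₂ (inj₂ eq)) = record
  { middle = hts L ; la = λ _ → nothing ; lb = λ _ → nothing
  ; wedgeᵇ = λ c → Edge-refl (λ _ → refl) ; wedgeᵃ = λ c → Edge-refl (ht-cong {L c} {M c} (eq c))
  ; la-excl = λ ne → contradiction refl ne ; lb-excl = λ ne → contradiction refl ne
  ; m-Decr = λ c → Conj-Decr (ht-Conj (L c))
  ; apart = λ _ ne → ne refl ; moved = inj₂ (inj₂ eq) }

module _ {N r} (T : SemiOsc r N) where

  abstract
    wedgeAt : ∀ t → Wedge (extend T t) (extend T (suc t))
    wedgeAt t = wedge {L = extend T t} {extend T (suc t)} (extend-step T t)

  matching-stair : ColStair N r
  matching-stair .stairOf c = record
    { E = λ t → heights T t c
    ; O = λ t → middle (wedgeAt t) c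
    ; a = λ t → la (wedgeAt t) c
    ; b = λ t → lb (wedgeAt t) c
    ; edgeᵇ = λ t → wedgeᵇ (wedgeAt t) c
    ; edgeᵃ = λ t → wedgeᵃ (wedgeAt t) c
    ; E-Decr = λ t → heights-Decr T t c
    ; O-Decr = λ t → m-Decr (wedgeAt t) c
    ; E-start = heights-start T c
    ; E-end = λ t le → heights-end T t le c }
  matching-stair .exclᵃ t = la-excl (wedgeAt t)
  matching-stair .exclᵇ t = lb-excl (wedgeAt t)

  matching-stair-separated : SeparatedStair matching-stair
  matching-stair-separated {t} = apart (wedgeAt t)

  matching-arcs : ArcSystem N r
  matching-arcs = fromStair matching-stair

  matching-arcs-separated : Separated matching-arcs
  matching-arcs-separated {c} {c′} {s} {t} {u} =
    fromStair-separated matching-stair (λ {t} {c} {c′} → matching-stair-separated {t} {c} {c′}) {c} {c′} {s} {t} {u}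

module _ {N r : ℕ} (c₀ : Fin r) where

  toSemiOsc : (Λ : ColPartition N r) → IsMatching (part Λ) → SemiOsc r N
  toSemiOsc Λ match = tableau (matching-walk (arcs Λ) (matching⇒separated Λ match))

  fromSemiOsc : SemiOsc r N → ColPartition N r
  fromSemiOsc T = colPartition (matching-arcs T) c₀

  fromSemiOsc-matching : ∀ T → IsMatching (part (fromSemiOsc T))
  fromSemiOsc-matching T = separated⇒matching (matching-arcs T)
    (λ {c} {c′} {s} {t} {u} → matching-arcs-separated T {c} {c′} {s} {t} {u})

  toSemiOsc-cong : ∀ {Λ Λ′} match match′ → Λ ≈CP Λ′ → toSemiOsc Λ match ≈T toSemiOsc Λ′ match′
  toSemiOsc-cong {Λ} {Λ′} match match′ eq = heights-injective {T = toSemiOsc Λ match} {toSemiOsc Λ′ match′} λ i c k → begin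
    heights (tableau w) i c k   ≡⟨ heights-tableau w i c k ⟩
    at-time w i c k             ≡⟨ E≡ (toStair-cong (arcs Λ) (arcs Λ′) (arcs-cong {Λ = Λ} {Λ′} eq)) c i k ⟩
    at-time w′ i c k            ≡⟨ heights-tableau w′ i c k ⟨
    heights (tableau w′) i c k  ∎
    where
    open ≡-Reasoning
    w  = matching-walk (arcs Λ) (matching⇒separated Λ match)
    w′ = matching-walk (arcs Λ′) (matching⇒separated Λ′ match′)

  fromSemiOsc-cong : ∀ {T T′} → T ≈T T′ → fromSemiOsc T ≈CP fromSemiOsc T′
  fromSemiOsc-cong {T} {T′} eq = colPartition-cong {S = matching-arcs T} {matching-arcs T′}
    (fromStair-cong (matching-stair T) (matching-stair T′)
      (separated-≈S (matching-stair T) (matching-stair T′)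
        (λ {t} {c} {c′} → matching-stair-separated T {t} {c} {c′})
        (λ {t} {c} {c′} → matching-stair-separated T′ {t} {c} {c′})
        (heights-cong {T = T} {T′} eq))) c₀

  fromSemiOsc-toSemiOsc : ∀ Λ match → fromSemiOsc (toSemiOsc Λ match) ≈CP Λ
  fromSemiOsc-toSemiOsc Λ match = ≈CP-trans {Λ = fromSemiOsc T} {colPartition (arcs Λ) c₀} {Λ}
    (colPartition-cong {S = matching-arcs T} {arcs Λ}
      (fromStair-toStair (matching-stair T) (arcs Λ)
        (separated-≈S (matching-stair T) (toStair (arcs Λ))
          (λ {t} {c} {c′} → matching-stair-separated T {t} {c} {c′})
          (λ {t} {c} {c′} → toStair-separated (arcs Λ) sep {t} {c} {c′})
          (heights-tableau (matching-walk (arcs Λ) sep)))) c₀)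
    (colPartition-arcs Λ c₀)
    where
    T = toSemiOsc Λ match
    sep : Separated (arcs Λ)
    sep = matching⇒separated Λ match

  stair≈ : ∀ T → toStair (arcs (fromSemiOsc T)) ≈S matching-stair T
  stair≈ T = toStair-fromStair (matching-stair T) (arcs (fromSemiOsc T)) (arcs-colPartition (matching-arcs T) c₀)

  toSemiOsc-fromSemiOsc : ∀ T match → toSemiOsc (fromSemiOsc T) match ≈T T
  toSemiOsc-fromSemiOsc T match = heights-injective {T = toSemiOsc (fromSemiOsc T) match} {T} λ i c k →
    trans (heights-tableau (matching-walk (arcs (fromSemiOsc T)) (matching⇒separated (fromSemiOsc T) match)) i c k)
          (E≡ (stair≈ T) c i k)

  toSemiOsc-cr-ne : ∀ Λ match j k → 0 < j → 0 < k →
    (CrLess Λ j × NeLess Λ k → Bounded (toSemiOsc Λ match) j k) × (Bounded (toSemiOsc Λ match) j k → CrLess Λ j × NeLess Λ k)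
  toSemiOsc-cr-ne Λ match = cr-ne Λ (tableau w)
    (λ i → let s , d , le , eq = vertex-E (arcs Λ) (toℕ i)
           in s , d , le , λ c k → trans (ht-tableau w i c k) (eq c k))
    (λ t le → fromℕ< (s≤s le) , λ c k → trans (ht-tableau w (fromℕ< (s≤s le)) c k)
       (cong (λ u → at-time w u c k) (toℕ-fromℕ< (s≤s le))))
    where
    w = matching-walk (arcs Λ) (matching⇒separated Λ match)

  semiOsc-bijection : Bij {ColMatching N r} {SemiOsc r N} (λ Λ Λ′ → proj₁ Λ ≈CP proj₁ Λ′) _≈T_
  semiOsc-bijection .to (Λ , match) = toSemiOsc Λ match
  semiOsc-bijection .from T = fromSemiOsc T , fromSemiOsc-matching T
  semiOsc-bijection .to-cong {Λ , match} {Λ′ , match′} eq = toSemiOsc-cong {Λ} {Λ′} match match′ eq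
  semiOsc-bijection .from-cong {T} {T′} eq = fromSemiOsc-cong {T} {T′} eq
  semiOsc-bijection .from-to (Λ , match) = fromSemiOsc-toSemiOsc Λ match
  semiOsc-bijection .to-from T = toSemiOsc-fromSemiOsc T (fromSemiOsc-matching T)

  -- Both edges start at the same `O`, so equal ends force equal labels. In a matching at most one
  -- of the two is nontrivial; a repeated diagram thus means that the point lies on no arc.
  oscillation-labels : ∀ Λ match i → seq (toSemiOsc Λ match) (inject₁ i) ≈M seq (toSemiOsc Λ match) (F.suc i) →
    ∀ c → a (stairAt (arcs Λ) c) (toℕ i) ≡ b (stairAt (arcs Λ) c) (toℕ i)
  oscillation-labels Λ match i eq c = Edge-label-unique (edgeᵃ z (toℕ i)) (edgeᵇ z (toℕ i)) (λ _ → refl) λ k → begin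
    E z (suc (toℕ i)) k              ≡⟨ ht-tableau w (F.suc i) c k ⟨
    ht (seq T (F.suc i) c) k         ≡⟨ ht-cong {seq T (inject₁ i) c} {seq T (F.suc i) c} (eq c) k ⟨
    ht (seq T (inject₁ i) c) k       ≡⟨ ht-tableau w (inject₁ i) c k ⟩
    E z (toℕ (inject₁ i)) k          ≡⟨ cong (λ t → E z t k) (toℕ-inject₁ i) ⟩
    E z (toℕ i) k                    ∎
    where
    open ≡-Reasoning
    z = stairAt (arcs Λ) c
    w = matching-walk (arcs Λ) (matching⇒separated Λ match)
    T = toSemiOsc Λ match

  Covered : ArcSystem N r → ℕ → Set
  Covered S t = (∃ λ c → ∃ λ u → marks S c t u ≡ true) ⊎ (∃ λ c → ∃ λ s → marks S c s t ≡ true)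

  complete⇒covered : ∀ Λ → IsCompleteMatching (part Λ) → ∀ i → Covered (arcs Λ) (toℕ i)
  complete⇒covered Λ (match , partner) i with partner i
  ... | j , j≢i , p with F.<-cmp i j
  ...   | tri≈ _ eq _ = contradiction (sym eq) j≢i
  ...   | tri> _ _ j<i with Arc-exists (part Λ) j<i (trans (same-sym (part Λ) j i) p)
  ...     | z , _ , arc = inj₂ (_ , _ , IsArc⇒marks Λ (z , i , refl , refl , arc , refl))
  complete⇒covered Λ (match , partner) i | j , j≢i , p | tri< i<j _ _ with Arc-exists (part Λ) i<j p
  ...     | z , _ , arc@(q , z<j , _)
    -- Both `i` and `z` are partners of `j`, so they coincide and the arc found begins at `i`.
    with match j i z (trans (same-sym (part Λ) j i) p) (trans (same-sym (part Λ) j z) q)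
           (j≢i ∘ sym) (λ eq → <⇒≢ z<j (cong toℕ eq))
  ...       | refl = inj₁ (_ , _ , IsArc⇒marks Λ (i , j , refl , refl , arc , refl))

  covered⇒partner : ∀ Λ i → Covered (arcs Λ) (toℕ i) → ∃ λ j → j ≢ i × same (part Λ) i j ≡ true
  covered⇒partner Λ i (inj₁ (c , u , m)) with marks⇒IsArc Λ m
  ... | i′ , j , eq , _ , (p , i<j , _) , _ with toℕ-injective eq
  ...   | refl = j , (λ e → <⇒≢ i<j (cong toℕ (sym e))) , p
  covered⇒partner Λ i (inj₂ (c , s , m)) with marks⇒IsArc Λ m
  ... | j , i′ , _ , eq , (p , j<i , _) , _ with toℕ-injective eq
  ...   | refl = j , (λ e → <⇒≢ j<i (cong toℕ e)) , trans (same-sym (part Λ) i j) p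

  toSemiOsc-oscillating : ∀ Λ (complete : IsCompleteMatching (part Λ)) → IsOscillating (toSemiOsc Λ (proj₁ complete))
  toSemiOsc-oscillating Λ complete@(match , _) i eq with complete⇒covered Λ complete i
  ... | inj₁ (c , u , m) = toStair-separated S sep {toℕ i} {c} {c}
          (subst (_≢ nothing) (a≡b c) (opener-stair S m)) (opener-stair S m)
    where
    S = arcs Λ
    sep : Separated S
    sep = matching⇒separated Λ match
    a≡b = oscillation-labels Λ match i eq
  ... | inj₂ (c , s , m) = toStair-separated S sep {toℕ i} {c} {c}
          (closer-stair S m) (subst (_≢ nothing) (sym (a≡b c)) (closer-stair S m))
    where
    S = arcs Λ
    sep : Separated S
    sep = matching⇒separated Λ match
    a≡b = oscillation-labels Λ match i eq

  -- Every step of an oscillating tableau changes the diagram, so its wedge has a label, and a label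
  -- at `i` stands for an arc that begins or ends there.
  fromSemiOsc-complete : ∀ T → IsOscillating T → IsCompleteMatching (part (fromSemiOsc T))
  fromSemiOsc-complete T osc = fromSemiOsc-matching T , λ i → covered⇒partner (fromSemiOsc T) i (covered i)
    where
    S = arcs (fromSemiOsc T)
    covered : ∀ i → Covered S (toℕ i)
    covered i with moved (wedgeAt T (toℕ i))
    ... | inj₁ (c , ne) = inj₁ (c , stair-opener S {t = toℕ i} (subst (_≢ nothing) (sym (a≡ (stair≈ T) c (toℕ i))) ne))
    ... | inj₂ (inj₁ (c , ne)) = inj₂ (c , stair-closer S {t = toℕ i} (subst (_≢ nothing) (sym (b≡ (stair≈ T) c (toℕ i))) ne))
    ... | inj₂ (inj₂ same) = contradiction
      (subst₂ _≈M_ (trans (cong (extend T) (sym (toℕ-inject₁ i))) (extend-toℕ T (inject₁ i))) (extend-toℕ T (F.suc i)) same)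
      (osc i)

  oscillating-bijection : Bij {ColCompleteMatching N r} {Oscillating r N}
    (λ Λ Λ′ → proj₁ Λ ≈CP proj₁ Λ′) (λ T T′ → proj₁ T ≈T proj₁ T′)
  oscillating-bijection .to (Λ , complete) = toSemiOsc Λ (proj₁ complete) , toSemiOsc-oscillating Λ complete
  oscillating-bijection .from (T , osc) = fromSemiOsc T , fromSemiOsc-complete T osc
  oscillating-bijection .to-cong {Λ , complete} {Λ′ , complete′} eq =
    toSemiOsc-cong {Λ} {Λ′} (proj₁ complete) (proj₁ complete′) eq
  oscillating-bijection .from-cong {T , _} {T′ , _} eq = fromSemiOsc-cong {T} {T′} eq
  oscillating-bijection .from-to (Λ , complete) = fromSemiOsc-toSemiOsc Λ (proj₁ complete)
  oscillating-bijection .to-from (T , osc) = toSemiOsc-fromSemiOsc T (fromSemiOsc-matching T)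

theorem3p3 : ∀ (n r : ℕ) → 0 < n → 0 < r →
    (Σ (Bij {ColPartition n r} {Vacillating r (2 * n)}
    _≈CP_ (λ T T' → proj₁ T ≈T proj₁ T')) λ b →
    CrNeProp (λ Λ → Λ) proj₁ (to b)) ×
    (Σ (Bij {ColMatching n r} {SemiOsc r n}
    (λ Λ Λ' → proj₁ Λ ≈CP proj₁ Λ') _≈T_) λ b →
    CrNeProp proj₁ (λ T → T) (to b)) ×
    (Σ (Bij {ColCompleteMatching (2 * n) r} {Oscillating r (2 * n)}
    (λ Λ Λ' → proj₁ Λ ≈CP proj₁ Λ') (λ T T' → proj₁ T ≈T proj₁ T')) λ b →
    CrNeProp proj₁ proj₁ (to b))
theorem3p3 n (suc r) _ _ =
  -- As `r` is positive, `F.zero` is available as the default color of pairs that are no arcs.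
  (vacillating-bijection F.zero , vacillating-cr-ne F.zero) ,
  (semiOsc-bijection F.zero , λ (Λ , match) → toSemiOsc-cr-ne F.zero Λ match) ,
  (oscillating-bijection F.zero , λ (Λ , complete) → toSemiOsc-cr-ne F.zero Λ (proj₁ complete))
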